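{- For every $k\ge 2$ there exists a $C^{\omega}_{\infty\omega}$-sentence $\varphi$ with $O(k)$ many variables (the constant in $O(\cdot)$ being independent of $k$) such that, given (a structural encoding of) a system $\mathcal P$ of polynomials over $\mathbb Q$ as input for the polynomial calculus of degree $k$, $\varphi$ expresses whether $\mathcal P$ can be refuted in $\mathrm{PC}_k$; that is, $\varphi$ holds in the encoding of $\mathcal P$ if and only if the constant polynomial $1$ is derivable from $\mathcal P$ in $\mathrm{PC}_k$ over $\mathbb Q$.
   Context: All structures are finite and relational. $C^\omega_{\infty\omega}$ is infinitary counting logic: first-order logic extended by infinite conjunctions and disjunctions and by counting quantifiers $\exists^{\ge i}x$, where each formula uses only finitely many (free or bound) variables. Polynomial calculus over $\mathbb Q$: inputs are systems $\mathcal P\subseteq\mathbb Q[\mathcal X]$ of polynomials (read as equations $p=0$), always containing $X^2-X$ for every variable $X$. The polynomial calculus has the rules: from $f$ infer $Xf$ for a variable $X$ (multiplication); from $f,g$ infer $ag+bf$ for $a,b\in\mathbb Q$ (linear combination). A refutation of $\mathcal P$ is a derivation of the constant polynomial $1$ from the axioms $\mathcal P$. Because of the axioms $X^2-X$ all polynomials are implicitly multilinearised. $\mathrm{PC}_k$ is the restriction to derivations using only polynomials of degree at most $k$, with no restriction on the size of the coefficients. Systems $\mathcal P$ are encoded naturally as many-sorted structures whose universe is partitioned into the polynomials, multilinear monomials, variables and rational coefficients occurring in $\mathcal P$, rationals being represented as fractions of integers in binary over a linear order of sufficient length provided in the structure. -}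

module Defs where

open import Data.Bool.Base using (Bool; T; if_then_else_)
open import Data.Empty using (⊥)
open import Data.Fin.Base using (Fin; toℕ)
open import Data.Fin.Subset using (Subset; ∣_∣; ⁅_⁆; _-_) renaming (⊥ to ∅; _∈_ to _∈ₛ_)
open import Data.Integer.Base as ℤ using (0ℤ)
open import Data.Nat.Base using (ℕ; NonZero; _<_; _≤_; _^_; _/_; _%_)
open import Data.Nat.Properties using (m^n≢0)
open import Data.Product.Base using (Σ-syntax; ∃-syntax; _×_)
open import Data.Rational.Base as ℚ using (ℚ; 0ℚ; 1ℚ; toℚᵘ)
open import Data.Rational.Unnormalised.Base as ℚᵘ using (ℚᵘ; ↥_; ↧ₙ_)
open import Data.Sum.Base using (_⊎_)
open import Data.Unit.Base using (⊤)
open import Data.Vec.Base using (Vec; []; _∷_; map; lookup)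
open import Data.Vec.Functional using (updateAt)
open import Data.Vec.Membership.Propositional using (_∈_)
open import Data.Vec.Properties using (≡-dec)
import Data.Bool.Properties as Bool
open import Function.Base using (const)
open import Function.Bundles using (_⇔_)
open import Function.Definitions using (Injective)
open import Relation.Binary.PropositionalEquality using (_≡_; _≢_; _≗_)
open import Relation.Nullary.Decidable.Core using (does)
open import Relation.Nullary.Negation.Core using (¬_)

------------------------------------------------------------------------
-- Finite relational structures and infinitary counting logic

record Signature : Set₁ where
  field
    Symbol : Set
    arity  : Symbol → ℕ

open Signature public

-- The universe is Fin size, non-empty as usual in model theory.
record Structure (τ : Signature) : Set where
  field
    size         : ℕ
    {{nonEmpty}} : NonZero size
    rel          : (R : Symbol τ) → Vec (Fin size) (arity τ R) → Bool

  Universe : Set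
  Universe = Fin size

open Structure public

-- Formula τ w is the fragment with the w variables Fin w, each of which may
-- occur free and may be requantified; C^ω_∞ω is the union over all w.
-- Binary connectives are ⋀ and ⋁ over a two-element index set.
data Formula (τ : Signature) (w : ℕ) : Set₁ where
  _≐_  : Fin w → Fin w → Formula τ w
  atom : (R : Symbol τ) → Vec (Fin w) (arity τ R) → Formula τ w
  neg  : Formula τ w → Formula τ w
  ⋀ ⋁  : {I : Set} → (I → Formula τ w) → Formula τ w
  all  : Fin w → Formula τ w → Formula τ w
  ex   : Fin w → Formula τ w → Formula τ w
  ex≥  : ℕ → Fin w → Formula τ w → Formula τ w

module _ {τ : Signature} {w : ℕ} where

  Free : Fin w → Formula τ w → Set
  Free y (x ≐ z)     = y ≡ x ⊎ y ≡ z
  Free y (atom R xs) = y ∈ xs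
  Free y (neg φ)     = Free y φ
  Free y (⋀ φ)       = ∃[ i ] Free y (φ i)
  Free y (⋁ φ)       = ∃[ i ] Free y (φ i)
  Free y (all x φ)   = y ≢ x × Free y φ
  Free y (ex x φ)    = y ≢ x × Free y φ
  Free y (ex≥ i x φ) = y ≢ x × Free y φ

  IsSentence : Formula τ w → Set
  IsSentence φ = ∀ y → ¬ Free y φ

  module _ (A : Structure τ) where

    Assignment : Set
    Assignment = Fin w → Universe A

    _[_↦_] : Assignment → Fin w → Universe A → Assignment
    α [ x ↦ u ] = updateAt α x (const u)

    Sat : Assignment → Formula τ w → Set
    Sat α (x ≐ z)     = α x ≡ α z
    Sat α (atom R xs) = T (rel A R (map α xs))
    Sat α (neg φ)     = ¬ Sat α φ
    Sat α (⋀ φ)       = ∀ i → Sat α (φ i)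
    Sat α (⋁ φ)       = ∃[ i ] Sat α (φ i)
    Sat α (all x φ)   = ∀ u → Sat (α [ x ↦ u ]) φ
    Sat α (ex x φ)    = ∃[ u ] Sat (α [ x ↦ u ]) φ
    Sat α (ex≥ i x φ) = Σ[ us ∈ (Fin i → Universe A) ]
      Injective _≡_ _≡_ us × (∀ j → Sat (α [ x ↦ us j ]) φ)

  -- For a sentence the choice of the assignment is immaterial, and one exists
  -- because the universe is non-empty.
  _⊨_ : Structure τ → Formula τ w → Set
  A ⊨ φ = ∀ α → Sat A α φ

------------------------------------------------------------------------
-- Multilinear polynomials over ℚ in the variables Fin n

-- A multilinear monomial is the set of its variables.
Monomial : ℕ → Set
Monomial n = Subset n

-- A polynomial is the function listing its coefficients; polynomials are
-- compared by pointwise equality _≗_.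
Poly : ℕ → Set
Poly n = Monomial n → ℚ

module _ {n : ℕ} where

  mono : Monomial n → Poly n
  mono m m′ = if does (≡-dec Bool._≟_ m m′) then 1ℚ else 0ℚ

  one : Poly n
  one = mono ∅

  var : Fin n → Poly n
  var x = mono ⁅ x ⁆

  -- The multilinearisation of X · f.  Multiplication by X sends a monomial m′
  -- to m′ ∪ {X}, so a monomial m containing X arises from exactly m and m ∖ {X},
  -- and a monomial not containing X does not arise.
  _·_ : Fin n → Poly n → Poly n
  (x · f) m = if lookup m x then f m ℚ.+ f (m - x) else 0ℚ

  lin : ℚ → Poly n → ℚ → Poly n → Poly n
  lin a g b f m = a ℚ.* g m ℚ.+ b ℚ.* f m

  Degree≤ : ℕ → Poly n → Set
  Degree≤ k f = ∀ m → k < ∣ m ∣ → f m ≡ 0ℚ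

-- A finite set of multilinear polynomials, enumerated without repetition.
-- The polynomials X² - X are not listed: they are axioms of every system (see
-- boolean below), and multilinearise to 0.
record System : Set where
  field
    #vars    : ℕ
    #polys   : ℕ
    poly     : Fin #polys → Poly #vars
    distinct : ∀ i j → poly i ≗ poly j → i ≡ j

open System public

------------------------------------------------------------------------
-- Degree-k polynomial calculus

-- Every line of a derivation has degree at most k; for lin this is inherited
-- from the premises.  resp only identifies pointwise equal functions.
data Derivable (k : ℕ) (P : System) : Poly (#vars P) → Set where
  axiom   : ∀ i → Degree≤ k (poly P i) → Derivable k P (poly P i)
  boolean : ∀ x → let X²-X = lin 1ℚ (x · var x) (ℚ.- 1ℚ) (var x) in
            Degree≤ k X²-X → Derivable k P X²-X
  mult    : ∀ {f} x → Derivable k P f → Degree≤ k (x · f) → Derivable k P (x · f)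
  lincomb : ∀ {f g} a b → Derivable k P f → Derivable k P g →
            Derivable k P (lin a g b f)
  resp    : ∀ {f g} → f ≗ g → Derivable k P f → Derivable k P g

Refutable : ℕ → System → Set
Refutable k P = Derivable k P one

------------------------------------------------------------------------
-- Encoding systems as finite structures

-- A many-sorted universe is a one-sorted one partitioned by the unary
-- predicates isPoly, …, isPos.  isPos is the sort of bit positions.
data SystemSymbol : Set where
  isPoly isMon isVar isCoef isPos : SystemSymbol
  occursIn                        : SystemSymbol
  hasCoef                         : SystemSymbol
  leq                             : SystemSymbol
  negative numBit denBit          : SystemSymbol

systemSignature : Signature
systemSignature = record { Symbol = SystemSymbol ; arity = ar }
  where
  ar : SystemSymbol → ℕ
  ar isPoly   = 1
  ar isMon    = 1
  ar isVar    = 1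
  ar isCoef   = 1
  ar isPos    = 1
  ar occursIn = 2
  ar hasCoef  = 3
  ar leq      = 2
  ar negative = 1
  ar numBit   = 2
  ar denBit   = 2

Bit : ℕ → ℕ → Set
Bit i a = (a / 2 ^ i) {{m^n≢0 2 i}} % 2 ≡ 1

-- L is the number of bit positions.
module _ (P : System) (L : ℕ) where

  data Element : Set where
    polyE : Fin (#polys P) → Element
    monE  : Monomial (#vars P) → Element
    varE  : Fin (#vars P) → Element
    coefE : ℚ → Element
    posE  : Fin L → Element

  -- Every variable occurs, since it occurs in its axiom X² - X.
  Occurs : Element → Set
  Occurs (polyE i) = ⊤
  Occurs (monE m)  = ∃[ i ] poly P i m ≢ 0ℚ
  Occurs (varE x)  = ⊤
  Occurs (coefE q) = q ≢ 0ℚ × (∃[ i ] ∃[ m ] poly P i m ≡ q)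
  Occurs (posE b)  = ⊤

  -- frac chooses for each coefficient a representation as a fraction, not
  -- necessarily in lowest terms.  Bit position b has weight 2 ^ toℕ b.
  Holds : (ℚ → ℚᵘ) → (R : SystemSymbol) → Vec Element (arity systemSignature R) → Set
  Holds _    isPoly   (polyE i ∷ [])                     = ⊤
  Holds _    isMon    (monE m ∷ [])                      = ⊤
  Holds _    isVar    (varE x ∷ [])                      = ⊤
  Holds _    isCoef   (coefE q ∷ [])                     = ⊤
  Holds _    isPos    (posE b ∷ [])                      = ⊤
  Holds _    occursIn (varE x ∷ monE m ∷ [])             = x ∈ₛ m
  Holds _    hasCoef  (polyE i ∷ monE m ∷ coefE q ∷ [])  = poly P i m ≡ q
  Holds _    leq      (posE b ∷ posE b′ ∷ [])            = toℕ b ≤ toℕ b′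
  Holds frac negative (coefE q ∷ [])                     = ↥ frac q ℤ.< 0ℤ
  Holds frac numBit   (coefE q ∷ posE b ∷ [])            = Bit (toℕ b) ℤ.∣ ↥ frac q ∣
  Holds frac denBit   (coefE q ∷ posE b ∷ [])            = Bit (toℕ b) (↧ₙ frac q)
  Holds _    _        _                                  = ⊥

-- A is, up to isomorphism, the structure of the occurring elements of P.
record Encodes (A : Structure systemSignature) (P : System) : Set where
  field
    L    : ℕ
    frac : ℚ → ℚᵘ

  Elt : Set
  Elt = Element P L

  field
    frac-value : ∀ q → Occurs P L (coefE q) → frac q ℚᵘ.≃ toℚᵘ q
    num-fits   : ∀ q → Occurs P L (coefE q) → ℤ.∣ ↥ frac q ∣ < 2 ^ L
    den-fits   : ∀ q → Occurs P L (coefE q) → ↧ₙ frac q < 2 ^ L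

    decode           : Universe A → Elt
    decode-injective : Injective _≡_ _≡_ decode
    decode-occurs    : ∀ u → Occurs P L (decode u)
    decode-covers    : ∀ e → Occurs P L e → ∃[ u ] decode u ≡ e

    rel-correct : ∀ R us → T (rel A R us) ⇔ Holds P L frac R (map decode us)

-- The polynomials of degree ≤ k that are derivable in PC_k form a subspace V.
-- Name the monomials of degree ≤ k by k-tuples of elements.  Then V is the row
-- space of a matrix indexed by pairs of k-tuples, and this matrix can be
-- built up from the axioms without any choice: the sum of the row spaces of M
-- and N is the row space of MᵀM + NᵀN, and the part of the row space of M that
-- may be multiplied by a variable X (its product has degree ≤ k) consists of
-- the combinations K M with K R = 0, where R collects the columns of M that
-- violate the bound.  Since RRᵀ is symmetric over ℚ, a suitable K is a
-- polynomial in RRᵀ, so no elimination, which depends on an order, is needed.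
-- The coefficients of these polynomials depend on the system, but an infinite
-- disjunction ranges over all of them: a wrong choice is harmless because rows
-- that still violate the bound are dropped.
-- The entries of a product of two such matrices are sums over k-tuples, so that
-- three k-tuples of variables and a few single ones suffice.  A sum of rationals
-- is determined by the number of times each value occurs, which is what counting
-- quantifiers express.

module Submission where

open import Defs
open import Data.Bool.Base using (Bool; true; false; if_then_else_)
import Data.Bool.Base as Bool
import Data.Bool.Properties as Boolₚ
open import Data.Empty using (⊥; ⊥-elim)
open import Data.Fin.Base using (Fin; zero; suc; toℕ; fromℕ<; inject≤; combine; splitAt; _↑ˡ_; _↑ʳ_)
open import Data.Fin.Patterns
import Data.Fin.Properties as Finₚ
open import Data.Fin.Subset using (Subset; inside; outside; ∣_∣; ⁅_⁆; _-_; _∪_)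
  renaming (⊥ to ∅; _∈_ to _∈ₛ_; _∉_ to _∉ₛ_)
open import Data.Fin.Subset.Properties renaming (_∈?_ to _∈ₛ?_)
open import Data.Integer.Base as ℤ using (0ℤ; -[1+_])
import Data.Integer.Properties as ℤₚ
open import Data.List.Base as List using (List; []; _∷_; _++_; length; filter; allFin; foldr; cartesianProductWith)
open import Data.List.Properties using (length-map; length-tabulate; length-++-sucʳ)
open import Data.List.Membership.Propositional using () renaming (_∈_ to _∈ₗ_; _∉_ to _∉ₗ_)
open import Data.List.Membership.Propositional.Properties
  using (∈-allFin; ∈-map⁺; ∈-map⁻; ∈-filter⁺; ∈-filter⁻; ∈-∃++; ∈-cartesianProduct⁺; ∈-cartesianProductWith⁺)
  renaming (∈-lookup to ∈ₗ-lookup)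
open import Data.List.Membership.Setoid.Properties using (index-injective)
open import Data.List.Relation.Binary.Permutation.Propositional.Properties using (↭-length; filter-↭) renaming (shift to ↭-shift)
import Data.List.Relation.Unary.All as All
import Data.List.Relation.Unary.All.Properties as All
open import Data.List.Relation.Unary.AllPairs using ([]; _∷_)
open import Data.List.Relation.Unary.Any using (Any; here; there; index)
import Data.List.Relation.Unary.Any.Properties as Any
open import Data.List.Relation.Unary.Unique.Propositional using (Unique)
import Data.List.Relation.Unary.Unique.Propositional.Properties as Unique
open import Data.Nat.Base as ℕ using (ℕ; zero; suc; _<_; _≤_; s≤s; z≤n; _^_)
import Data.Nat.Properties as ℕₚ
open import Data.Nat.DivMod using (_/_; _%_; m≡m%n+[m/n]*n; m/n/o≡m/[n*o]; m<n⇒m/n≡0; m/n<m; m%n<n; n/1≡n)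
open import Data.Nat.Induction using (<-rec)
open import Data.Product.Base using (Σ-syntax; ∃-syntax; _×_; _,_; proj₁; proj₂)
open import Data.Rational.Base as ℚ using (ℚ; 0ℚ; 1ℚ; ≢-nonZero; toℚᵘ)
import Data.Rational.Properties as ℚₚ
open import Data.Rational.Solver using (module +-*-Solver)
open import Data.Rational.Unnormalised.Base as ℚᵘ using (ℚᵘ; mkℚᵘ; ↥_; ↧ₙ_)
import Data.Rational.Unnormalised.Properties as ℚᵘₚ
open import Data.Sum.Base using (_⊎_; inj₁; inj₂)
open import Data.Unit.Base using (⊤; tt)
open import Data.Vec.Base as Vec using (Vec; []; _∷_; here; there; tabulate; lookup; updateAt; _[_]≔_)
import Data.Vec.Functional as Fun
import Data.Vec.Functional.Properties as Funₚ
open import Data.Vec.Membership.Propositional using (_∈_)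
open import Data.Vec.Membership.Propositional.Properties using (∈-lookup)
open import Data.Vec.Properties as Vecₚ using (≡-dec; []=⇒lookup; lookup⇒[]=; lookup∘tabulate)
import Data.Vec.Relation.Unary.Any as VecAny
open import Data.Vec.Relation.Unary.Any.Properties using (lookup-index)
open import Function.Base using (_∘_; const; id)
open import Function.Bundles using (_⇔_; mk⇔; Equivalence)
open import Function.Definitions using (Injective)
open import Relation.Binary.PropositionalEquality
  using (_≡_; _≢_; _≗_; refl; sym; trans; cong; cong₂; subst; subst₂; setoid; module ≡-Reasoning)
open import Relation.Nullary using (Dec; yes; no; ¬_; contradiction; does)
open import Relation.Nullary.Decidable as Dec using (dec-true; dec-false; map′; _×-dec_; _⊎-dec_; ¬?)
open +-*-Solver using (solve; _:=_; _:+_; _:*_; :-_; con)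

-- The disjunction in the sentence ranges over codes as well as coefficients. A code is a finite
-- tree that copies the shape of a derivation, so V is never saturated: there is no fixed point and
-- no bound on the length of derivations. Every code is sound, and every derivable polynomial lies
-- in the row space of some code. Gram matrices keep the row space because ℚ is ordered: a sum of
-- squares vanishes only termwise. The same fact cancels factors of a symmetric matrix in a
-- polynomial relation between its powers, which yields the polynomials that replace elimination.
-- They have no constant term, because the rows of the identity matrix need not be derivable. Two
-- obstacles come from naming. A monomial has many names among the k-tuples, so multiplication by a
-- variable has to be weighted by the number of names. A monomial of fewer than k variables needs a
-- padding element that is not a variable; the element of a polynomial is used, and a system without
-- polynomials is never refutable.

-- Linear algebra over ℚ with order-independent operations

module LinearAlgebra where

  open import Data.Rational.Base using (_+_; _*_; -_; 1/_)

  private variable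
    X Y I J K L : Set

  ∑ : List X → (X → ℚ) → ℚ
  ∑ []       f = 0ℚ
  ∑ (x ∷ xs) f = f x + ∑ xs f

  ∑-cong : ∀ (xs : List X) {f g : X → ℚ} → f ≗ g → ∑ xs f ≡ ∑ xs g
  ∑-cong []       f≗g = refl
  ∑-cong (x ∷ xs) f≗g = cong₂ _+_ (f≗g x) (∑-cong xs f≗g)

  ∑-0 : ∀ (xs : List X) → ∑ xs (λ _ → 0ℚ) ≡ 0ℚ
  ∑-0 []       = refl
  ∑-0 (x ∷ xs) = trans (ℚₚ.+-identityˡ _) (∑-0 xs)

  ∑-+ : ∀ (xs : List X) (f g : X → ℚ) → ∑ xs (λ x → f x + g x) ≡ ∑ xs f + ∑ xs g
  ∑-+ []       f g = refl
  ∑-+ (x ∷ xs) f g = trans (cong (f x + g x +_) (∑-+ xs f g))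
    (solve 4 (λ a b c d → (a :+ b) :+ (c :+ d) := (a :+ c) :+ (b :+ d)) refl (f x) (g x) (∑ xs f) (∑ xs g))

  ∑-*ˡ : ∀ (xs : List X) a (f : X → ℚ) → ∑ xs (λ x → a * f x) ≡ a * ∑ xs f
  ∑-*ˡ []       a f = sym (ℚₚ.*-zeroʳ a)
  ∑-*ˡ (x ∷ xs) a f = trans (cong (a * f x +_) (∑-*ˡ xs a f)) (sym (ℚₚ.*-distribˡ-+ a _ _))

  ∑-*ʳ : ∀ (xs : List X) (f : X → ℚ) a → ∑ xs (λ x → f x * a) ≡ ∑ xs f * a
  ∑-*ʳ xs f a = trans (∑-cong xs (λ x → ℚₚ.*-comm (f x) a))
    (trans (∑-*ˡ xs a f) (ℚₚ.*-comm a _))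

  ∑-swap : ∀ (xs : List X) (ys : List Y) (f : X → Y → ℚ) →
           ∑ xs (λ x → ∑ ys (f x)) ≡ ∑ ys (λ y → ∑ xs (λ x → f x y))
  ∑-swap []       ys f = sym (∑-0 ys)
  ∑-swap (x ∷ xs) ys f = trans (cong (∑ ys (f x) +_) (∑-swap xs ys f)) (sym (∑-+ ys _ _))

  ∑-++ : ∀ (xs ys : List X) f → ∑ (xs ++ ys) f ≡ ∑ xs f + ∑ ys f
  ∑-++ []       ys f = sym (ℚₚ.+-identityˡ _)
  ∑-++ (x ∷ xs) ys f = trans (cong (f x +_) (∑-++ xs ys f)) (sym (ℚₚ.+-assoc (f x) _ _))

  ∑-map : ∀ (g : X → Y) xs f → ∑ (List.map g xs) f ≡ ∑ xs (f ∘ g)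
  ∑-map g []       f = refl
  ∑-map g (x ∷ xs) f = cong (f (g x) +_) (∑-map g xs f)

  ∑-cartesianProductWith : ∀ (h : X → Y → K) xs ys f →
    ∑ (cartesianProductWith h xs ys) f ≡ ∑ xs (λ x → ∑ ys (f ∘ h x))
  ∑-cartesianProductWith h []       ys f = refl
  ∑-cartesianProductWith h (x ∷ xs) ys f =
    trans (∑-++ (List.map (h x) ys) _ f)
      (cong₂ _+_ (∑-map (h x) ys f) (∑-cartesianProductWith h xs ys f))

  0≤a*a : ∀ a → 0ℚ ℚ.≤ a * a
  0≤a*a a with ℚₚ.≤-total 0ℚ a
  ... | inj₁ 0≤a = subst (ℚ._≤ a * a) (ℚₚ.*-zeroʳ a)
    (ℚₚ.*-monoˡ-≤-nonNeg a {{ℚ.nonNegative 0≤a}} 0≤a)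
  ... | inj₂ a≤0 = subst (ℚ._≤ a * a) (ℚₚ.*-zeroʳ a)
    (ℚₚ.*-monoˡ-≤-nonPos a {{ℚ.nonPositive a≤0}} a≤0)

  a*a≡0⇒a≡0 : ∀ a → a * a ≡ 0ℚ → a ≡ 0ℚ
  a*a≡0⇒a≡0 a a²≡0 with a ℚₚ.≟ 0ℚ
  ... | yes a≡0 = a≡0
  ... | no  a≢0 = begin
    a                 ≡⟨ ℚₚ.*-identityˡ a ⟨
    1ℚ * a            ≡⟨ cong (_* a) (ℚₚ.*-inverseˡ a) ⟨
    1/ a * a * a      ≡⟨ ℚₚ.*-assoc (1/ a) a a ⟩
    1/ a * (a * a)    ≡⟨ cong (1/ a *_) a²≡0 ⟩
    1/ a * 0ℚ         ≡⟨ ℚₚ.*-zeroʳ (1/ a) ⟩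
    0ℚ                ∎
    where
    open ≡-Reasoning
    instance _ = ≢-nonZero a≢0

  +-nonNeg : ∀ {a b} → 0ℚ ℚ.≤ a → 0ℚ ℚ.≤ b → 0ℚ ℚ.≤ a + b
  +-nonNeg {a} {b} 0≤a 0≤b = subst (ℚ._≤ a + b) (ℚₚ.+-identityˡ 0ℚ) (ℚₚ.+-mono-≤ 0≤a 0≤b)

  nonNeg+nonNeg≡0 : ∀ {a b} → 0ℚ ℚ.≤ a → 0ℚ ℚ.≤ b → a + b ≡ 0ℚ → a ≡ 0ℚ × b ≡ 0ℚ
  nonNeg+nonNeg≡0 {a} {b} 0≤a 0≤b a+b≡0 =
    ℚₚ.≤-antisym (subst₂ ℚ._≤_ (ℚₚ.+-identityʳ a) a+b≡0 (ℚₚ.+-monoʳ-≤ a 0≤b)) 0≤a ,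
    ℚₚ.≤-antisym (subst₂ ℚ._≤_ (ℚₚ.+-identityˡ b) a+b≡0 (ℚₚ.+-monoˡ-≤ b 0≤a)) 0≤b

  ∑-nonNeg : ∀ (xs : List X) f → (∀ x → 0ℚ ℚ.≤ f x) → 0ℚ ℚ.≤ ∑ xs f
  ∑-nonNeg []       f 0≤f = ℚₚ.≤-refl
  ∑-nonNeg (x ∷ xs) f 0≤f = +-nonNeg (0≤f x) (∑-nonNeg xs f 0≤f)

  ∑≡0⇒≡0 : ∀ (xs : List X) f → (∀ x → 0ℚ ℚ.≤ f x) → ∑ xs f ≡ 0ℚ → ∀ {x} → x ∈ₗ xs → f x ≡ 0ℚ
  ∑≡0⇒≡0 (x ∷ xs) f 0≤f eq x∈ with nonNeg+nonNeg≡0 (0≤f x) (∑-nonNeg xs f 0≤f) eq | x∈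
  ... | fx≡0 , _ | here refl = fx≡0
  ... | _ , eq′  | there x∈′ = ∑≡0⇒≡0 xs f 0≤f eq′ x∈′

  ∑-*-≡0⇒≡0 : ∀ (xs : List X) (f : X → ℚ) → ∑ xs (λ x → f x * f x) ≡ 0ℚ → ∀ {x} → x ∈ₗ xs → f x ≡ 0ℚ
  ∑-*-≡0⇒≡0 xs f eq x∈ = a*a≡0⇒a≡0 _ (∑≡0⇒≡0 xs _ (λ x → 0≤a*a (f x)) eq x∈)

  -- Repetitions are allowed; sums count elements with multiplicity.
  record Enum (X : Set) : Set where
    field
      elements : List X
      complete : ∀ x → x ∈ₗ elements

  open Enum public

  sum : Enum X → (X → ℚ) → ℚ
  sum e = ∑ (elements e)

  Matrix : Set → Set → Set
  Matrix I J = I → J → ℚ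

  infix 4 _≋_
  _≋_ : Matrix I J → Matrix I J → Set
  M ≋ N = ∀ i j → M i j ≡ N i j

  infixr 7 _∙[_]_
  _∙[_]_ : Matrix I J → Enum J → Matrix J K → Matrix I K
  (M ∙[ e ] N) i k = sum e (λ j → M i j * N j k)

  _ᵀ : Matrix I J → Matrix J I
  (M ᵀ) j i = M i j

  Symmetric : Matrix J J → Set
  Symmetric S = S ᵀ ≋ S

  0ᴹ : Matrix I J
  0ᴹ _ _ = 0ℚ

  infixl 6 _⊕_ _⊖_
  infixr 7 _⊛_
  _⊕_ _⊖_ : Matrix I J → Matrix I J → Matrix I J
  (M ⊕ N) i j = M i j + N i j
  (M ⊖ N) i j = M i j + (- N i j)

  _⊛_ : ℚ → Matrix I J → Matrix I J
  (a ⊛ M) i j = a * M i j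

  module _ (e : Enum J) where

    ∙-congˡ : ∀ (M : Matrix I J) {N N′ : Matrix J K} → N ≋ N′ → M ∙[ e ] N ≋ M ∙[ e ] N′
    ∙-congˡ M q i k = ∑-cong (elements e) λ j → cong (M i j *_) (q j k)

    ∙-congʳ : ∀ {M M′ : Matrix I J} (N : Matrix J K) → M ≋ M′ → M ∙[ e ] N ≋ M′ ∙[ e ] N
    ∙-congʳ N p i k = ∑-cong (elements e) λ j → cong (_* N j k) (p i j)

    ∙-zeroˡ : ∀ {M : Matrix I J} (N : Matrix J K) → M ≋ 0ᴹ → M ∙[ e ] N ≋ 0ᴹ
    ∙-zeroˡ N p i k = trans (∑-cong (elements e) λ j → trans (cong (_* N j k) (p i j)) (ℚₚ.*-zeroˡ (N j k))) (∑-0 (elements e))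

    ∙-zeroʳ : ∀ (M : Matrix I J) {N : Matrix J K} → N ≋ 0ᴹ → M ∙[ e ] N ≋ 0ᴹ
    ∙-zeroʳ M q i k = trans (∑-cong (elements e) λ j → trans (cong (M i j *_) (q j k)) (ℚₚ.*-zeroʳ (M i j))) (∑-0 (elements e))

    ∙-distribˡ-⊕ : ∀ (M : Matrix I J) (N N′ : Matrix J K) → M ∙[ e ] (N ⊕ N′) ≋ (M ∙[ e ] N) ⊕ (M ∙[ e ] N′)
    ∙-distribˡ-⊕ M N N′ i k = trans (∑-cong (elements e) λ j → ℚₚ.*-distribˡ-+ (M i j) (N j k) (N′ j k)) (∑-+ (elements e) _ _)

    ∙-distribʳ-⊕ : ∀ (M M′ : Matrix I J) (N : Matrix J K) → (M ⊕ M′) ∙[ e ] N ≋ (M ∙[ e ] N) ⊕ (M′ ∙[ e ] N)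
    ∙-distribʳ-⊕ M M′ N i k = trans (∑-cong (elements e) λ j → ℚₚ.*-distribʳ-+ (N j k) (M i j) (M′ i j)) (∑-+ (elements e) _ _)

    ∙-⊛ʳ : ∀ a (M : Matrix I J) (N : Matrix J K) → M ∙[ e ] (a ⊛ N) ≋ a ⊛ (M ∙[ e ] N)
    ∙-⊛ʳ a M N i k = trans (∑-cong (elements e) λ j →
        solve 3 (λ x y z → x :* (y :* z) := y :* (x :* z)) refl (M i j) a (N j k))
      (∑-*ˡ (elements e) a _)

    ∙-⊛ˡ : ∀ a (M : Matrix I J) (N : Matrix J K) → (a ⊛ M) ∙[ e ] N ≋ a ⊛ (M ∙[ e ] N)
    ∙-⊛ˡ a M N i k = trans (∑-cong (elements e) λ j → ℚₚ.*-assoc a (M i j) (N j k))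
      (∑-*ˡ (elements e) a _)

    ∙-distribˡ-⊖ : ∀ (M : Matrix I J) (N N′ : Matrix J K) → M ∙[ e ] (N ⊖ N′) ≋ (M ∙[ e ] N) ⊖ (M ∙[ e ] N′)
    ∙-distribˡ-⊖ M N N′ i k = trans (∙-distribˡ-⊕ M N (λ j k → - N′ j k) i k) (cong ((M ∙[ e ] N) i k +_) (begin
      sum e (λ j → M i j * (- N′ j k))     ≡⟨ ∑-cong (elements e) (λ j → solve 2 (λ x y → x :* (:- y) := con (- 1ℚ) :* (x :* y)) refl (M i j) (N′ j k)) ⟩
      sum e (λ j → (- 1ℚ) * (M i j * N′ j k)) ≡⟨ ∑-*ˡ (elements e) (- 1ℚ) _ ⟩
      (- 1ℚ) * (M ∙[ e ] N′) i k           ≡⟨ solve 1 (λ x → con (- 1ℚ) :* x := :- x) refl _ ⟩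
      - (M ∙[ e ] N′) i k                  ∎))
      where open ≡-Reasoning

    ᵀ-∙ : ∀ (M : Matrix I J) (N : Matrix J K) → (M ∙[ e ] N) ᵀ ≋ (N ᵀ) ∙[ e ] (M ᵀ)
    ᵀ-∙ M N k i = ∑-cong (elements e) λ j → ℚₚ.*-comm (M i j) (N j k)

  ∙-distribʳ-⊖ : ∀ (e : Enum J) (M M′ : Matrix I J) (N : Matrix J K) → (M ⊖ M′) ∙[ e ] N ≋ (M ∙[ e ] N) ⊖ (M′ ∙[ e ] N)
  ∙-distribʳ-⊖ e M M′ N i k = trans (ᵀ-∙ e (M ⊖ M′) N k i)
    (trans (∙-distribˡ-⊖ e (N ᵀ) (M ᵀ) (M′ ᵀ) k i)
      (cong₂ (λ x y → x + (- y)) (ᵀ-∙ e (N ᵀ) (M ᵀ) i k) (ᵀ-∙ e (N ᵀ) (M′ ᵀ) i k)))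

  ∙-assoc : ∀ (e : Enum J) (e′ : Enum K) (M : Matrix I J) (N : Matrix J K) (O : Matrix K L) →
            (M ∙[ e ] N) ∙[ e′ ] O ≋ M ∙[ e ] (N ∙[ e′ ] O)
  ∙-assoc e e′ M N O i l = begin
    sum e′ (λ k → sum e (λ j → M i j * N j k) * O k l)
      ≡⟨ ∑-cong (elements e′) (λ k → sym (∑-*ʳ (elements e) _ _)) ⟩
    sum e′ (λ k → sum e (λ j → M i j * N j k * O k l))
      ≡⟨ ∑-swap (elements e′) (elements e) _ ⟩
    sum e (λ j → sum e′ (λ k → M i j * N j k * O k l))
      ≡⟨ ∑-cong (elements e) (λ j → trans (∑-cong (elements e′) (λ k → ℚₚ.*-assoc (M i j) _ _)) (∑-*ˡ (elements e′) (M i j) _)) ⟩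
    sum e (λ j → M i j * sum e′ (λ k → N j k * O k l)) ∎
    where open ≡-Reasoning

  ≋-trans : {M N O : Matrix I J} → M ≋ N → N ≋ O → M ≋ O
  ≋-trans p q i j = trans (p i j) (q i j)

  ≋-sym : {M N : Matrix I J} → M ≋ N → N ≋ M
  ≋-sym p i j = sym (p i j)

  ⊖≋0⇒≋ : {M N : Matrix I J} → M ⊖ N ≋ 0ᴹ → M ≋ N
  ⊖≋0⇒≋ {M = M} {N} p i j = begin
    M i j                    ≡⟨ solve 2 (λ x y → x := (x :+ :- y) :+ y) refl (M i j) (N i j) ⟩
    M i j + (- N i j) + N i j ≡⟨ cong (_+ N i j) (p i j) ⟩
    0ℚ + N i j               ≡⟨ ℚₚ.+-identityˡ _ ⟩
    N i j                    ∎
    where open ≡-Reasoning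

  ≋⇒⊖≋0 : {M N : Matrix I J} → M ≋ N → M ⊖ N ≋ 0ᴹ
  ≋⇒⊖≋0 {M = M} {N} p i j = trans (cong (_+ (- N i j)) (p i j)) (ℚₚ.+-inverseʳ (N i j))

  gram : Enum I → Matrix I J → Matrix J J
  gram e M = (M ᵀ) ∙[ e ] M

  gram-symmetric : ∀ (e : Enum I) (M : Matrix I J) → Symmetric (gram e M)
  gram-symmetric e M i j = ᵀ-∙ e (M ᵀ) M i j

  -- Each diagonal entry of `gram e M` is the sum of the squares of a column of `M`. This positivity
  -- takes the place of pivoting.
  gram≋0⇒≋0 : ∀ (e : Enum I) (M : Matrix I J) → gram e M ≋ 0ᴹ → M ≋ 0ᴹ
  gram≋0⇒≋0 e M p i j = ∑-*-≡0⇒≡0 (elements e) (λ i → M i j) (p j j) (complete e i)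

  -- Linear dependence

  combination : List ℚ → (ℕ → X → ℚ) → X → ℚ
  combination []       v x = 0ℚ
  combination (c ∷ cs) v x = c * v 0 x + combination cs (v ∘ suc) x

  combination-++ : ∀ cs ds (v : ℕ → X → ℚ) x →
    combination (cs ++ ds) v x ≡ combination cs v x + combination ds (λ i → v (length cs ℕ.+ i)) x
  combination-++ []       ds v x = sym (ℚₚ.+-identityˡ _)
  combination-++ (c ∷ cs) ds v x = trans (cong (c * v 0 x +_) (combination-++ cs ds (v ∘ suc) x))
    (sym (ℚₚ.+-assoc (c * v 0 x) _ _))

  combination-scale : ∀ a cs (v : ℕ → X → ℚ) x → combination (List.map (a *_) cs) v x ≡ a * combination cs v x
  combination-scale a []       v x = sym (ℚₚ.*-zeroʳ a)
  combination-scale a (c ∷ cs) v x = trans (cong (a * c * v 0 x +_) (combination-scale a cs (v ∘ suc) x))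
    (solve 4 (λ a c y z → a :* c :* y :+ a :* z := a :* (c :* y :+ z)) refl a c _ _)

  -- A second relation between later members of the sequence cancels the value
  -- of the first relation at the new coordinate.
  dependence : ∀ (xs : List X) (v : ℕ → X → ℚ) →
    ∃[ cs ] Any (_≢ 0ℚ) cs × (∀ {x} → x ∈ₗ xs → combination cs v x ≡ 0ℚ)
  dependence []       v = 1ℚ ∷ [] , here (λ ()) , λ ()
  dependence (x ∷ xs) v
    with cs , cs≢0 , cs∙v≡0 ← dependence xs v
    with combination cs v x ℚₚ.≟ 0ℚ
  ... | yes eq = cs , cs≢0 , λ { (here refl) → eq ; (there x∈) → cs∙v≡0 x∈ }
  ... | no  neq
    with ds , ds≢0 , ds∙v≡0 ← dependence xs (λ i → v (length cs ℕ.+ i))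
    -- The relation `ds` starts in the sequence where `cs` ends, so its nonzero coefficient survives
    -- in the concatenation even if the factor `a` is zero.
    = List.map (a *_) cs ++ ds , Any.++⁺ʳ (List.map (a *_) cs) ds≢0 , vanish
    where
    open ≡-Reasoning
    instance _ = ≢-nonZero neq
    y b a : ℚ
    y = combination cs v x
    b = combination ds (λ i → v (length cs ℕ.+ i)) x
    a = - (b * 1/ y)
    split : ∀ z → combination (List.map (a *_) cs ++ ds) v z
                ≡ a * combination cs v z + combination ds (λ i → v (length cs ℕ.+ i)) z
    split z = trans (combination-++ (List.map (a *_) cs) ds v z) (cong₂ _+_ (combination-scale a cs v z)
      (cong (λ ℓ → combination ds (λ i → v (ℓ ℕ.+ i)) z) (length-map (a *_) cs)))
    vanish : ∀ {z} → z ∈ₗ x ∷ xs → combination (List.map (a *_) cs ++ ds) v z ≡ 0ℚ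
    vanish (here refl) = begin
      combination (List.map (a *_) cs ++ ds) v x ≡⟨ split x ⟩
      a * y + b                            ≡⟨ solve 3 (λ b i y → (:- (b :* i)) :* y :+ b := b :+ :- (b :* (i :* y))) refl b (1/ y) y ⟩
      b + (- (b * (1/ y * y)))              ≡⟨ cong (λ z → b + (- (b * z))) (ℚₚ.*-inverseˡ y) ⟩
      b + (- (b * 1ℚ))                      ≡⟨ cong (λ z → b + (- z)) (ℚₚ.*-identityʳ b) ⟩
      b + (- b)                             ≡⟨ ℚₚ.+-inverseʳ b ⟩
      0ℚ                                    ∎
    vanish {z} (there z∈) = begin
      combination (List.map (a *_) cs ++ ds) v z ≡⟨ split z ⟩
      a * combination cs v z + combination ds (λ i → v (length cs ℕ.+ i)) z
        ≡⟨ cong₂ (λ p q → a * p + q) (cs∙v≡0 z∈) (ds∙v≡0 z∈) ⟩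
      a * 0ℚ + 0ℚ                           ≡⟨ trans (ℚₚ.+-identityʳ _) (ℚₚ.*-zeroʳ a) ⟩
      0ℚ                                    ∎

  -- Polynomials in a symmetric matrix

  module _ (e : Enum J) where

    -- The polynomial with coefficients 0, c₀, c₁, … at S.
    poly₀ : List ℚ → Matrix J J → Matrix J J
    poly₀ []       S = 0ᴹ
    poly₀ (c ∷ cs) S = (c ⊛ S) ⊕ (S ∙[ e ] poly₀ cs S)

    poly₀-comm : ∀ cs S → S ∙[ e ] poly₀ cs S ≋ poly₀ cs S ∙[ e ] S
    poly₀-comm []       S i j = trans (∙-zeroʳ e S {N = 0ᴹ} (λ _ _ → refl) i j) (sym (∙-zeroˡ e {M = 0ᴹ} S (λ _ _ → refl) i j))
    poly₀-comm (c ∷ cs) S i j = begin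
      (S ∙[ e ] ((c ⊛ S) ⊕ (S ∙[ e ] p))) i j
        ≡⟨ ∙-distribˡ-⊕ e S (c ⊛ S) (S ∙[ e ] p) i j ⟩
      (S ∙[ e ] (c ⊛ S)) i j + (S ∙[ e ] (S ∙[ e ] p)) i j
        ≡⟨ cong₂ _+_ (trans (∙-⊛ʳ e c S S i j) (sym (∙-⊛ˡ e c S S i j)))
             (trans (∙-congˡ e S (poly₀-comm cs S) i j) (sym (∙-assoc e e S p S i j))) ⟩
      ((c ⊛ S) ∙[ e ] S) i j + ((S ∙[ e ] p) ∙[ e ] S) i j
        ≡⟨ ∙-distribʳ-⊕ e (c ⊛ S) (S ∙[ e ] p) S i j ⟨
      (((c ⊛ S) ⊕ (S ∙[ e ] p)) ∙[ e ] S) i j ∎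
      where
      open ≡-Reasoning
      p = poly₀ cs S

    poly₀-symmetric : ∀ cs {S} → Symmetric S → Symmetric (poly₀ cs S)
    poly₀-symmetric []       S-sym i j = refl
    poly₀-symmetric (c ∷ cs) {S} S-sym i j = cong₂ _+_ (cong (c *_) (S-sym i j)) (begin
      (S ∙[ e ] p) j i         ≡⟨ ᵀ-∙ e S p i j ⟩
      ((p ᵀ) ∙[ e ] (S ᵀ)) i j ≡⟨ trans (∙-congˡ e (p ᵀ) S-sym i j) (∙-congʳ e S (poly₀-symmetric cs S-sym) i j) ⟩
      (p ∙[ e ] S) i j         ≡⟨ poly₀-comm cs S i j ⟨
      (S ∙[ e ] p) i j         ∎)
      where
      open ≡-Reasoning
      p = poly₀ cs S

    poly₀-scale : ∀ a cs S → poly₀ (List.map (a *_) cs) S ≋ a ⊛ poly₀ cs S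
    poly₀-scale a []       S i j = sym (ℚₚ.*-zeroʳ a)
    poly₀-scale a (c ∷ cs) S i j = begin
      a * c * S i j + (S ∙[ e ] poly₀ (List.map (a *_) cs) S) i j
        ≡⟨ cong₂ _+_ (ℚₚ.*-assoc a c _) (trans (∙-congˡ e S (poly₀-scale a cs S) i j) (∙-⊛ʳ e a S (poly₀ cs S) i j)) ⟩
      a * (c * S i j) + a * (S ∙[ e ] poly₀ cs S) i j
        ≡⟨ ℚₚ.*-distribˡ-+ a _ _ ⟨
      a * (c * S i j + (S ∙[ e ] poly₀ cs S) i j) ∎
      where open ≡-Reasoning

    -- There is no constant term, so every summand begins with a factor `S`.
    poly₀-annihilated : ∀ cs {S} (v : Matrix I J) → v ∙[ e ] S ≋ 0ᴹ → v ∙[ e ] poly₀ cs S ≋ 0ᴹ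
    poly₀-annihilated []       v vS≋0 = ∙-zeroʳ e v {N = 0ᴹ} (λ _ _ → refl)
    poly₀-annihilated (c ∷ cs) {S} v vS≋0 i j = begin
      (v ∙[ e ] ((c ⊛ S) ⊕ (S ∙[ e ] p))) i j          ≡⟨ ∙-distribˡ-⊕ e v (c ⊛ S) (S ∙[ e ] p) i j ⟩
      (v ∙[ e ] (c ⊛ S)) i j + (v ∙[ e ] (S ∙[ e ] p)) i j
        ≡⟨ cong₂ _+_ (trans (∙-⊛ʳ e c v S i j) (trans (cong (c *_) (vS≋0 i j)) (ℚₚ.*-zeroʳ c)))
             (trans (sym (∙-assoc e e v S p i j)) (∙-zeroˡ e p vS≋0 i j)) ⟩
      0ℚ + 0ℚ                                          ≡⟨⟩
      0ℚ                                               ∎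
      where
      open ≡-Reasoning
      p = poly₀ cs S

    -- The exponent is one more than the index, in accordance with `poly₀`. Taking a pair of indices
    -- makes a matrix a vector to which `dependence` applies.
    power : Matrix J J → ℕ → J × J → ℚ
    power S zero    (i , j) = S i j
    power S (suc n) (i , j) = (S ∙[ e ] (λ i j → power S n (i , j))) i j

    combination-∙ : ∀ cs (S : Matrix J J) (v : ℕ → J × J → ℚ) →
      (λ i j → combination cs (λ n ij → (S ∙[ e ] (λ i j → v n (i , j))) (proj₁ ij) (proj₂ ij)) (i , j))
      ≋ S ∙[ e ] (λ i j → combination cs v (i , j))
    combination-∙ []       S v i j = sym (∙-zeroʳ e S {N = 0ᴹ} (λ _ _ → refl) i j)
    combination-∙ (c ∷ cs) S v i j = trans
      (cong₂ _+_ (sym (∙-⊛ʳ e c S (λ i j → v 0 (i , j)) i j)) (combination-∙ cs S (v ∘ suc) i j))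
      (sym (∙-distribˡ-⊕ e S (λ i j → c * v 0 (i , j)) (λ i j → combination cs (v ∘ suc) (i , j)) i j))

    poly₀≋combination : ∀ cs S → poly₀ cs S ≋ λ i j → combination cs (power S) (i , j)
    poly₀≋combination []       S i j = refl
    poly₀≋combination (c ∷ cs) S i j = cong (c * S i j +_)
      (trans (∙-congˡ e S (poly₀≋combination cs S) i j) (sym (combination-∙ cs S (power S) i j)))

    -- A relation c₀ S + c₁ S² + … = 0 is solved for S if c₀ ≠ 0; otherwise
    -- the symmetry of S allows the cancellation of a factor S.
    poly₀≋0⇒reproducing : ∀ cs {S} → Symmetric S → Any (_≢ 0ℚ) cs → poly₀ cs S ≋ 0ᴹ →
      ∃[ ds ] poly₀ ds S ∙[ e ] S ≋ S
    poly₀≋0⇒reproducing (c ∷ cs) {S} S-sym nz rel with c ℚₚ.≟ 0ℚ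
    ... | no c≢0 = List.map (a *_) cs , λ i j → begin
      (poly₀ (List.map (a *_) cs) S ∙[ e ] S) i j  ≡⟨ ∙-congʳ e S (poly₀-scale a cs S) i j ⟩
      ((a ⊛ p) ∙[ e ] S) i j                  ≡⟨ ∙-⊛ˡ e a p S i j ⟩
      a * (p ∙[ e ] S) i j                    ≡⟨ cong (a *_) (poly₀-comm cs S i j) ⟨
      a * (S ∙[ e ] p) i j                    ≡⟨ solve 4 (λ r c s y → (:- r) :* y := r :* c :* s :+ :- (r :* (c :* s :+ y))) refl (1/ c) c (S i j) _ ⟩
      1/ c * c * S i j + (- (1/ c * (c * S i j + (S ∙[ e ] p) i j)))
        ≡⟨ cong₂ (λ x y → x * S i j + (- (1/ c * y))) (ℚₚ.*-inverseˡ c) (rel i j) ⟩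
      1ℚ * S i j + (- (1/ c * 0ℚ))            ≡⟨ solve 2 (λ s r → con 1ℚ :* s :+ :- (r :* con 0ℚ) := s) refl (S i j) (1/ c) ⟩
      S i j ∎
      where
      open ≡-Reasoning
      instance _ = ≢-nonZero c≢0
      a = - (1/ c)
      p = poly₀ cs S
    ... | yes refl with nz
    ...   | here c≢0  = ⊥-elim (c≢0 refl)
    -- With leading coefficient 0 the relation reads `S p = 0`. Since `p` commutes with `S` and is
    -- itself a polynomial in `S` without constant term, `p p = 0` follows; by symmetry `p p` is the
    -- Gram matrix of `p`. Hence `p = 0`, a shorter relation.
    ...   | there nz′ = poly₀≋0⇒reproducing cs S-sym nz′ (gram≋0⇒≋0 e p pᵀp≋0)
      where
      open ≡-Reasoning
      p = poly₀ cs S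
      Sp≋0 : S ∙[ e ] p ≋ 0ᴹ
      Sp≋0 i j = trans (sym (trans (cong (_+ (S ∙[ e ] p) i j) (ℚₚ.*-zeroˡ (S i j))) (ℚₚ.+-identityˡ _))) (rel i j)
      pS≋0 : p ∙[ e ] S ≋ 0ᴹ
      pS≋0 i j = trans (sym (poly₀-comm cs S i j)) (Sp≋0 i j)
      pᵀp≋0 : gram e p ≋ 0ᴹ
      pᵀp≋0 i j = trans (∙-congʳ e p (poly₀-symmetric cs S-sym) i j)
        (poly₀-annihilated cs p pS≋0 i j)

  cartesian : Enum X → Enum Y → Enum (X × Y)
  cartesian e e′ = record
    { elements = cartesianProductWith _,_ (elements e) (elements e′)
    ; complete = λ (x , y) → ∈-cartesianProduct⁺ (complete e x) (complete e′ y) }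

  -- The powers of `S` lie in a finite-dimensional space, so some nontrivial relation holds between
  -- them. The resulting polynomial acts as the identity on the row space of `S`, like the
  -- orthogonal projection onto it.
  reproducing : ∀ (e : Enum J) {S} → Symmetric S → ∃[ ds ] poly₀ e ds S ∙[ e ] S ≋ S
  reproducing e {S} S-sym
    with cs , nz , rel ← dependence (elements (cartesian e e)) (power e S)
    = poly₀≋0⇒reproducing e cs S-sym nz λ i j →
        trans (poly₀≋combination e cs S i j) (rel (complete (cartesian e e) (i , j)))

  -- M − M Q is orthogonal to the rows of M and is a combination of them.
  gram-reproducing : ∀ (e : Enum I) (f : Enum J) (M : Matrix I J) →
    ∃[ ds ] M ∙[ f ] poly₀ f ds (gram e M) ≋ M
  gram-reproducing e f M with ds , QS≋S ← reproducing f (gram-symmetric e M) =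
    ds , ≋-sym (⊖≋0⇒≋ {M = M} (gram≋0⇒≋0 e Z ZᵀZ≋0))
    where
    open ≡-Reasoning
    S = gram e M
    Q = poly₀ f ds S
    Z = M ⊖ (M ∙[ f ] Q)
    ZᵀM≋0 : (Z ᵀ) ∙[ e ] M ≋ 0ᴹ
    ZᵀM≋0 i j = begin
      ((Z ᵀ) ∙[ e ] M) i j                             ≡⟨ ∙-distribʳ-⊖ e (M ᵀ) ((M ∙[ f ] Q) ᵀ) M i j ⟩
      S i j + (- (((M ∙[ f ] Q) ᵀ) ∙[ e ] M) i j)      ≡⟨ cong (λ x → S i j + (- x)) (begin
        (((M ∙[ f ] Q) ᵀ) ∙[ e ] M) i j                  ≡⟨ ∙-congʳ e M (ᵀ-∙ f M Q) i j ⟩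
        (((Q ᵀ) ∙[ f ] (M ᵀ)) ∙[ e ] M) i j              ≡⟨ ∙-assoc f e (Q ᵀ) (M ᵀ) M i j ⟩
        ((Q ᵀ) ∙[ f ] S) i j                             ≡⟨ ∙-congʳ f S (poly₀-symmetric f ds (gram-symmetric e M)) i j ⟩
        (Q ∙[ f ] S) i j                                 ≡⟨ QS≋S i j ⟩
        S i j                                            ∎) ⟩
      S i j + (- S i j)                                ≡⟨ ℚₚ.+-inverseʳ (S i j) ⟩
      0ℚ                                               ∎
    ZᵀZ≋0 : gram e Z ≋ 0ᴹ
    ZᵀZ≋0 i j = begin
      ((Z ᵀ) ∙[ e ] Z) i j                             ≡⟨ ∙-distribˡ-⊖ e (Z ᵀ) M (M ∙[ f ] Q) i j ⟩
      ((Z ᵀ) ∙[ e ] M) i j + (- ((Z ᵀ) ∙[ e ] (M ∙[ f ] Q)) i j)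
        ≡⟨ cong₂ (λ x y → x + (- y)) (ZᵀM≋0 i j)
             (trans (sym (∙-assoc e f (Z ᵀ) M Q i j)) (∙-zeroˡ f Q ZᵀM≋0 i j)) ⟩
      0ℚ + (- 0ℚ)                                      ≡⟨⟩
      0ℚ                                               ∎

  -- The absence of a constant term lets a factor `S` be split off on the right. Thus the rows of a
  -- polynomial in `S` are combinations of the rows of `S`.
  poly₀-factor : ∀ (e : Enum J) cs S (V : Matrix I J) → ∃[ W ] V ∙[ e ] poly₀ e cs S ≋ W ∙[ e ] S
  poly₀-factor e []       S V = 0ᴹ , λ i j →
    trans (∙-zeroʳ e V {N = 0ᴹ} (λ _ _ → refl) i j) (sym (∙-zeroˡ e {M = 0ᴹ} S (λ _ _ → refl) i j))
  poly₀-factor e (c ∷ cs) S V = (c ⊛ V) ⊕ (V ∙[ e ] p) , λ i j → begin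
    (V ∙[ e ] ((c ⊛ S) ⊕ (S ∙[ e ] p))) i j               ≡⟨ ∙-distribˡ-⊕ e V (c ⊛ S) (S ∙[ e ] p) i j ⟩
    (V ∙[ e ] (c ⊛ S)) i j + (V ∙[ e ] (S ∙[ e ] p)) i j  ≡⟨ cong₂ _+_
      (trans (∙-⊛ʳ e c V S i j) (sym (∙-⊛ˡ e c V S i j)))
      (trans (∙-congˡ e V (poly₀-comm e cs S) i j) (sym (∙-assoc e e V p S i j))) ⟩
    ((c ⊛ V) ∙[ e ] S) i j + ((V ∙[ e ] p) ∙[ e ] S) i j  ≡⟨ ∙-distribʳ-⊕ e (c ⊛ V) (V ∙[ e ] p) S i j ⟨
    (((c ⊛ V) ⊕ (V ∙[ e ] p)) ∙[ e ] S) i j               ∎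
    where
    open ≡-Reasoning
    p = poly₀ e cs S

  -- By `gram-reproducing`, `M` equals `M Q` with `Q` a polynomial in the Gram matrix, and
  -- `poly₀-factor` makes this a left multiple of the Gram matrix. This is the substantial inclusion
  -- of row spaces; the converse is immediate from the product that defines `gram`.
  gram-spans : ∀ (e : Enum I) (f : Enum J) (M : Matrix I J) → ∃[ V ] V ∙[ f ] gram e M ≋ M
  gram-spans e f M = V , ≋-trans (≋-sym MQ≋VS) (proj₂ (gram-reproducing e f M))
    where
    factor = poly₀-factor f (proj₁ (gram-reproducing e f M)) (gram e M) M
    V = proj₁ factor
    MQ≋VS = proj₂ factor

  bools : Enum Bool
  bools = record { elements = true ∷ false ∷ [] ; complete = λ { true → here refl ; false → there (here refl) } }

  stack : Matrix I J → Matrix I J → Matrix (Bool × I) J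
  stack M N (b , i) j = if b then M i j else N i j

  -- The sum of two row spaces is the row space of the stacked matrix. This identity reduces `join`
  -- to the case of a single Gram matrix.
  gram-stack : ∀ (e : Enum I) (M N : Matrix I J) →
    gram (cartesian bools e) (stack M N) ≋ gram e M ⊕ gram e N
  gram-stack e M N j k =
    trans (∑-cartesianProductWith _,_ (true ∷ false ∷ []) (elements e) (λ bi → stack M N bi j * stack M N bi k))
      (cong (gram e M j k +_) (ℚₚ.+-identityʳ (gram e N j k)))

  finite : ∀ n → Enum (Fin n)
  finite n = record { elements = allFin n ; complete = ∈-allFin }

  vectors : Enum X → ∀ n → Enum (Vec X n)
  vectors e zero    = record { elements = [] ∷ [] ; complete = λ { [] → here refl } }
  vectors e (suc n) = record
    { elements = cartesianProductWith _∷_ (elements e) (elements (vectors e n))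
    ; complete = λ { (x ∷ xs) → ∈-cartesianProductWith⁺ _∷_ (complete e x) (complete (vectors e n) xs) } }

open LinearAlgebra

-- Multilinear monomials, multiplication by a variable, and the zero polynomial in derivations

module MultilinearPolynomials where

  open import Data.Rational.Base using (_+_; _*_; -_)

  private variable
    n k : ℕ
    X : Set

  -- Finite cardinalities

  injection⇒≤length : ∀ {i} {xs : List X} (us : Fin i → X) → Injective _≡_ _≡_ us →
    (∀ j → us j ∈ₗ xs) → i ≤ length xs
  injection⇒≤length us us-inj us∈ = Finₚ.injective⇒≤ {f = index ∘ us∈}
    λ {j} {j′} eq → us-inj (index-injective (setoid _) (us∈ j) (us∈ j′) eq)

  lookup-injective : ∀ {xs : List X} → Unique xs → Injective _≡_ _≡_ (List.lookup xs)
  lookup-injective {xs = x ∷ xs} (x∉ ∷ u) {zero}  {zero}  eq = refl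
  lookup-injective {xs = x ∷ xs} (x∉ ∷ u) {zero}  {suc j} eq = contradiction eq (All.lookup x∉ (∈ₗ-lookup j))
  lookup-injective {xs = x ∷ xs} (x∉ ∷ u) {suc i} {zero}  eq = contradiction (sym eq) (All.lookup x∉ (∈ₗ-lookup i))
  lookup-injective {xs = x ∷ xs} (x∉ ∷ u) {suc i} {suc j} eq = cong suc (lookup-injective u eq)

  members : Subset n → List (Fin n)
  members []            = []
  members (inside  ∷ p) = zero ∷ List.map suc (members p)
  members (outside ∷ p) = List.map suc (members p)

  length-members : ∀ (p : Subset n) → length (members p) ≡ ∣ p ∣
  length-members []            = refl
  length-members (inside  ∷ p) = cong suc (trans (length-map suc (members p)) (length-members p))
  length-members (outside ∷ p) = trans (length-map suc (members p)) (length-members p)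

  ∈-members⁺ : ∀ {x} {p : Subset n} → x ∈ₛ p → x ∈ₗ members p
  ∈-members⁺ {p = inside ∷ p}  here       = here refl
  ∈-members⁺ {p = inside ∷ p}  (there x∈) = there (∈-map⁺ suc (∈-members⁺ x∈))
  ∈-members⁺ {p = outside ∷ p} (there x∈) = ∈-map⁺ suc (∈-members⁺ x∈)

  ∈-members⁻ : ∀ {x} (p : Subset n) → x ∈ₗ members p → x ∈ₛ p
  ∈-members⁻ (inside ∷ p) (here refl) = here
  ∈-members⁻ (inside ∷ p) (there x∈) with _ , y∈ , refl ← ∈-map⁻ suc x∈ = there (∈-members⁻ p y∈)
  ∈-members⁻ (outside ∷ p) x∈ with _ , y∈ , refl ← ∈-map⁻ suc x∈ = there (∈-members⁻ p y∈)

  members-unique : ∀ (p : Subset n) → Unique (members p)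
  members-unique []            = []
  members-unique (outside ∷ p) = Unique.map⁺ (λ { refl → refl }) (members-unique p)
  members-unique (inside  ∷ p) =
    All.map⁺ (All.universal (λ _ ()) (members p)) ∷ Unique.map⁺ (λ { refl → refl }) (members-unique p)

  ≤∣∣⇒injection : ∀ {i} (p : Subset n) → i ≤ ∣ p ∣ →
    Σ[ us ∈ (Fin i → Fin n) ] Injective _≡_ _≡_ us × (∀ j → us j ∈ₛ p)
  ≤∣∣⇒injection {i = i} p i≤ = us ,
    (λ eq → Finₚ.inject≤-injective i≤′ i≤′ _ _ (lookup-injective (members-unique p) eq)) ,
    λ j → ∈-members⁻ p (∈ₗ-lookup (inject≤ j i≤′))
    where
    i≤′ : i ≤ length (members p)
    i≤′ = subst (i ≤_) (sym (length-members p)) i≤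
    us : Fin i → Fin _
    us j = List.lookup (members p) (inject≤ j i≤′)

  injection⇒≤∣∣ : ∀ {i} (p : Subset n) (us : Fin i → Fin n) → Injective _≡_ _≡_ us →
    (∀ j → us j ∈ₛ p) → i ≤ ∣ p ∣
  injection⇒≤∣∣ p us us-inj us∈ = subst (_ ≤_) (length-members p)
    (injection⇒≤length us us-inj (∈-members⁺ ∘ us∈))

  -- Removing and adding a variable

  ∈-delete⁻ : ∀ {x y} (p : Subset n) → y ∈ₛ p - x → y ∈ₛ p × y ≢ x
  ∈-delete⁻ {x = zero}  (s ∷ p) (there y∈) = there (subst (_ ∈ₛ_) (p─⊥≡p p) y∈) , λ ()
  ∈-delete⁻ {x = suc x} (inside ∷ p) here = here , λ ()
  ∈-delete⁻ {x = suc x} (s ∷ p) (there y∈) with y∈p , y≢x ← ∈-delete⁻ p y∈ = there y∈p , λ { refl → y≢x refl }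

  ∈-delete⁺ : ∀ {x y} {p : Subset n} → y ∈ₛ p → y ≢ x → y ∈ₛ p - x
  ∈-delete⁺ y∈p y≢x = x∈p∧x≢y⇒x∈p-y y∈p y≢x

  ∪-delete : ∀ {x} (p q : Subset n) → x ∉ₛ p → p ∪ ⁅ x ⁆ ≡ q → p ≡ q - x
  ∪-delete {x = x} p q x∉p refl = ⊆-antisym
    (λ y∈p → ∈-delete⁺ (x∈p∪q⁺ (inj₁ y∈p)) λ { refl → x∉p y∈p })
    λ {y} y∈ → case-∪ (∈-delete⁻ (p ∪ ⁅ x ⁆) y∈)
    where
    case-∪ : ∀ {y} → y ∈ₛ p ∪ ⁅ x ⁆ × y ≢ x → y ∈ₛ p
    case-∪ {y} (y∈ , y≢x) with x∈p∪q⁻ p ⁅ x ⁆ y∈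
    ... | inj₁ y∈p = y∈p
    ... | inj₂ y∈x = contradiction (x∈⁅y⁆⇒x≡y x y∈x) y≢x

  ∪-absorbs : ∀ {x} (p : Subset n) → x ∈ₛ p → p ∪ ⁅ x ⁆ ≡ p
  ∪-absorbs {x = x} p x∈p = ⊆-antisym to (x∈p∪q⁺ ∘ inj₁)
    where
    to : ∀ {y} → y ∈ₛ p ∪ ⁅ x ⁆ → y ∈ₛ p
    to y∈ with x∈p∪q⁻ p ⁅ x ⁆ y∈
    ... | inj₁ y∈p = y∈p
    ... | inj₂ y∈x with refl ← x∈⁅y⁆⇒x≡y x y∈x = x∈p

  delete-∪ : ∀ {x} (p : Subset n) → x ∈ₛ p → (p - x) ∪ ⁅ x ⁆ ≡ p
  delete-∪ {x = x} p x∈p = ⊆-antisym to from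
    where
    to : ∀ {y} → y ∈ₛ (p - x) ∪ ⁅ x ⁆ → y ∈ₛ p
    to y∈ with x∈p∪q⁻ (p - x) ⁅ x ⁆ y∈
    ... | inj₁ y∈p-x = proj₁ (∈-delete⁻ p y∈p-x)
    ... | inj₂ y∈x with refl ← x∈⁅y⁆⇒x≡y x y∈x = x∈p
    from : ∀ {y} → y ∈ₛ p → y ∈ₛ (p - x) ∪ ⁅ x ⁆
    from {y} y∈p with y Finₚ.≟ x
    ... | yes refl = x∈p∪q⁺ {p = p - x} (inj₂ (x∈⁅x⁆ x))
    ... | no y≢x   = x∈p∪q⁺ (inj₁ (∈-delete⁺ y∈p y≢x))

  -- Multiplication by a variable

  mono-≡ : ∀ (m : Monomial n) → mono m m ≡ 1ℚ
  mono-≡ m = cong (if_then 1ℚ else 0ℚ) (dec-true (≡-dec Boolₚ._≟_ m m) refl)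

  mono-≢ : ∀ {m m′ : Monomial n} → m ≢ m′ → mono m m′ ≡ 0ℚ
  mono-≢ {m = m} {m′} m≢ = cong (if_then 1ℚ else 0ℚ) (dec-false (≡-dec Boolₚ._≟_ m m′) m≢)

  ·-∈ : ∀ x (f : Poly n) {m} → x ∈ₛ m → (x · f) m ≡ f m + f (m - x)
  ·-∈ x f {m} x∈m = cong (if_then f m + f (m - x) else 0ℚ) ([]=⇒lookup x∈m)

  ·-∉ : ∀ x (f : Poly n) {m} → x ∉ₛ m → (x · f) m ≡ 0ℚ
  ·-∉ x f {m} x∉m = cong (if_then f m + f (m - x) else 0ℚ)
    (Boolₚ.¬-not λ eq → x∉m (lookup⇒[]= x m eq))

  ·-var : ∀ (x : Fin n) → x · var x ≗ var x
  ·-var x m with x ∈ₛ? m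
  ... | no x∉m = trans (·-∉ x (var x) x∉m) (sym (mono-≢ {m = ⁅ x ⁆} {m} λ { refl → x∉m (x∈⁅x⁆ x) }))
  ... | yes x∈m = trans (·-∈ x (var x) x∈m) (trans (cong (var x m +_) (mono-≢ λ eq →
    proj₂ (∈-delete⁻ m (subst (x ∈ₛ_) eq (x∈⁅x⁆ x))) refl)) (ℚₚ.+-identityʳ (var x m)))

  boolean≗0 : ∀ (x : Fin n) → lin 1ℚ (x · var x) (- 1ℚ) (var x) ≗ λ _ → 0ℚ
  boolean≗0 x m = trans (cong (λ q → 1ℚ * q + (- 1ℚ) * var x m) (·-var x m))
    (solve 1 (λ a → con 1ℚ :* a :+ con (- 1ℚ) :* a := con 0ℚ) refl (var x m))

  module _ {P : System} where

    derivable-degree : ∀ {f} → Derivable k P f → Degree≤ k f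
    derivable-degree (axiom i deg)    = deg
    derivable-degree (boolean x deg)  = deg
    derivable-degree (mult x d deg)   = deg
    derivable-degree (lincomb {f} {g} a b d d′) m k<m = trans
      (cong₂ (λ p q → a * p + b * q) (derivable-degree d′ m k<m) (derivable-degree d m k<m))
      (solve 2 (λ a b → a :* con 0ℚ :+ b :* con 0ℚ := con 0ℚ) refl a b)
    derivable-degree (resp f≗g d) m k<m = trans (sym (f≗g m)) (derivable-degree d m k<m)

    derivable⇒zero-derivable : ∀ {f} → Derivable k P f → Derivable k P (λ _ → 0ℚ)
    derivable⇒zero-derivable {f = f} d = resp (λ m → solve 1 (λ a → con 0ℚ :* a :+ con 0ℚ :* a := con 0ℚ) refl (f m)) (lincomb 0ℚ 0ℚ d d)

    -- Supplies the polynomial whose element pads the names of monomials, and justifies that the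
    -- sentence rejects systems without polynomials.
    refutable⇒poly : Refutable k P → Fin (#polys P)
    refutable⇒poly d = by-size (#polys P) refl
      where
      -- Without axioms, every derivable polynomial vanishes at the origin.
      constant≡0 : ¬ Fin (#polys P) → ∀ {f} → Derivable _ P f → f ∅ ≡ 0ℚ
      constant≡0 none (axiom i _)    = ⊥-elim (none i)
      constant≡0 none (boolean x _)  = boolean≗0 x ∅
      constant≡0 none (mult {f} x _ _) = ·-∉ x f ∉⊥
      constant≡0 none (lincomb a b d d′) = trans
        (cong₂ (λ p q → a * p + b * q) (constant≡0 none d′) (constant≡0 none d))
        (solve 2 (λ a b → a :* con 0ℚ :+ b :* con 0ℚ := con 0ℚ) refl a b)
      constant≡0 none (resp f≗g d)   = trans (sym (f≗g ∅)) (constant≡0 none d)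
      by-size : ∀ N → #polys P ≡ N → Fin (#polys P)
      by-size (suc N) eq = subst Fin (sym eq) zero
      by-size zero    eq = contradiction
        (trans (sym (mono-≡ {n = #vars P} ∅)) (constant≡0 (λ i → Finₚ.¬Fin0 (subst Fin eq i)) d)) λ ()

    -- Empty linear combinations must be derivable. If there is a variable, its Boolean axiom is
    -- zero. Otherwise every polynomial is constant, so the given one is admissible as a line and
    -- can be multiplied by 0; in general its degree might exceed `k`.
    poly⇒zero-derivable : Fin (#polys P) → Derivable k P (λ _ → 0ℚ)
    poly⇒zero-derivable {k} i = by-size (#vars P) refl
      where
      by-size : ∀ N → #vars P ≡ N → Derivable k P (λ _ → 0ℚ)
      by-size zero eq = derivable⇒zero-derivable (axiom i λ m k<m →
        contradiction (ℕₚ.<-≤-trans k<m (subst (∣ m ∣ ≤_) eq (∣p∣≤n m))) λ ())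
      by-size (suc N) eq = resp (boolean≗0 x) (boolean x λ m _ → boolean≗0 x m)
        where x = subst Fin (sym eq) zero

    derivable-∑ : Derivable k P (λ _ → 0ℚ) → ∀ (xs : List X) (v : X → ℚ) (f : X → Poly (#vars P)) →
      (∀ x → Derivable k P (f x)) → Derivable k P (λ m → ∑ xs (λ x → v x * f x m))
    derivable-∑ d₀ []       v f d = d₀
    derivable-∑ d₀ (x ∷ xs) v f d = resp (λ m → cong (v x * f x m +_) (ℚₚ.*-identityˡ (∑ xs λ x → v x * f x m)))
      (lincomb (v x) 1ℚ (derivable-∑ d₀ xs v f d) (d x))

open MultilinearPolynomials

-- Rational-valued indicators and decidability of the degree bound

module Indicators where

  open import Data.Rational.Base using (_*_; 1/_)

  indicator : {B : Set} → Dec B → ℚ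
  indicator b? = if does b? then 1ℚ else 0ℚ

  indicator-yes : {B : Set} (b? : Dec B) → B → indicator b? ≡ 1ℚ
  indicator-yes b? b = cong (if_then 1ℚ else 0ℚ) (dec-true b? b)

  indicator-no : {B : Set} (b? : Dec B) → ¬ B → indicator b? ≡ 0ℚ
  indicator-no b? ¬b = cong (if_then 1ℚ else 0ℚ) (dec-false b? ¬b)

  indicator-nonNeg : {B : Set} (b? : Dec B) → 0ℚ ℚ.≤ indicator b?
  indicator-nonNeg (yes _) = ℚₚ.nonNegative⁻¹ 1ℚ
  indicator-nonNeg (no _)  = ℚₚ.≤-refl

  isZero : ℚ → ℚ
  isZero q = indicator (q ℚₚ.≟ 0ℚ)

  inverse : ℚ → ℚ
  inverse q with q ℚₚ.≟ 0ℚ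
  ... | yes _  = 0ℚ
  ... | no q≢0 = (1/ q) {{≢-nonZero q≢0}}

  *-inverse : ∀ {q} → q ≢ 0ℚ → q * inverse q ≡ 1ℚ
  *-inverse {q} q≢0 with q ℚₚ.≟ 0ℚ
  ... | yes q≡0 = contradiction q≡0 q≢0
  ... | no  _   = ℚₚ.*-inverseʳ q {{≢-nonZero q≢0}}

  degree≤? : ∀ {n} k (f : Poly n) → Dec (Degree≤ k f)
  degree≤? k f = map′ to from (¬? (anySubset? λ m → (k ℕₚ.<? ∣ m ∣) ×-dec ¬? (f m ℚₚ.≟ 0ℚ)))
    where
    to : ¬ (∃[ m ] k < ∣ m ∣ × f m ≢ 0ℚ) → Degree≤ k f
    to none m k<m with f m ℚₚ.≟ 0ℚ
    ... | yes fm≡0 = fm≡0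
    ... | no  fm≢0 = contradiction (m , k<m , fm≢0) none
    from : Degree≤ k f → ¬ (∃[ m ] k < ∣ m ∣ × f m ≢ 0ℚ)
    from deg (m , k<m , fm≢0) = fm≢0 (deg m k<m)

open Indicators

-- A code prescribes how to build, uniformly in the system, a matrix whose
-- rows are derivable polynomials.  The list in step holds the coefficients of
-- a polynomial in a matrix.
data Code : Set where
  base : Code
  join : Code → Code → Code
  step : Code → List ℚ → Code

-- Matrices of derivable polynomials over an encoded system

module Matrices (k : ℕ) {P : System} {A : Structure systemSignature} (E : Encodes A P) where

  open import Data.Rational.Base using (_+_; _*_; -_)

  open Encodes E public

  n : ℕ
  n = #vars P

  U J : Set
  U = Universe A
  J = Vec U k

  universe : Enum U
  universe = finite (size A)

  tuples : Enum J
  tuples = vectors universe k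

  varU : Fin n → U
  varU v = proj₁ (decode-covers (varE v) tt)

  decode-varU : ∀ v → decode (varU v) ≡ varE v
  decode-varU v = proj₂ (decode-covers (varE v) tt)

  varU-injective : ∀ {v w} → varU v ≡ varU w → v ≡ w
  varU-injective {v} {w} eq with trans (sym (decode-varU v)) (trans (cong decode eq) (decode-varU w))
  ... | refl = refl

  open import Data.Vec.Membership.DecPropositional (Finₚ._≟_ {size A}) using (_∈?_)

  -- The monomial named by a tuple; entries that are not variables are ignored.
  named : ∀ {l} → Vec U l → Monomial n
  named j = tabulate λ v → does (varU v ∈? j)

  ∈-named⁺ : ∀ {l} (j : Vec U l) {v} → varU v ∈ j → v ∈ₛ named j
  ∈-named⁺ j {v} v∈j = lookup⇒[]= v (named j) (trans (lookup∘tabulate _ v) (dec-true (varU v ∈? j) v∈j))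

  ∈-named⁻ : ∀ {l} (j : Vec U l) {v} → v ∈ₛ named j → varU v ∈ j
  ∈-named⁻ j {v} v∈ with varU v ∈? j | trans (sym (lookup∘tabulate (λ v → does (varU v ∈? j)) v)) ([]=⇒lookup v∈)
  ... | yes v∈j | _ = v∈j
  ... | no  _   | ()

  infix 4 _≟ₛ_
  _≟ₛ_ : (s t : Monomial n) → Dec (s ≡ t)
  _≟ₛ_ = ≡-dec Boolₚ._≟_

  onVar? : ∀ (el : Element P L) {B : Fin n → Set} → (∀ v → Dec (B v)) → Dec (∃[ v ] el ≡ varE v × B v)
  onVar? (varE v)  b? = map′ (λ b → v , refl , b) (λ { (_ , refl , b) → b }) (b? v)
  onVar? (polyE _) b? = no λ { (_ , () , _) }
  onVar? (monE _)  b? = no λ { (_ , () , _) }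
  onVar? (coefE _) b? = no λ { (_ , () , _) }
  onVar? (posE _)  b? = no λ { (_ , () , _) }

  adjoins? : ∀ (x : U) (c b : J) → Dec (∃[ v ] decode x ≡ varE v × named c ∪ ⁅ v ⁆ ≡ named b)
  adjoins? x c b = onVar? (decode x) λ v → named c ∪ ⁅ v ⁆ ≟ₛ named b

  exceeds? : ∀ (x : U) (b : J) → Dec (∃[ v ] decode x ≡ varE v × k < ∣ named b ∪ ⁅ v ⁆ ∣)
  exceeds? x b = onVar? (decode x) λ v → k ℕₚ.<? ∣ named b ∪ ⁅ v ⁆ ∣

  multiplicity : J → ℚ
  multiplicity c = sum tuples λ d → indicator (named d ≟ₛ named c)

  -- Multiplication by x; dividing by the multiplicity compensates for the
  -- different names of a monomial.
  times : U → Matrix J J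
  times x c b = indicator (adjoins? x c b) * inverse (multiplicity c)

  -- The matrix R of offending columns. The other columns are set to zero instead of being deleted,
  -- which keeps the index set.
  mask : U → Matrix J J → Matrix J J
  mask x M a b = M a b * indicator (exceeds? x b)

  -- The combinations of the rows of M whose product with x has degree ≤ k,
  -- provided that r is a suitable polynomial.
  restrict : U → List ℚ → Matrix J J → Matrix J J
  restrict x r M = M ⊖ (poly₀ tuples r (gram tuples (mask x M ᵀ)) ∙[ tuples ] M)

  -- The safeguard against an unsuitable list `r`: a row passes only if its offending part vanishes.
  -- A sum of squares condenses this test into one rational.
  gate : U → Matrix J J → J → ℚ
  gate x M d = isZero (sum tuples λ b → mask x M d b * mask x M d b)

  -- No formula can single out the variable by which a derivation multiplies, so all `x` are treated
  -- at once with the same `r`. For an `x` that `r` does not suit, the gate merely drops rows.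
  shift : List ℚ → Matrix J J → Matrix (U × J) J
  shift r M (x , d) b = gate x (restrict x r M) d * (restrict x r M ∙[ tuples ] times x) d b

  axiomEntry : Element P L → Monomial n → ℚ
  axiomEntry (polyE i) m = if does (degree≤? k (poly P i)) then poly P i m else 0ℚ
  axiomEntry _         m = 0ℚ

  -- The row index has the same type as in `shift`, so that one definability lemma covers both
  -- `base` and `step`.
  axioms : Matrix (U × J) J
  axioms (x , _) b = axiomEntry (decode x) (named b)

  ⟦_⟧ : Code → Matrix J J
  ⟦ base ⟧     = gram (cartesian universe tuples) axioms
  ⟦ join c d ⟧ = gram tuples ⟦ c ⟧ ⊕ gram tuples ⟦ d ⟧
  ⟦ step c r ⟧ = gram (cartesian universe tuples) (shift r ⟦ c ⟧)

  ⟦⟧-symmetric : ∀ c → Symmetric ⟦ c ⟧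
  ⟦⟧-symmetric base       = gram-symmetric (cartesian universe tuples) axioms
  ⟦⟧-symmetric (join c d) i j = cong₂ _+_ (gram-symmetric tuples ⟦ c ⟧ i j) (gram-symmetric tuples ⟦ d ⟧ i j)
  ⟦⟧-symmetric (step c r) = gram-symmetric (cartesian universe tuples) (shift r ⟦ c ⟧)

  unit : J → ℚ
  unit j = one (named j)

  -- Tests whether 1 lies in the row space without solving a linear system: for the list given by
  -- `reproducing`, the polynomial in the matrix fixes exactly the vectors of the row space.
  residue : Code → List ℚ → J → ℚ
  residue c r j = sum tuples (λ a → unit a * poly₀ tuples r ⟦ c ⟧ a j) + (- unit j)

  test : Code → List ℚ → ℚ
  test c r = sum tuples λ j → residue c r j * residue c r j

  -- Soundness and completeness of codes for a system with a polynomial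

  module Correctness (i₀ : Fin (#polys P)) where

    -- The padding element. Repeating a variable instead would not do for the empty monomial.
    nullU : U
    nullU = proj₁ (decode-covers (polyE i₀) tt)

    nullU≢varU : ∀ v → varU v ≢ nullU
    nullU≢varU v eq with trans (sym (decode-varU v)) (trans (cong decode eq) (proj₂ (decode-covers (polyE i₀) tt)))
    ... | ()

    pad : ∀ l → List U → Vec U l
    pad zero    _        = []
    pad (suc l) []       = nullU ∷ pad l []
    pad (suc l) (u ∷ us) = u ∷ pad l us

    ∈-pad⁺ : ∀ {l} us {u} → length us ≤ l → u ∈ₗ us → u ∈ pad l us
    ∈-pad⁺ (_ ∷ us) (s≤s le) (here eq)   = VecAny.here eq
    ∈-pad⁺ (_ ∷ us) (s≤s le) (there u∈) = VecAny.there (∈-pad⁺ us le u∈)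

    ∈-pad⁻ : ∀ {l} us {u} → u ≢ nullU → u ∈ pad l us → u ∈ₗ us
    ∈-pad⁻ {suc l} []       u≢ (VecAny.here eq)  = contradiction eq u≢
    ∈-pad⁻ {suc l} []       u≢ (VecAny.there u∈) = ∈-pad⁻ {l} [] u≢ u∈
    ∈-pad⁻ {suc l} (_ ∷ us) u≢ (VecAny.here eq)  = here eq
    ∈-pad⁻ {suc l} (_ ∷ us) u≢ (VecAny.there u∈) = there (∈-pad⁻ us u≢ u∈)

    name : Monomial n → J
    name m = pad k (List.map varU (members m))

    named-name : ∀ m → ∣ m ∣ ≤ k → named (name m) ≡ m
    named-name m m≤k = ⊆-antisym to from
      where
      to : ∀ {v} → v ∈ₛ named (name m) → v ∈ₛ m
      to {v} v∈ with _ , w∈ , eq ← ∈-map⁻ varU (∈-pad⁻ (List.map varU (members m)) (nullU≢varU v) (∈-named⁻ (name m) v∈))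
        with refl ← varU-injective eq = ∈-members⁻ m w∈
      from : ∀ {v} → v ∈ₛ m → v ∈ₛ named (name m)
      from v∈m = ∈-named⁺ (name m) (∈-pad⁺ (List.map varU (members m))
        (subst (_≤ k) (sym (trans (length-map varU (members m)) (length-members m))) m≤k)
        (∈-map⁺ varU (∈-members⁺ v∈m)))

    ∣named∣≤ : ∀ (j : J) → ∣ named j ∣ ≤ k
    ∣named∣≤ j = subst (_≤ k) (length-members (named j)) (Finₚ.injective⇒≤ {f = position} position-injective)
      where
      member∈ : ∀ i → varU (List.lookup (members (named j)) i) ∈ j
      member∈ i = ∈-named⁻ j (∈-members⁻ (named j) (∈ₗ-lookup i))
      position : Fin (length (members (named j))) → Fin k
      position i = VecAny.index (member∈ i)
      position-injective : Injective _≡_ _≡_ position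
      position-injective {i} {i′} eq = lookup-injective (members-unique (named j)) (varU-injective
        (trans (lookup-index (member∈ i)) (trans (cong (Vec.lookup j) eq) (sym (lookup-index (member∈ i′))))))

    multiplicity≢0 : ∀ j → multiplicity j ≢ 0ℚ
    multiplicity≢0 j eq = contradiction
      (trans (sym (indicator-yes (named j ≟ₛ named j) refl))
        (∑≡0⇒≡0 (elements tuples) _ (λ d → indicator-nonNeg (named d ≟ₛ named j)) eq (complete tuples j)))
      λ ()

    -- All names of a monomial carry the same weight, the inverse of their number, so together they
    -- count the monomial once.
    average : ∀ (f : Poly n) j →
      sum tuples (λ c → f (named c) * (indicator (named c ≟ₛ named j) * inverse (multiplicity c))) ≡ f (named j)
    average f j = begin
      sum tuples (λ c → f (named c) * (indicator (named c ≟ₛ named j) * inverse (multiplicity c)))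
        ≡⟨ ∑-cong (elements tuples) (λ c → pointwise c (named c ≟ₛ named j)) ⟩
      sum tuples (λ c → indicator (named c ≟ₛ named j) * q)
        ≡⟨ ∑-*ʳ (elements tuples) _ q ⟩
      multiplicity j * (inverse (multiplicity j) * f (named j))
        ≡⟨ ℚₚ.*-assoc (multiplicity j) (inverse (multiplicity j)) (f (named j)) ⟨
      multiplicity j * inverse (multiplicity j) * f (named j)
        ≡⟨ cong (_* f (named j)) (*-inverse (multiplicity≢0 j)) ⟩
      1ℚ * f (named j)
        ≡⟨ ℚₚ.*-identityˡ (f (named j)) ⟩
      f (named j) ∎
      where
      open ≡-Reasoning
      q = inverse (multiplicity j) * f (named j)
      -- The weight depends on a tuple only through the monomial it names, so an equation between
      -- monomials suffices to rewrite it.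
      weight : Monomial n → ℚ
      weight m = inverse (sum tuples λ d → indicator (named d ≟ₛ m))
      pointwise : ∀ c (c≟j : Dec (named c ≡ named j)) →
        f (named c) * (indicator c≟j * inverse (multiplicity c)) ≡ indicator c≟j * q
      pointwise c (yes eq) = trans (cong (λ m → f m * (1ℚ * weight m)) eq)
        (solve 2 (λ a b → a :* (con 1ℚ :* b) := con 1ℚ :* (b :* a)) refl (f (named j)) (weight (named j)))
      pointwise c (no _) = solve 3 (λ a b c → a :* (con 0ℚ :* b) := con 0ℚ :* c) refl (f (named c)) (inverse (multiplicity c)) q

    -- A monomial containing `v` arises from itself and from itself without `v`. Both have at most
    -- `k` variables, hence names, and `average` evaluates the two contributions. A monomial without
    -- `v` does not arise.
    times-correct : ∀ {x v} → decode x ≡ varE v → ∀ (f : Poly n) b →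
      sum tuples (λ c → f (named c) * times x c b) ≡ (v · f) (named b)
    times-correct {x} {v} x≡v f b with v ∈ₛ? named b
    ... | no v∉b = trans (∑-cong (elements tuples) vanish) (trans (∑-0 (elements tuples)) (sym (·-∉ v f v∉b)))
      where
      not-adjoined : ∀ c → ¬ (∃[ w ] decode x ≡ varE w × named c ∪ ⁅ w ⁆ ≡ named b)
      not-adjoined c (w , x≡w , eq) with trans (sym x≡v) x≡w
      ... | refl = v∉b (subst (v ∈ₛ_) eq (x∈p∪q⁺ {p = named c} (inj₂ (x∈⁅x⁆ v))))
      vanish : ∀ c → f (named c) * times x c b ≡ 0ℚ
      vanish c = trans (cong (λ i → f (named c) * (i * inverse (multiplicity c))) (indicator-no (adjoins? x c b) (not-adjoined c)))
        (solve 2 (λ a b → a :* (con 0ℚ :* b) := con 0ℚ) refl (f (named c)) (inverse (multiplicity c)))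
    ... | yes v∈b = begin
      sum tuples (λ c → f (named c) * times x c b)
        ≡⟨ ∑-cong (elements tuples) (λ c → trans (cong (λ i → f (named c) * (i * inverse (multiplicity c))) (split c))
             (solve 4 (λ f w a b → f :* ((a :+ b) :* w) := f :* (a :* w) :+ f :* (b :* w)) refl
               (f (named c)) (inverse (multiplicity c)) (indicator (named c ≟ₛ named b)) (indicator (named c ≟ₛ named b⁻)))) ⟩
      sum tuples (λ c → f (named c) * (indicator (named c ≟ₛ named b) * inverse (multiplicity c))
                      + f (named c) * (indicator (named c ≟ₛ named b⁻) * inverse (multiplicity c)))
        ≡⟨ ∑-+ (elements tuples) _ _ ⟩
      sum tuples (λ c → f (named c) * (indicator (named c ≟ₛ named b) * inverse (multiplicity c)))
        + sum tuples (λ c → f (named c) * (indicator (named c ≟ₛ named b⁻) * inverse (multiplicity c)))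
        ≡⟨ cong₂ _+_ (average f b) (trans (average f b⁻) (cong f named-b⁻)) ⟩
      f (named b) + f (named b - v)
        ≡⟨ ·-∈ v f v∈b ⟨
      (v · f) (named b) ∎
      where
      open ≡-Reasoning
      b⁻ : J
      b⁻ = name (named b - v)
      named-b⁻ : named b⁻ ≡ named b - v
      named-b⁻ = named-name (named b - v) (ℕₚ.≤-trans (∣p─q∣≤∣p∣ (named b) ⁅ v ⁆) (∣named∣≤ b))
      v∉b⁻ : v ∉ₛ named b⁻
      v∉b⁻ v∈ = proj₂ (∈-delete⁻ (named b) (subst (v ∈ₛ_) named-b⁻ v∈)) refl
      split : ∀ c → indicator (adjoins? x c b) ≡ indicator (named c ≟ₛ named b) + indicator (named c ≟ₛ named b⁻)
      split c with named c ≟ₛ named b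
      ... | yes c≡b = trans (indicator-yes (adjoins? x c b) (v , x≡v , trans (cong (_∪ ⁅ v ⁆) c≡b) (∪-absorbs (named b) v∈b)))
            (cong (1ℚ +_) (sym (indicator-no (named c ≟ₛ named b⁻) λ c≡b⁻ → v∉b⁻ (subst (v ∈ₛ_) (trans (sym c≡b) c≡b⁻) v∈b))))
      ... | no c≢b with named c ≟ₛ named b⁻
      ...   | yes c≡b⁻ = indicator-yes (adjoins? x c b) (v , x≡v ,
              trans (cong (_∪ ⁅ v ⁆) (trans c≡b⁻ named-b⁻)) (delete-∪ (named b) v∈b))
      ...   | no c≢b⁻ = indicator-no (adjoins? x c b) not-adjoined
        where
        not-adjoined : ¬ (∃[ w ] decode x ≡ varE w × named c ∪ ⁅ w ⁆ ≡ named b)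
        not-adjoined (w , x≡w , eq) with trans (sym x≡v) x≡w
        ... | refl with v ∈ₛ? named c
        ...   | yes v∈c = c≢b (trans (sym (∪-absorbs (named c) v∈c)) eq)
        ...   | no  v∉c = c≢b⁻ (trans (∪-delete (named c) (named b) v∉c eq) (sym named-b⁻))

    -- Above degree `k`, a coefficient of the product is `f m + f (m - v)` or zero. The first term
    -- vanishes by the degree of `f`. So does the second, unless `m - v` has a name, and then it
    -- sits in an offending column.
    adjoin-degree : ∀ {x v} → decode x ≡ varE v → ∀ {f : Poly n} → Degree≤ k f →
      (∀ b → f (named b) * indicator (exceeds? x b) ≡ 0ℚ) → Degree≤ k (v · f)
    adjoin-degree {x} {v} x≡v {f} deg bound m k<m with v ∈ₛ? m
    ... | no v∉m  = ·-∉ v f v∉m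
    ... | yes v∈m = trans (·-∈ v f v∈m) (cong₂ _+_ (deg m k<m) (lower (∣ m - v ∣ ℕₚ.≤? k)))
      where
      lower : Dec (∣ m - v ∣ ≤ k) → f (m - v) ≡ 0ℚ
      lower (no ≰k) = deg (m - v) (ℕₚ.≰⇒> ≰k)
      lower (yes ≤k) = begin
        f (m - v)                                         ≡⟨ cong f named-b ⟨
        f (named b)                                       ≡⟨ ℚₚ.*-identityʳ (f (named b)) ⟨
        f (named b) * 1ℚ                                  ≡⟨ cong (f (named b) *_) (indicator-yes (exceeds? x b) exceeds) ⟨
        f (named b) * indicator (exceeds? x b)            ≡⟨ bound b ⟩
        0ℚ                                                ∎
        where
        open ≡-Reasoning
        b : J
        b = name (m - v)
        named-b : named b ≡ m - v
        named-b = named-name (m - v) ≤k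
        exceeds : ∃[ w ] decode x ≡ varE w × k < ∣ named b ∪ ⁅ w ⁆ ∣
        exceeds = v , x≡v , subst (λ p → k < ∣ p ∣) (sym (trans (cong (_∪ ⁅ v ⁆) named-b) (delete-∪ m v∈m))) k<m

    -- Nothing cancels in an offending coefficient: for `v` outside `s`, the product has
    -- `f (s ∪ ⁅ v ⁆) + f s` at `s ∪ ⁅ v ⁆`, where the first term is already zero.
    degree-bound : ∀ {x v} → decode x ≡ varE v → ∀ {f : Poly n} → Degree≤ k f → Degree≤ k (v · f) →
      ∀ b → f (named b) * indicator (exceeds? x b) ≡ 0ℚ
    degree-bound {x} {v} x≡v {f} deg deg′ b = by-cases (exceeds? x b)
      where
      open ≡-Reasoning
      s = named b
      f≡0 : ∃[ w ] decode x ≡ varE w × k < ∣ s ∪ ⁅ w ⁆ ∣ → f s ≡ 0ℚ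
      f≡0 (w , x≡w , k<) with trans (sym x≡v) x≡w
      ... | refl with v ∈ₛ? s
      ...   | yes v∈s = deg s (subst (λ p → k < ∣ p ∣) (∪-absorbs s v∈s) k<)
      ...   | no  v∉s = begin
        f s                               ≡⟨ ℚₚ.+-identityˡ (f s) ⟨
        0ℚ + f s                          ≡⟨ cong₂ _+_ (sym (deg (s ∪ ⁅ v ⁆) k<)) (cong f (∪-delete s (s ∪ ⁅ v ⁆) v∉s refl)) ⟩
        f (s ∪ ⁅ v ⁆) + f (s ∪ ⁅ v ⁆ - v) ≡⟨ ·-∈ v f (x∈p∪q⁺ {p = s} (inj₂ (x∈⁅x⁆ v))) ⟨
        (v · f) (s ∪ ⁅ v ⁆)               ≡⟨ deg′ (s ∪ ⁅ v ⁆) k< ⟩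
        0ℚ                                ∎
      by-cases : (e? : Dec (∃[ w ] decode x ≡ varE w × k < ∣ s ∪ ⁅ w ⁆ ∣)) → f s * indicator e? ≡ 0ℚ
      by-cases (yes e) = trans (ℚₚ.*-identityʳ (f s)) (f≡0 e)
      by-cases (no _)  = ℚₚ.*-zeroʳ (f s)

    -- Soundness

    -- The polynomial is determined by the vector, since lines of a derivation vanish on the
    -- monomials of degree above `k`, and all others have names.
    Represents : (J → ℚ) → Set
    Represents g = ∃[ f ] Derivable k P f × (∀ j → g j ≡ f (named j))

    represents-cong : ∀ {g h} → g ≗ h → Represents h → Represents g
    represents-cong g≗h (f , d , h≡f) = f , d , λ j → trans (g≗h j) (h≡f j)

    represents-0 : Represents (λ _ → 0ℚ)
    represents-0 = _ , poly⇒zero-derivable i₀ , λ _ → refl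

    represents-lin : ∀ a b {g h} → Represents g → Represents h → Represents (λ j → a * g j + b * h j)
    represents-lin a b (f , d , g≡f) (f′ , d′ , h≡f′) = lin a f b f′ , lincomb a b d′ d ,
      λ j → cong₂ (λ p q → a * p + b * q) (g≡f j) (h≡f′ j)

    represents-∑ : ∀ {X : Set} (xs : List X) (v : X → ℚ) (M : Matrix X J) → (∀ x → Represents (M x)) →
      Represents (λ j → ∑ xs λ x → v x * M x j)
    represents-∑ xs v M rep = _ , derivable-∑ (poly⇒zero-derivable i₀) xs v (proj₁ ∘ rep) (proj₁ ∘ proj₂ ∘ rep) ,
      λ j → ∑-cong xs λ x → cong (v x *_) (proj₂ (proj₂ (rep x)) j)

    Sound : {I : Set} → Matrix I J → Set
    Sound M = ∀ i → Represents (M i)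

    gram-sound : {I : Set} (e : Enum I) (M : Matrix I J) → Sound M → Sound (gram e M)
    gram-sound e M sound a = represents-∑ (elements e) (λ i → M i a) M sound

    ⊕-sound : ∀ (M N : Matrix J J) → Sound M → Sound N → Sound (M ⊕ N)
    ⊕-sound M N sM sN i = represents-cong
      (λ j → cong₂ _+_ (sym (ℚₚ.*-identityˡ (M i j))) (sym (ℚₚ.*-identityˡ (N i j))))
      (represents-lin 1ℚ 1ℚ (sM i) (sN i))

    poly₀-sound : ∀ r M → Sound M → Sound (poly₀ tuples r M)
    poly₀-sound []      M sound i = represents-0
    poly₀-sound (c ∷ r) M sound i = represents-cong
      (λ j → cong (c * M i j +_) (sym (ℚₚ.*-identityˡ ((M ∙[ tuples ] poly₀ tuples r M) i j))))
      (represents-lin c 1ℚ (sound i) (represents-∑ (elements tuples) (M i) (poly₀ tuples r M) (poly₀-sound r M sound)))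

    restrict-sound : ∀ x r M → Sound M → Sound (restrict x r M)
    restrict-sound x r M sound i = represents-cong
      (λ j → solve 2 (λ a b → a :+ :- b := con 1ℚ :* a :+ con (- 1ℚ) :* b) refl (M i j) ((Q ∙[ tuples ] M) i j))
      (represents-lin 1ℚ (- 1ℚ) (sound i) (represents-∑ (elements tuples) (Q i) M sound))
      where Q = poly₀ tuples r (gram tuples (mask x M ᵀ))

    axioms-sound : Sound axioms
    axioms-sound (x , _) = by-element (decode x)
      where
      by-degree : ∀ i (d? : Dec (Degree≤ k (poly P i))) →
        Represents (λ j → if does d? then poly P i (named j) else 0ℚ)
      by-degree i (yes deg) = poly P i , axiom i deg , λ _ → refl
      by-degree i (no _)    = represents-0
      by-element : ∀ el → Represents (λ j → axiomEntry el (named j))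
      by-element (polyE i) = by-degree i (degree≤? k (poly P i))
      by-element (monE _)  = represents-0
      by-element (varE _)  = represents-0
      by-element (coefE _) = represents-0
      by-element (posE _)  = represents-0

    -- Valid for every `r`. An open gate provides the hypothesis of `adjoin-degree`; a closed gate,
    -- or an `x` that is not a variable, leaves the zero row.
    shift-sound : ∀ r M → Sound M → Sound (shift r M)
    shift-sound r M sound (x , d) = by-gate (total ℚₚ.≟ 0ℚ)
      where
      F = restrict x r M
      total = sum tuples λ b → mask x F d b * mask x F d b
      product : Represents (F d) → (∀ b → mask x F d b ≡ 0ℚ) → Dec (∃[ v ] decode x ≡ varE v × ⊤) →
        Represents (λ b → (F ∙[ tuples ] times x) d b)
      product _ _ (no ¬var) = represents-cong (∙-zeroʳ tuples F {N = times x} (λ c b →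
        trans (cong (_* inverse (multiplicity c)) (indicator-no (adjoins? x c b) λ (v , x≡v , _) → ¬var (v , x≡v , tt)))
          (ℚₚ.*-zeroˡ (inverse (multiplicity c)))) d) represents-0
      product (f , der , F≡f) masked≡0 (yes (v , x≡v , _)) =
        v · f ,
        mult v der (adjoin-degree x≡v (derivable-degree der)
          λ b → trans (cong (_* indicator (exceeds? x b)) (sym (F≡f b))) (masked≡0 b)) ,
        λ b → trans (∑-cong (elements tuples) λ c → cong (_* times x c b) (F≡f c)) (times-correct x≡v f b)
      by-gate : (z? : Dec (total ≡ 0ℚ)) → Represents (λ b → indicator z? * (F ∙[ tuples ] times x) d b)
      by-gate (no _) = represents-cong (λ b → ℚₚ.*-zeroˡ ((F ∙[ tuples ] times x) d b)) represents-0
      by-gate (yes z) = represents-cong (λ b → ℚₚ.*-identityˡ ((F ∙[ tuples ] times x) d b))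
        (product (restrict-sound x r M sound d)
          (λ b → ∑-*-≡0⇒≡0 (elements tuples) (mask x F d) z (complete tuples b))
          (onVar? (decode x) λ _ → yes tt))

    ⟦⟧-sound : ∀ c → Sound ⟦ c ⟧
    ⟦⟧-sound base       = gram-sound (cartesian universe tuples) axioms axioms-sound
    ⟦⟧-sound (join c d) = ⊕-sound (gram tuples ⟦ c ⟧) (gram tuples ⟦ d ⟧)
      (gram-sound tuples ⟦ c ⟧ (⟦⟧-sound c)) (gram-sound tuples ⟦ d ⟧ (⟦⟧-sound d))
    ⟦⟧-sound (step c r) = gram-sound (cartesian universe tuples) (shift r ⟦ c ⟧) (shift-sound r ⟦ c ⟧ (⟦⟧-sound c))

    test⇒refutable : ∀ c r → test c r ≡ 0ℚ → Refutable k P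
    test⇒refutable c r test≡0 = conclude
      (represents-∑ (elements tuples) unit (poly₀ tuples r ⟦ c ⟧) (poly₀-sound r ⟦ c ⟧ (⟦⟧-sound c)))
      where
      span : J → ℚ
      span j = sum tuples λ a → unit a * poly₀ tuples r ⟦ c ⟧ a j
      span≡unit : ∀ j → span j ≡ unit j
      span≡unit j = ⊖≋0⇒≋ {M = λ (_ : ⊤) → span} {N = λ _ → unit} (λ _ j →
        ∑-*-≡0⇒≡0 (elements tuples) (residue c r) test≡0 (complete tuples j)) tt j
      conclude : Represents span → Refutable k P
      conclude (f , d , span≡f) = resp f≗one d
        where
        one-degree : Degree≤ k (one {n})
        one-degree m k<m = mono-≢ {m = ∅} {m} λ { refl → contradiction (subst (k <_) (∣⊥∣≡0 n) k<m) λ () }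
        f≗one : f ≗ one
        f≗one m with ∣ m ∣ ℕₚ.≤? k
        ... | no ≰k  = trans (derivable-degree d m (ℕₚ.≰⇒> ≰k)) (sym (one-degree m (ℕₚ.≰⇒> ≰k)))
        ... | yes ≤k = trans (cong f (sym (named-name m ≤k)))
          (trans (sym (span≡f (name m))) (trans (span≡unit (name m)) (cong one (named-name m ≤k))))

    -- Completeness

    infix 4 _∈rows_
    _∈rows_ : (J → ℚ) → Matrix J J → Set
    g ∈rows M = Σ[ v ∈ (J → ℚ) ] ∀ j → sum tuples (λ a → v a * M a j) ≡ g j

    row∈gram : {I : Set} (e : Enum I) (M : Matrix I J) (i : I) → M i ∈rows gram e M
    row∈gram e M i = proj₁ (gram-spans e tuples M) i , proj₂ (gram-spans e tuples M) i

    combination∈gram : {I : Set} (e : Enum I) (M : Matrix I J) (w : I → ℚ) {g : J → ℚ} →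
      (∀ j → sum e (λ i → w i * M i j) ≡ g j) → g ∈rows gram e M
    combination∈gram {I} e M w {g} wM≡g = (W ∙[ e ] V) tt , λ j → begin
      ((W ∙[ e ] V) ∙[ tuples ] gram e M) tt j   ≡⟨ ∙-assoc e tuples W V (gram e M) tt j ⟩
      (W ∙[ e ] (V ∙[ tuples ] gram e M)) tt j   ≡⟨ ∙-congˡ e W (proj₂ (gram-spans e tuples M)) tt j ⟩
      (W ∙[ e ] M) tt j                          ≡⟨ wM≡g j ⟩
      g j                                        ∎
      where
      open ≡-Reasoning
      W : Matrix ⊤ I
      W _ = w
      V = proj₁ (gram-spans e tuples M)

    0∈rows : ∀ M {g} → (∀ j → g j ≡ 0ℚ) → g ∈rows M
    0∈rows M g≡0 = (λ _ → 0ℚ) , λ j →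
      trans (∙-zeroˡ tuples {M = λ (_ : ⊤) _ → 0ℚ} M (λ _ _ → refl) tt j) (sym (g≡0 j))

    axiom∈rows : ∀ i → Degree≤ k (poly P i) → (poly P i ∘ named) ∈rows ⟦ base ⟧
    axiom∈rows i deg = v , λ j → trans (vM≡ j) (entry (named j))
      where
      u = proj₁ (decode-covers (polyE i) tt)
      -- The rows of `axioms` are the same for all tuples, so any tuple serves here.
      row = row∈gram (cartesian universe tuples) axioms (u , name ∅)
      v = proj₁ row
      vM≡ = proj₂ row
      entry : ∀ m → axiomEntry (decode u) m ≡ poly P i m
      entry m = trans (cong (λ el → axiomEntry el m) (proj₂ (decode-covers (polyE i) tt)))
        (cong (if_then poly P i m else 0ℚ) (dec-true (degree≤? k (poly P i)) deg))

    lincomb∈rows : ∀ c d a b {g h} → g ∈rows ⟦ c ⟧ → h ∈rows ⟦ d ⟧ →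
      (λ j → a * g j + b * h j) ∈rows ⟦ join c d ⟧
    lincomb∈rows c d a b {g} {h} (v , vM≡g) (w , wN≡h) = proj₁ rows , λ j → begin
      sum tuples (λ i → proj₁ rows i * ⟦ join c d ⟧ i j)
        ≡⟨ ∑-cong (elements tuples) (λ i → cong (proj₁ rows i *_) (sym (gram-stack tuples ⟦ c ⟧ ⟦ d ⟧ i j))) ⟩
      sum tuples (λ i → proj₁ rows i * gram (cartesian bools tuples) M i j)
        ≡⟨ proj₂ rows j ⟩
      a * g j + b * h j ∎
      where
      open ≡-Reasoning
      M = stack ⟦ c ⟧ ⟦ d ⟧
      vw : Bool × J → ℚ
      vw (β , i) = if β then a * v i else b * w i
      scaled : ∀ a (v : J → ℚ) (N : Matrix J J) {g : J → ℚ} → (∀ j → sum tuples (λ i → v i * N i j) ≡ g j) →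
        ∀ j → sum tuples (λ i → a * v i * N i j) ≡ a * g j
      scaled a v N vN≡g j = trans (∑-cong (elements tuples) λ i → ℚₚ.*-assoc a (v i) (N i j))
        (trans (∑-*ˡ (elements tuples) a (λ i → v i * N i j)) (cong (a *_) (vN≡g j)))
      vwM≡ : ∀ j → sum (cartesian bools tuples) (λ βi → vw βi * M βi j) ≡ a * g j + b * h j
      vwM≡ j = trans (∑-cartesianProductWith _,_ (elements bools) (elements tuples) (λ βi → vw βi * M βi j))
        (cong₂ _+_ (scaled a v ⟦ c ⟧ vM≡g j)
          (trans (ℚₚ.+-identityʳ (sum tuples λ i → b * w i * ⟦ d ⟧ i j)) (scaled b w ⟦ d ⟧ wN≡h j)))
      rows : (λ j → a * g j + b * h j) ∈rows gram (cartesian bools tuples) M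
      rows = combination∈gram (cartesian bools tuples) M vw vwM≡

    -- For a suitable r, restrict removes exactly the part of the row space
    -- that violates the degree bound.
    restrict-exact : ∀ x M → ∃[ r ] mask x (restrict x r M) ≋ 0ᴹ ×
      (∀ {g : J → ℚ} (v : J → ℚ) → (∀ j → sum tuples (λ a → v a * M a j) ≡ g j) →
        (∀ j → g j * indicator (exceeds? x j) ≡ 0ℚ) →
        ∀ j → sum tuples (λ a → v a * restrict x r M a j) ≡ g j)
    restrict-exact x M = r , masked≋0 , keeps
      where
      open ≡-Reasoning
      R S Q : Matrix J J
      R = mask x M
      S = gram tuples (R ᵀ)
      exact = gram-reproducing tuples tuples (R ᵀ)
      r : List ℚ
      r = proj₁ exact
      Q = poly₀ tuples r S
      -- Transpose of `R ᵀ Q = R ᵀ`, using that `Q` is symmetric. As `mask` acts on columns, it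
      -- commutes with multiplication by `Q` from the left, so the offending part of `M - Q M` is
      -- `R - Q R`.
      QR≋R : Q ∙[ tuples ] R ≋ R
      QR≋R a b = begin
        (Q ∙[ tuples ] R) a b             ≡⟨ ∙-congʳ tuples R (≋-sym (poly₀-symmetric tuples r (gram-symmetric tuples (R ᵀ)))) a b ⟩
        ((Q ᵀ) ∙[ tuples ] R) a b         ≡⟨ ᵀ-∙ tuples (R ᵀ) Q a b ⟨
        ((R ᵀ) ∙[ tuples ] Q) b a         ≡⟨ proj₂ exact b a ⟩
        R a b                             ∎
      mask-∙ : ∀ a b → (Q ∙[ tuples ] M) a b * indicator (exceeds? x b) ≡ (Q ∙[ tuples ] R) a b
      mask-∙ a b = trans (sym (∑-*ʳ (elements tuples) (λ c → Q a c * M c b) (indicator (exceeds? x b))))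
        (∑-cong (elements tuples) λ c → ℚₚ.*-assoc (Q a c) (M c b) (indicator (exceeds? x b)))
      masked≋0 : mask x (restrict x r M) ≋ 0ᴹ
      masked≋0 a b = begin
        (M a b + (- (Q ∙[ tuples ] M) a b)) * i
          ≡⟨ solve 3 (λ m q i → (m :+ :- q) :* i := m :* i :+ :- (q :* i)) refl (M a b) ((Q ∙[ tuples ] M) a b) i ⟩
        R a b + (- ((Q ∙[ tuples ] M) a b * i))
          ≡⟨ cong (λ z → R a b + (- z)) (trans (mask-∙ a b) (QR≋R a b)) ⟩
        R a b + (- R a b)
          ≡⟨ ℚₚ.+-inverseʳ (R a b) ⟩
        0ℚ ∎
        where i = indicator (exceeds? x b)
      keeps : ∀ {g : J → ℚ} (v : J → ℚ) → (∀ j → sum tuples (λ a → v a * M a j) ≡ g j) →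
        (∀ j → g j * indicator (exceeds? x j) ≡ 0ℚ) →
        ∀ j → sum tuples (λ a → v a * restrict x r M a j) ≡ g j
      keeps {g} v vM≡g g-bound j = begin
        (V ∙[ tuples ] (M ⊖ (Q ∙[ tuples ] M))) tt j
          ≡⟨ ∙-distribˡ-⊖ tuples V M (Q ∙[ tuples ] M) tt j ⟩
        (V ∙[ tuples ] M) tt j + (- (V ∙[ tuples ] (Q ∙[ tuples ] M)) tt j)
          ≡⟨ cong₂ (λ p q → p + (- q)) (vM≡g j) (trans (sym (∙-assoc tuples tuples V Q M tt j))
               (∙-zeroˡ tuples M VQ≋0 tt j)) ⟩
        g j + (- 0ℚ)
          ≡⟨ ℚₚ.+-identityʳ (g j) ⟩
        g j ∎
        where
        V : Matrix ⊤ J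
        V _ = v
        VR≋0 : V ∙[ tuples ] R ≋ 0ᴹ
        VR≋0 _ b = begin
          sum tuples (λ a → v a * (M a b * indicator (exceeds? x b)))
            ≡⟨ ∑-cong (elements tuples) (λ a → sym (ℚₚ.*-assoc (v a) (M a b) (indicator (exceeds? x b)))) ⟩
          sum tuples (λ a → v a * M a b * indicator (exceeds? x b))
            ≡⟨ ∑-*ʳ (elements tuples) (λ a → v a * M a b) (indicator (exceeds? x b)) ⟩
          sum tuples (λ a → v a * M a b) * indicator (exceeds? x b)
            ≡⟨ cong (_* indicator (exceeds? x b)) (vM≡g b) ⟩
          g b * indicator (exceeds? x b)
            ≡⟨ g-bound b ⟩
          0ℚ ∎
        -- A combination without offending part has `V R = 0`. It is therefore annihilated by
        -- `S = R R ᵀ` and by `Q`, so subtracting `Q M` does not change it.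
        VQ≋0 : V ∙[ tuples ] Q ≋ 0ᴹ
        VQ≋0 = poly₀-annihilated tuples r V λ i j →
          trans (sym (∙-assoc tuples tuples V R (R ᵀ) i j)) (∙-zeroˡ tuples (R ᵀ) VR≋0 i j)

    mult∈rows : ∀ c v {f} → Degree≤ k f → Degree≤ k (v · f) → (f ∘ named) ∈rows ⟦ c ⟧ →
      ∃[ r ] ((v · f) ∘ named) ∈rows ⟦ step c r ⟧
    mult∈rows c v {f} deg deg′ (w , wM≡f) = r , rows
      where
      open ≡-Reasoning
      x = varU v
      exact = restrict-exact x ⟦ c ⟧
      r = proj₁ exact
      F = restrict x r ⟦ c ⟧
      wF≡f = proj₂ (proj₂ exact) {f ∘ named} w wM≡f (degree-bound (decode-varU v) deg deg′)
      F-times = F ∙[ tuples ] times x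
      gate≡1 : ∀ d → gate x F d ≡ 1ℚ
      gate≡1 d = indicator-yes (sum tuples (λ b → mask x F d b * mask x F d b) ℚₚ.≟ 0ℚ)
        (trans (∑-cong (elements tuples) λ b → cong₂ _*_ (proj₁ (proj₂ exact) d b) (proj₁ (proj₂ exact) d b))
          (∑-0 (elements tuples)))
      M = shift r ⟦ c ⟧
      V : Matrix (U × J) J
      V = proj₁ (gram-spans (cartesian universe tuples) tuples M)
      wM≡vf : ∀ j → sum tuples (λ d → w d * M (x , d) j) ≡ (v · f) (named j)
      wM≡vf j = begin
        sum tuples (λ d → w d * (gate x F d * F-times d j))
          ≡⟨ ∑-cong (elements tuples) (λ d → cong (w d *_)
               (trans (cong (_* F-times d j) (gate≡1 d)) (ℚₚ.*-identityˡ (F-times d j)))) ⟩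
        (W ∙[ tuples ] F-times) tt j
          ≡⟨ ∙-assoc tuples tuples W F (times x) tt j ⟨
        ((W ∙[ tuples ] F) ∙[ tuples ] times x) tt j
          ≡⟨ ∙-congʳ tuples {M = W ∙[ tuples ] F} {M′ = λ _ c → f (named c)} (times x) (λ _ c → wF≡f c) tt j ⟩
        sum tuples (λ c → f (named c) * times x c j)
          ≡⟨ times-correct (decode-varU v) f j ⟩
        (v · f) (named j) ∎
        where
        W : Matrix ⊤ J
        W _ = w
      rows : ((v · f) ∘ named) ∈rows gram (cartesian universe tuples) M
      rows = (W ∙[ tuples ] V′) tt , λ j → begin
        ((W ∙[ tuples ] V′) ∙[ tuples ] gram (cartesian universe tuples) M) tt j
          ≡⟨ ∙-assoc tuples tuples W V′ (gram (cartesian universe tuples) M) tt j ⟩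
        (W ∙[ tuples ] (V′ ∙[ tuples ] gram (cartesian universe tuples) M)) tt j
          ≡⟨ ∙-congˡ tuples W (λ d j → proj₂ (gram-spans (cartesian universe tuples) tuples M) (x , d) j) tt j ⟩
        sum tuples (λ d → w d * M (x , d) j)
          ≡⟨ wM≡vf j ⟩
        (v · f) (named j) ∎
        where
        W : Matrix ⊤ J
        W _ = w
        V′ : Matrix J J
        V′ d = V (x , d)

    -- Induction on the derivation, whose shape the code copies. Each use of `mult` contributes the
    -- list that `restrict-exact` finds for the matrix reached so far.
    derivable⇒∈rows : ∀ {f} → Derivable k P f → ∃[ c ] (f ∘ named) ∈rows ⟦ c ⟧
    derivable⇒∈rows (axiom i deg)   = base , axiom∈rows i deg
    derivable⇒∈rows (boolean x deg) = base , 0∈rows ⟦ base ⟧ (boolean≗0 x ∘ named)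
    derivable⇒∈rows (mult x d deg)  =
      let c , f∈ = derivable⇒∈rows d
          r , xf∈ = mult∈rows c x (derivable-degree d) deg f∈
      in step c r , xf∈
    derivable⇒∈rows (lincomb {f} {g} a b d d′) =
      let c , f∈ = derivable⇒∈rows d
          c′ , g∈ = derivable⇒∈rows d′
      in join c′ c , lincomb∈rows c′ c a b g∈ f∈
    derivable⇒∈rows (resp f≗g d) =
      let c , v , vM≡f = derivable⇒∈rows d
      in c , v , λ j → trans (vM≡f j) (f≗g (named j))

    refutable⇒test : Refutable k P → ∃[ c ] ∃[ r ] test c r ≡ 0ℚ
    refutable⇒test d = c , r , trans (∑-cong (elements tuples) λ j →
        cong₂ _*_ (residue≡0 j) (residue≡0 j)) (∑-0 (elements tuples))
      where
      open ≡-Reasoning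
      spanned = derivable⇒∈rows d
      c = proj₁ spanned
      v = proj₁ (proj₂ spanned)
      vM≡unit = proj₂ (proj₂ spanned)
      M = ⟦ c ⟧
      r = proj₁ (reproducing tuples (⟦⟧-symmetric c))
      Q = poly₀ tuples r M
      V : Matrix ⊤ J
      V _ = v
      residue≡0 : ∀ j → residue c r j ≡ 0ℚ
      residue≡0 j = ≋⇒⊖≋0 {M = λ (_ : ⊤) j → sum tuples λ a → unit a * Q a j} {N = λ _ → unit} (λ _ j → begin
        sum tuples (λ a → unit a * Q a j)
          ≡⟨ ∑-cong (elements tuples) (λ a → cong (_* Q a j) (sym (vM≡unit a))) ⟩
        ((V ∙[ tuples ] M) ∙[ tuples ] Q) tt j
          ≡⟨ ∙-assoc tuples tuples V M Q tt j ⟩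
        (V ∙[ tuples ] (M ∙[ tuples ] Q)) tt j
          ≡⟨ ∙-congˡ tuples V (λ a b → trans (poly₀-comm tuples r M a b) (proj₂ (reproducing tuples (⟦⟧-symmetric c)) a b)) tt j ⟩
        (V ∙[ tuples ] M) tt j
          ≡⟨ vM≡unit j ⟩
        unit j ∎) tt j

open Equivalence using (to; from)

-- Sums determined by the multiplicities of their values

module Counting where

  open import Data.Rational.Base using (_+_)

  module _ {X : Set} where

    count : (X → ℚ) → ℚ → List X → ℕ
    count f q xs = length (filter (λ x → f x ℚₚ.≟ q) xs)

    count-∷ : ∀ (f : X → ℚ) q x xs → count f q (x ∷ xs) ≡ (if does (f x ℚₚ.≟ q) then 1 else 0) ℕ.+ count f q xs
    count-∷ f q x xs with does (f x ℚₚ.≟ q)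
    ... | true  = refl
    ... | false = refl

    count≥1⇒∈ : ∀ (f : X → ℚ) q xs → 1 ≤ count f q xs → ∃[ x ] x ∈ₗ xs × f x ≡ q
    count≥1⇒∈ f q xs 1≤ with filter (λ x → f x ℚₚ.≟ q) xs in eq
    count≥1⇒∈ f q xs () | []
    ... | x ∷ _ = x , ∈-filter⁻ (λ x → f x ℚₚ.≟ q) (subst (x ∈ₗ_) (sym eq) (here refl))

  -- Lower bounds on multiplicities suffice: those of `g` already exhaust `ys`, and `xs` is no
  -- longer than `ys`. Counting quantifiers express exactly such lower bounds. Matching entries are
  -- removed in pairs.
  counts-determine-∑ : ∀ {X Y : Set} (xs : List X) (ys : List Y) f g → length xs ≤ length ys →
    (∀ q → count g q ys ≤ count f q xs) → ∑ xs f ≡ ∑ ys g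
  counts-determine-∑ []       []       f g _  _ = refl
  counts-determine-∑ (x ∷ xs) []       f g () _
  counts-determine-∑ xs       (y ∷ ys) f g le counts
    with x , x∈ , fx≡gy ← count≥1⇒∈ f (g y) xs
           (ℕₚ.≤-trans (subst (1 ≤_) (sym (trans (count-∷ g (g y) y ys)
             (cong (λ b → (if b then 1 else 0) ℕ.+ count g (g y) ys) (dec-true (g y ℚₚ.≟ g y) refl)))) (s≤s z≤n)) (counts (g y)))
    with as , bs , refl ← ∈-∃++ x∈
    = begin
    ∑ (as ++ x ∷ bs) f            ≡⟨ ∑-++ as (x ∷ bs) f ⟩
    ∑ as f + (f x + ∑ bs f)       ≡⟨ solve 3 (λ a x b → a :+ (x :+ b) := x :+ (a :+ b)) refl (∑ as f) (f x) (∑ bs f) ⟩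
    f x + (∑ as f + ∑ bs f)       ≡⟨ cong₂ _+_ fx≡gy (sym (∑-++ as bs f)) ⟩
    g y + ∑ (as ++ bs) f          ≡⟨ cong (g y +_) (counts-determine-∑ (as ++ bs) ys f g
                                       (ℕₚ.≤-pred (subst (_≤ suc (length ys)) (length-++-sucʳ as x bs) le)) counts′) ⟩
    g y + ∑ ys g                  ∎
    where
    open ≡-Reasoning
    counts′ : ∀ q → count g q ys ≤ count f q (as ++ bs)
    counts′ q = ℕₚ.+-cancelˡ-≤ (if does (g y ℚₚ.≟ q) then 1 else 0) (count g q ys) (count f q (as ++ bs))
      (subst (_≤ _) (count-∷ g q y ys) (ℕₚ.≤-trans (counts q) (ℕₚ.≤-reflexive (trans
        (↭-length (filter-↭ (λ x → f x ℚₚ.≟ q) (↭-shift x as bs)))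
        (trans (count-∷ f q x (as ++ bs)) (cong (λ p → (if does (p ℚₚ.≟ q) then 1 else 0) ℕ.+ count f q (as ++ bs)) fx≡gy))))))

open Counting

-- Closing formulas under universal quantifiers

module _ {τ : Signature} {w : ℕ} where

  -- `IsSentence` is syntactic, whereas a definability proof does not track free variables.
  -- Quantifying over every variable is harmless, because the property finally defined ignores the
  -- environment.
  closure : List (Fin w) → Formula τ w → Formula τ w
  closure xs φ = foldr all φ xs

  closure-free : ∀ xs φ y → Free y (closure xs φ) → y ∉ₗ xs
  closure-free (x ∷ xs) φ y (y≢x , free) (here y≡x) = y≢x y≡x
  closure-free (x ∷ xs) φ y (y≢x , free) (there y∈) = closure-free xs φ y free y∈

  closure-sentence : ∀ φ → IsSentence (closure (allFin w) φ)
  closure-sentence φ y free = closure-free (allFin w) φ y free (∈-allFin y)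

  module _ (A : Structure τ) (φ : Formula τ w) where

    closure-intro : ∀ xs → (∀ α → Sat A α φ) → ∀ α → Sat A α (closure xs φ)
    closure-intro []       sat α = sat α
    closure-intro (x ∷ xs) sat α u = closure-intro xs sat _

    closure-elim : ∀ xs α → Sat A α (closure xs φ) → ∃[ β ] Sat A β φ
    closure-elim []       α sat = α , sat
    closure-elim (x ∷ xs) α sat = closure-elim xs _ (sat (α x))

-- Environments

record Model : Set where
  field
    system    : System
    structure : Structure systemSignature
    encoding  : Encodes structure system

open Model public

Uni : Model → Set
Uni M = Universe (structure M)

-- Definable properties and rational functions with a fixed supply of variables

module Definability (k : ℕ) where

  -- The six single variables hold the current element, a monomial, a coefficient, an element
  -- ranging over a set of variables, and two bit positions.
  width : ℕ
  width = 3 ℕ.* k ℕ.+ 6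

  data Slot : Set where
    tup : Fin 3 → Fin k → Slot
    el  : Fin 6 → Slot

  slot : Slot → Fin width
  slot (tup a i) = combine a i ↑ˡ 6
  slot (el s)    = (3 ℕ.* k) ↑ʳ s

  ↑ˡ≢↑ʳ : ∀ {m n} {i : Fin m} {j : Fin n} → i ↑ˡ n ≢ m ↑ʳ j
  ↑ˡ≢↑ʳ {m} {n} {i} {j} eq with trans (sym (Finₚ.splitAt-↑ˡ m i n)) (trans (cong (splitAt m) eq) (Finₚ.splitAt-↑ʳ m n j))
  ... | ()

  slot-injective : ∀ s t → slot s ≡ slot t → s ≡ t
  slot-injective (tup a i) (tup b j) eq with refl , refl ← Finₚ.combine-injective a i b j (Finₚ.↑ˡ-injective 6 _ _ eq) = refl
  slot-injective (tup a i) (el t)    eq = contradiction eq ↑ˡ≢↑ʳ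
  slot-injective (el s)    (tup b j) eq = contradiction (sym eq) ↑ˡ≢↑ʳ
  slot-injective (el s)    (el t)    eq = cong el (Finₚ.↑ʳ-injective (3 ℕ.* k) s t eq)

  -- Vectors and fields rather than functions, so that environments with equal entries are equal and
  -- properties can be transported along `view-upd`.
  record Env (U : Set) : Set where
    constructor env
    field
      tuple              : Vec (Vec U k) 3
      e₀ e₁ e₂ e₃ e₄ e₅ : U

  open Env public

  lookup-ext : ∀ {X : Set} {l} (xs ys : Vec X l) → lookup xs ≗ lookup ys → xs ≡ ys
  lookup-ext xs ys eq = trans (sym (Vecₚ.tabulate∘lookup xs)) (trans (Vecₚ.tabulate-cong eq) (Vecₚ.tabulate∘lookup ys))

  module _ {U : Set} where

    singles : Env U → Fin 6 → U
    singles ρ 0F = e₀ ρ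
    singles ρ 1F = e₁ ρ
    singles ρ 2F = e₂ ρ
    singles ρ 3F = e₃ ρ
    singles ρ 4F = e₄ ρ
    singles ρ 5F = e₅ ρ

    fromFun : Vec (Vec U k) 3 → (Fin 6 → U) → Env U
    fromFun t f = env t (f 0F) (f 1F) (f 2F) (f 3F) (f 4F) (f 5F)

    fromFun-cong : ∀ {t t′ f f′} → t ≡ t′ → f ≗ f′ → fromFun t f ≡ fromFun t′ f′
    fromFun-cong {f = f} {f′} refl f≗f′
      rewrite f≗f′ 0F | f≗f′ 1F | f≗f′ 2F | f≗f′ 3F | f≗f′ 4F | f≗f′ 5F = refl

    blk : Fin 3 → Env U → Vec U k
    blk a ρ = lookup (tuple ρ) a

    get : Env U → Slot → U
    get ρ (tup a i) = lookup (blk a ρ) i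
    get ρ (el s)    = singles ρ s

    updBlk : Env U → Fin 3 → (Vec U k → Vec U k) → Env U
    updBlk ρ a g = record ρ { tuple = updateAt (tuple ρ) a g }

    setBlk : Env U → Fin 3 → Vec U k → Env U
    setBlk ρ a v = updBlk ρ a (const v)

    upd : Env U → Slot → U → Env U
    upd ρ (tup a i) u = updBlk ρ a (_[ i ]≔ u)
    upd ρ (el s)    u = fromFun (tuple ρ) (Fun.updateAt (singles ρ) s (const u))

    view : (Fin width → U) → Env U
    view α = fromFun (tabulate λ a → tabulate λ i → α (slot (tup a i))) (α ∘ slot ∘ el)

    get-view : ∀ α s → get (view α) s ≡ α (slot s)
    get-view α (tup a i) = trans (cong (λ v → lookup v i) (Vecₚ.lookup∘tabulate (λ a → tabulate λ i → α (slot (tup a i))) a))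
      (Vecₚ.lookup∘tabulate (λ i → α (slot (tup a i))) i)
    get-view α (el 0F) = refl
    get-view α (el 1F) = refl
    get-view α (el 2F) = refl
    get-view α (el 3F) = refl
    get-view α (el 4F) = refl
    get-view α (el 5F) = refl

    view-upd : ∀ α s u → view (Fun.updateAt α (slot s) (const u)) ≡ upd (view α) s u
    view-upd α s@(tup a i) u = fromFun-cong
      (lookup-ext _ _ λ b → lookup-ext _ _ λ j → trans (get-view α′ (tup b j)) (sym (entry b j)))
      (λ t → Funₚ.updateAt-minimal (slot (el t)) (slot s) {const u} α λ eq → contradiction (slot-injective (el t) s eq) λ ())
      where
      α′ = Fun.updateAt α (slot s) (const u)
      entry : ∀ b j → get (upd (view α) s u) (tup b j) ≡ α′ (slot (tup b j))
      entry b j with b Finₚ.≟ a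
      ... | no b≢a = trans (cong (λ v → lookup v j) (Vecₚ.lookup∘updateAt′ b a b≢a (tuple (view α))))
            (trans (get-view α (tup b j)) (sym (Funₚ.updateAt-minimal (slot (tup b j)) (slot s) α λ eq →
              b≢a (cong (λ { (tup b _) → b ; (el _) → b }) (slot-injective (tup b j) s eq)))))
      ... | yes refl with j Finₚ.≟ i
      ...   | yes refl = trans (cong (λ v → lookup v j) (Vecₚ.lookup∘updateAt b (tuple (view α))))
              (trans (Vecₚ.lookup∘update j (blk b (view α)) u) (sym (Funₚ.updateAt-updates (slot s) α)))
      ...   | no j≢i = trans (cong (λ v → lookup v j) (Vecₚ.lookup∘updateAt b (tuple (view α))))
              (trans (Vecₚ.lookup∘update′ j≢i (blk b (view α)) u)
                (trans (get-view α (tup b j)) (sym (Funₚ.updateAt-minimal (slot (tup b j)) (slot s) α λ eq →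
                  j≢i (cong (λ { (tup _ j) → j ; (el _) → j }) (slot-injective (tup b j) s eq))))))
    view-upd α s@(el t) u = fromFun-cong
      (Vecₚ.tabulate-cong λ b → Vecₚ.tabulate-cong λ j →
        Funₚ.updateAt-minimal (slot (tup b j)) (slot s) {const u} α λ eq → contradiction (slot-injective (tup b j) s eq) λ ())
      entry
      where
      singles-view : ∀ t′ → α (slot (el t′)) ≡ singles (view α) t′
      singles-view t′ = sym (get-view α (el t′))
      entry : ∀ t′ → Fun.updateAt α (slot s) (const u) (slot (el t′)) ≡ Fun.updateAt (singles (view α)) t (const u) t′
      entry t′ with t′ Finₚ.≟ t
      ... | yes refl = trans (Funₚ.updateAt-updates (slot s) α) (sym (Funₚ.updateAt-updates t (singles (view α))))
      ... | no t′≢t  = trans (Funₚ.updateAt-minimal (slot (el t′)) (slot s) α λ eq →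
              t′≢t (cong (λ { (tup _ _) → t′ ; (el t) → t }) (slot-injective (el t′) s eq)))
            (trans (singles-view t′) (sym (Funₚ.updateAt-minimal t′ t (singles (view α)) t′≢t)))

  Property : Set₁
  Property = (M : Model) → Env (Uni M) → Set

  -- Definability over the structures that encode a system, so that a property
  -- may refer to the encoded system.
  record Definable (Pr : Property) : Set₁ where
    field
      formula : Formula systemSignature width
      correct : ∀ M α → Sat (structure M) α formula ⇔ Pr M (view α)

  open Definable public

  infix 4 _⇔ₚ_
  _⇔ₚ_ : Property → Property → Set
  Pr ⇔ₚ Qr = ∀ M ρ → Pr M ρ ⇔ Qr M ρ

  private variable
    Pr Qr : Property
    I : Set

  definable-resp : Pr ⇔ₚ Qr → Definable Pr → Definable Qr
  definable-resp eq d .formula = formula d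
  definable-resp eq d .correct M α = mk⇔
    (λ sat → to (eq M (view α)) (to (correct d M α) sat))
    (λ q → from (correct d M α) (from (eq M (view α)) q))

  ¬-definable : Definable Pr → Definable (λ M ρ → ¬ Pr M ρ)
  ¬-definable d .formula = neg (formula d)
  ¬-definable d .correct M α = mk⇔ (_∘ from (correct d M α)) (_∘ to (correct d M α))

  ∀-definable : {Pr : I → Property} → (∀ i → Definable (Pr i)) → Definable (λ M ρ → ∀ i → Pr i M ρ)
  ∀-definable d .formula = ⋀ (formula ∘ d)
  ∀-definable d .correct M α = mk⇔ (λ sat i → to (correct (d i) M α) (sat i)) (λ p i → from (correct (d i) M α) (p i))

  ∃-definable : {Pr : I → Property} → (∀ i → Definable (Pr i)) → Definable (λ M ρ → ∃[ i ] Pr i M ρ)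
  ∃-definable d .formula = ⋁ (formula ∘ d)
  ∃-definable d .correct M α = mk⇔ (λ (i , sat) → i , to (correct (d i) M α) sat) (λ (i , p) → i , from (correct (d i) M α) p)

  ⊤-definable : Definable (λ _ _ → ⊤)
  ⊤-definable = definable-resp (λ M ρ → mk⇔ (λ _ → tt) λ _ ()) (∀-definable {I = ⊥} {Pr = λ ()} λ ())

  ×-definable : Definable Pr → Definable Qr → Definable (λ M ρ → Pr M ρ × Qr M ρ)
  ×-definable p q = definable-resp (λ M ρ → mk⇔ (λ f → f true , f false) λ { (p , q) true → p ; (p , q) false → q })
    (∀-definable {Pr = λ { true → _ ; false → _ }} λ { true → p ; false → q })

  ⊎-definable : Definable Pr → Definable Qr → Definable (λ M ρ → Pr M ρ ⊎ Qr M ρ)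
  ⊎-definable p q = definable-resp
    (λ M ρ → mk⇔ (λ { (true , p) → inj₁ p ; (false , q) → inj₂ q }) λ { (inj₁ p) → true , p ; (inj₂ q) → false , q })
    (∃-definable {Pr = λ { true → _ ; false → _ }} λ { true → p ; false → q })

  -- Formulas have no implication; replacing it by `¬ Pr ⊎ Qr` constructively takes a decision of
  -- `Pr`.
  →-definable : (∀ M ρ → Dec (Pr M ρ)) → Definable Pr → Definable Qr → Definable (λ M ρ → Pr M ρ → Qr M ρ)
  →-definable {Pr} {Qr} p? p q = definable-resp (λ M ρ → mk⇔
    (λ { (inj₁ ¬p) p → contradiction p ¬p ; (inj₂ q) _ → q }) (by-dec M ρ (p? M ρ))) (⊎-definable (¬-definable p) q)
    where
    by-dec : ∀ M ρ → Dec (Pr M ρ) → (Pr M ρ → Qr M ρ) → ¬ Pr M ρ ⊎ Qr M ρ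
    by-dec M ρ (yes p) f = inj₂ (f p)
    by-dec M ρ (no ¬p) f = inj₁ ¬p

  module _ (s : Slot) (d : Definable Pr) where

    private
      ⇔-upd : ∀ M α u → Sat (structure M) (Fun.updateAt α (slot s) (const u)) (formula d) ⇔ Pr M (upd (view α) s u)
      ⇔-upd M α u = subst (λ ρ → Sat (structure M) (Fun.updateAt α (slot s) (const u)) (formula d) ⇔ Pr M ρ)
        (view-upd α s u) (correct d M (Fun.updateAt α (slot s) (const u)))

    all-definable : Definable (λ M ρ → ∀ u → Pr M (upd ρ s u))
    all-definable .formula = all (slot s) (formula d)
    all-definable .correct M α = mk⇔ (λ sat u → to (⇔-upd M α u) (sat u)) (λ p u → from (⇔-upd M α u) (p u))

    ex-definable : Definable (λ M ρ → ∃[ u ] Pr M (upd ρ s u))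
    ex-definable .formula = ex (slot s) (formula d)
    ex-definable .correct M α = mk⇔ (λ (u , sat) → u , to (⇔-upd M α u) sat) (λ (u , p) → u , from (⇔-upd M α u) p)

    ex≥-definable : ∀ i → Definable (λ M ρ →
      Σ[ us ∈ (Fin i → Uni M) ] Injective _≡_ _≡_ us × (∀ j → Pr M (upd ρ s (us j))))
    ex≥-definable i .formula = ex≥ i (slot s) (formula d)
    ex≥-definable i .correct M α = mk⇔
      (λ (us , inj , sat) → us , inj , λ j → to (⇔-upd M α (us j)) (sat j))
      (λ (us , inj , p) → us , inj , λ j → from (⇔-upd M α (us j)) (p j))

  ≡-definable : ∀ s t → Definable (λ M ρ → get ρ s ≡ get ρ t)
  ≡-definable s t .formula = slot s ≐ slot t
  ≡-definable s t .correct M α = mk⇔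
    (λ eq → trans (get-view α s) (trans eq (sym (get-view α t))))
    (λ eq → trans (sym (get-view α s)) (trans eq (get-view α t)))

  HoldsAt : (R : SystemSymbol) → Vec Slot (arity systemSignature R) → Property
  HoldsAt R ss M ρ = Holds (system M) (Encodes.L (encoding M)) (Encodes.frac (encoding M)) R
    (Vec.map (Encodes.decode (encoding M)) (Vec.map (get ρ) ss))

  holds? : ∀ R ss M ρ → Dec (HoldsAt R ss M ρ)
  holds? R ss M ρ = Dec.map (Encodes.rel-correct (encoding M) R (Vec.map (get ρ) ss))
    (Boolₚ.T? (rel (structure M) R (Vec.map (get ρ) ss)))

  atom-definable : ∀ R ss → Definable (HoldsAt R ss)
  atom-definable R ss .formula = atom R (Vec.map slot ss)
  atom-definable R ss .correct M α = subst (λ us → Bool.T (rel (structure M) R us) ⇔ HoldsAt R ss M (view α))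
    (trans (Vecₚ.map-cong (get-view α) ss) (Vecₚ.map-∘ α slot ss))
    (Encodes.rel-correct (encoding M) R (Vec.map (get (view α)) ss))

  -- Definable rational functions

  Function : Set
  Function = (M : Model) → Env (Uni M) → ℚ

  -- Values in ℚ lie outside the universe, so there is one formula per value. Functions are then
  -- composed by disjunctions over the possible intermediate values.
  DefinableF : Function → Set₁
  DefinableF G = ∀ q → Definable (λ M ρ → G M ρ ≡ q)

  private variable
    G H : Function

  definableF-resp : (∀ M ρ → G M ρ ≡ H M ρ) → DefinableF G → DefinableF H
  definableF-resp eq d q = definable-resp (λ M ρ → mk⇔ (trans (sym (eq M ρ))) (trans (eq M ρ))) (d q)

  map₁-definable : ∀ (h : ℚ → ℚ) → DefinableF G → DefinableF (λ M ρ → h (G M ρ))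
  map₁-definable h d q = definable-resp
    (λ M ρ → mk⇔ (λ { ((p , hp≡q) , G≡p) → trans (cong h G≡p) hp≡q }) λ eq → (_ , eq) , refl)
    (∃-definable {I = ∃[ p ] h p ≡ q} λ (p , _) → d p)

  map₂-definable : ∀ (h : ℚ → ℚ → ℚ) → DefinableF G → DefinableF H → DefinableF (λ M ρ → h (G M ρ) (H M ρ))
  map₂-definable h d d′ q = definable-resp
    (λ M ρ → mk⇔ (λ { ((p , r , hpr≡q) , G≡p , H≡r) → trans (cong₂ h G≡p H≡r) hpr≡q }) λ eq → (_ , _ , eq) , refl , refl)
    (∃-definable {I = ∃[ p ] ∃[ r ] h p r ≡ q} λ (p , r , _) → ×-definable (d p) (d′ r))

  const-definable : ∀ c → DefinableF (λ _ _ → c)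
  const-definable c q = definable-resp (λ M ρ → mk⇔ proj₁ (λ eq → eq , tt)) (∃-definable {I = c ≡ q} λ _ → ⊤-definable)

  indicator-definable : (p? : ∀ M ρ → Dec (Pr M ρ)) → Definable Pr → DefinableF (λ M ρ → indicator (p? M ρ))
  indicator-definable {Pr} p? d q = definable-resp (λ M ρ → mk⇔
      (λ { (inj₁ (eq , p)) → trans (indicator-yes (p? M ρ) p) eq ; (inj₂ (eq , ¬p)) → trans (indicator-no (p? M ρ) ¬p) eq })
      (by-dec M ρ (p? M ρ)))
    (⊎-definable (∃-definable {I = 1ℚ ≡ q} λ _ → d) (∃-definable {I = 0ℚ ≡ q} λ _ → ¬-definable d))
    where
    by-dec : ∀ M ρ (d? : Dec (Pr M ρ)) → indicator d? ≡ q → (1ℚ ≡ q × Pr M ρ) ⊎ (0ℚ ≡ q × ¬ Pr M ρ)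
    by-dec M ρ (yes p) eq = inj₁ (eq , p)
    by-dec M ρ (no ¬p) eq = inj₂ (eq , ¬p)

  -- The encoding has elements for nonzero coefficients only, so the value 0 has to be defined by
  -- the absence of all others.
  from-nonzero : (∀ q → q ≢ 0ℚ → Definable (λ M ρ → G M ρ ≡ q)) → DefinableF G
  from-nonzero {G} d q with q ℚₚ.≟ 0ℚ
  ... | no q≢0   = d q q≢0
  ... | yes refl = definable-resp (λ M ρ → mk⇔ (zero⁻ M ρ (G M ρ ℚₚ.≟ 0ℚ)) λ { G≡0 ((p , p≢0) , G≡p) → p≢0 (trans (sym G≡p) G≡0) })
    (¬-definable (∃-definable {I = ∃[ p ] p ≢ 0ℚ} λ (p , p≢0) → d p p≢0))
    where
    zero⁻ : ∀ M ρ → Dec (G M ρ ≡ 0ℚ) → ¬ (∃[ p ] G M ρ ≡ proj₁ p) → G M ρ ≡ 0ℚ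
    zero⁻ M ρ (yes eq) _ = eq
    zero⁻ M ρ (no neq) none = contradiction ((G M ρ , neq) , refl) none

  -- A list g of values is compared with the values of G by size and by the
  -- multiplicity of every rational.
  sum-definable : ∀ s → DefinableF G → DefinableF (λ M ρ → sum (finite (size (structure M))) λ u → G M (upd ρ s u))
  sum-definable {G} s d q = definable-resp (λ M ρ → mk⇔ (sound M ρ) (complete′ M ρ))
    (∃-definable {I = ∃[ N ] Σ[ g ∈ (Fin N → ℚ) ] sum (finite N) g ≡ q} λ (N , g , _) →
      ×-definable
        -- The universe has at most `N` elements, and each value is taken at least as often as by
        -- `g`: the hypotheses of `counts-determine-∑`.
        (¬-definable (ex≥-definable s ⊤-definable (suc N)))
        (∀-definable {I = ℚ} λ p → ex≥-definable s (d p) (count g p (allFin N))))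
    where
    length-allFin : ∀ N → length (allFin N) ≡ N
    length-allFin N = length-tabulate {n = N} id
    Certified : Property
    Certified M ρ = Σ[ (N , g , _) ∈ (∃[ N ] Σ[ g ∈ (Fin N → ℚ) ] sum (finite N) g ≡ q) ]
      (¬ (Σ[ us ∈ (Fin (suc N) → Uni M) ] Injective _≡_ _≡_ us × (∀ (j : Fin (suc N)) → ⊤))) ×
      (∀ p → Σ[ us ∈ (Fin (count g p (allFin N)) → Uni M) ] Injective _≡_ _≡_ us × (∀ j → G M (upd ρ s (us j)) ≡ p))
    sound : ∀ M ρ → Certified M ρ → sum (finite (size (structure M))) (λ u → G M (upd ρ s u)) ≡ q
    sound M ρ ((N , g , g≡q) , small , counts) = trans
      (counts-determine-∑ (allFin (size (structure M))) (allFin N) (λ u → G M (upd ρ s u)) g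
        (subst₂ _≤_ (sym (length-allFin (size (structure M)))) (sym (length-allFin N)) (≤N (size (structure M) ℕₚ.≤? N)))
        (λ p → let us , inj , eq = counts p in injection⇒≤length us inj λ j →
          ∈-filter⁺ (λ u → G M (upd ρ s u) ℚₚ.≟ p) (∈-allFin (us j)) (eq j)))
      g≡q
      where
      ≤N : Dec (size (structure M) ≤ N) → size (structure M) ≤ N
      ≤N (yes le) = le
      ≤N (no ≰N)  = contradiction
        ((λ j → inject≤ j (ℕₚ.≰⇒> ≰N)) , (λ {i} {j} → Finₚ.inject≤-injective (ℕₚ.≰⇒> ≰N) (ℕₚ.≰⇒> ≰N) i j) , λ _ → tt) small
    complete′ : ∀ M ρ → sum (finite (size (structure M))) (λ u → G M (upd ρ s u)) ≡ q → Certified M ρ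
    complete′ M ρ eq = (size (structure M) , (λ u → G M (upd ρ s u)) , eq) ,
      (λ (us , inj , _) → ℕₚ.<-irrefl refl (Finₚ.injective⇒≤ inj)) ,
      λ p → let xs = filter (λ u → G M (upd ρ s u) ℚₚ.≟ p) (allFin (size (structure M))) in
        List.lookup xs ,
        lookup-injective (Unique.filter⁺ (λ u → G M (upd ρ s u) ℚₚ.≟ p) (Unique.allFin⁺ (size (structure M)))) ,
        λ j → proj₂ (∈-filter⁻ (λ u → G M (upd ρ s u) ℚₚ.≟ p) {xs = allFin (size (structure M))} (∈ₗ-lookup j))

  -- Summation over a block of k variables

  module _ {U : Set} where

    overwrite : ∀ {l} → Vec U k → Vec (Fin k) l → Vec U l → Vec U k
    overwrite r []       []       = r
    overwrite r (p ∷ ps) (u ∷ us) = overwrite (r [ p ]≔ u) ps us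

    overwrite-minimal : ∀ {l} r (f : Fin l → Fin k) us p → (∀ i → p ≢ f i) →
      lookup (overwrite r (tabulate f) us) p ≡ lookup r p
    overwrite-minimal r f []       p p≢ = refl
    overwrite-minimal r f (u ∷ us) p p≢ = trans (overwrite-minimal (r [ f zero ]≔ u) (f ∘ suc) us p (p≢ ∘ suc))
      (Vecₚ.lookup∘update′ (p≢ zero) r u)

    overwrite-updates : ∀ {l} r (f : Fin l → Fin k) → Injective _≡_ _≡_ f → ∀ us i →
      lookup (overwrite r (tabulate f) us) (f i) ≡ lookup us i
    overwrite-updates r f inj (u ∷ us) zero = trans
      (overwrite-minimal (r [ f zero ]≔ u) (f ∘ suc) us (f zero) (λ i eq → contradiction (inj eq) λ ()))
      (Vecₚ.lookup∘update (f zero) r u)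
    overwrite-updates r f inj (u ∷ us) (suc i) =
      overwrite-updates (r [ f zero ]≔ u) (f ∘ suc) (Finₚ.suc-injective ∘ inj) us i

    overwrite-all : ∀ r us → overwrite r (Vec.allFin k) us ≡ us
    overwrite-all r us = lookup-ext (overwrite r (Vec.allFin k) us) us (overwrite-updates r id id us)

  -- Generalises a block sum to the list of positions still to be summed, so that one variable is
  -- treated at a time. Once all positions are listed, the former content of the block is gone.
  sums-definable : ∀ {l} a (ps : Vec (Fin k) l) → DefinableF G → DefinableF (λ M ρ →
    sum (vectors (finite (size (structure M))) l) λ us → G M (updBlk ρ a λ r → overwrite r ps us))
  sums-definable {G} a [] d = definableF-resp (λ M ρ → trans
      (cong (λ t → G M (record ρ { tuple = t })) (sym (Vecₚ.updateAt-id a (tuple ρ))))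
      (sym (ℚₚ.+-identityʳ (G M (updBlk ρ a id))))) d
  sums-definable {G} {suc l} a (p ∷ ps) d = definableF-resp (λ M ρ → sym (trans
      (∑-cartesianProductWith _∷_ (allFin (size (structure M))) (elements (vectors (finite (size (structure M))) l))
        (λ us → G M (updBlk ρ a λ r → overwrite r (p ∷ ps) us)))
      (∑-cong (allFin (size (structure M))) λ u → ∑-cong (elements (vectors (finite (size (structure M))) l)) λ us →
        cong (λ t → G M (record ρ { tuple = t })) (sym (Vecₚ.updateAt-updateAt a (tuple ρ))))))
    (sum-definable (tup a p) (sums-definable a ps d))

  block-sum-definable : ∀ a → DefinableF G → DefinableF (λ M ρ →
    sum (vectors (finite (size (structure M))) k) λ us → G M (setBlk ρ a us))
  block-sum-definable {G} a d = definableF-resp (λ M ρ →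
      ∑-cong (elements (vectors (finite (size (structure M))) k)) λ us →
        cong (λ t → G M (record ρ { tuple = t })) (Vecₚ.updateAt-cong a (λ r → overwrite-all r us) (tuple ρ)))
    (sums-definable a (Vec.allFin k) d)

-- Binary expansions

bits-injective : ∀ a b → (∀ i → Bit i a ⇔ Bit i b) → a ≡ b
bits-injective = <-rec (λ a → ∀ b → (∀ i → Bit i a ⇔ Bit i b) → a ≡ b) by-halves
  where
  bit₀ : ∀ a → Bit 0 a ⇔ (a % 2 ≡ 1)
  bit₀ a = subst (λ z → (z % 2 ≡ 1) ⇔ (a % 2 ≡ 1)) (sym (n/1≡n a)) (mk⇔ id id)
  bit-suc : ∀ i a → Bit (suc i) a ⇔ Bit i (a / 2)
  bit-suc i a = subst (λ z → (z % 2 ≡ 1) ⇔ Bit i (a / 2)) (m/n/o≡m/[n*o] a 2 (2 ^ i) {{_}} {{ℕₚ.m^n≢0 2 i}} {{ℕₚ.m^n≢0 2 (suc i)}}) (mk⇔ id id)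
  parity : ∀ p q → p < 2 → q < 2 → (p ≡ 1 ⇔ q ≡ 1) → p ≡ q
  parity 0 0 _ _ _ = refl
  parity 0 1 _ _ e = contradiction (from e refl) λ ()
  parity 1 0 _ _ e = contradiction (to e refl) λ ()
  parity 1 1 _ _ _ = refl
  parity (suc (suc _)) _ (s≤s (s≤s ())) _ _
  parity 0 (suc (suc _)) _ (s≤s (s≤s ())) _
  parity 1 (suc (suc _)) _ (s≤s (s≤s ())) _
  compose : ∀ {A B C D : Set} → A ⇔ B → C ⇔ D → A ⇔ C → B ⇔ D
  compose ab cd ac = mk⇔ (to cd ∘ to ac ∘ from ab) (to ab ∘ from ac ∘ from cd)
  bits : ∀ a b → (∀ i → Bit i a ⇔ Bit i b) → a % 2 ≡ b % 2
  bits a b eq = parity (a % 2) (b % 2) (m%n<n a 2) (m%n<n b 2) (compose (bit₀ a) (bit₀ b) (eq 0))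
  halves : ∀ a b → (∀ i → Bit i a ⇔ Bit i b) → ∀ i → Bit i (a / 2) ⇔ Bit i (b / 2)
  halves a b eq i = compose (bit-suc i a) (bit-suc i b) (eq (suc i))
  reassemble : ∀ a b → a % 2 ≡ b % 2 → a / 2 ≡ b / 2 → a ≡ b
  reassemble a b p q = trans (m≡m%n+[m/n]*n a 2) (trans (cong₂ (λ r h → r ℕ.+ h ℕ.* 2) p q) (sym (m≡m%n+[m/n]*n b 2)))
  -- Halving does not decrease 0, so for `a = 0` the induction has to run over `b`.
  no-bits : ∀ b → (∀ i → Bit i 0 ⇔ Bit i b) → 0 ≡ b
  no-bits = <-rec (λ b → (∀ i → Bit i 0 ⇔ Bit i b) → 0 ≡ b) λ
    { zero    rec eq → refl
    ; b@(suc _) rec eq → reassemble 0 b (bits 0 b eq) (rec (m/n<m b 2 (s≤s (s≤s z≤n))) (halves 0 b eq)) }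
  by-halves : ∀ a → (∀ {a′} → a′ < a → ∀ b → (∀ i → Bit i a′ ⇔ Bit i b) → a′ ≡ b) →
    ∀ b → (∀ i → Bit i a ⇔ Bit i b) → a ≡ b
  by-halves zero      rec b eq = no-bits b eq
  by-halves a@(suc _) rec b eq = reassemble a b (bits a b eq)
    (rec (m/n<m a 2 (s≤s (s≤s z≤n))) (b / 2) (halves a b eq))

bit⇒< : ∀ {i a L} → a < 2 ^ L → Bit i a → i < L
bit⇒< {i} {a} {L} a< bit with i ℕₚ.<? L
... | yes i<L = i<L
... | no  i≮L = contradiction (trans (sym (cong (_% 2) (m<n⇒m/n≡0 {a} {2 ^ i} {{ℕₚ.m^n≢0 2 i}}
    (ℕₚ.<-≤-trans a< (ℕₚ.^-monoʳ-≤ 2 (ℕₚ.≮⇒≥ i≮L)))))) bit) λ ()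

sign-magnitude : ∀ i j → (i ℤ.< 0ℤ ⇔ j ℤ.< 0ℤ) → ℤ.∣ i ∣ ≡ ℤ.∣ j ∣ → i ≡ j
sign-magnitude (ℤ.+ m)    (ℤ.+ n)    e eq = cong ℤ.+_ eq
sign-magnitude (ℤ.+ m)    -[1+ n ] e eq = contradiction (from e ℤ.-<+) λ { (ℤ.+<+ ()) }
sign-magnitude -[1+ m ] (ℤ.+ n)    e eq = contradiction (to e ℤ.-<+) λ { (ℤ.+<+ ()) }
sign-magnitude -[1+ m ] -[1+ n ] e eq = cong -[1+_] (ℕₚ.suc-injective eq)

-- Formulas for monomials, coefficients, matrix entries and the acceptance test

module Atoms (k : ℕ) where

  open Definability k
  open module Sems (M : Model) = Matrices k (encoding M) using
    (named; ∈-named⁺; ∈-named⁻; varU; decode-varU; varU-injective; adjoins?; exceeds?; multiplicity; times; mask; restrict;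
     gate; shift; axiomEntry; axioms; unit; residue; test; universe; tuples; ⟦_⟧)
  open module Encs (M : Model) = Encodes (encoding M) using
    (L; frac; decode; decode-covers; decode-occurs; decode-injective; frac-value; num-fits; den-fits)

  private variable
    Pr : Property

  x m c y b b′ : Slot
  x  = el 0F
  m  = el 1F
  c  = el 2F
  y  = el 3F
  b  = el 4F
  b′ = el 5F

  El : Model → Set
  El M = Element (system M) (L M)

  Mon : Model → Set
  Mon M = Monomial (#vars (system M))

  H : (M : Model) (R : SystemSymbol) → Vec (El M) (arity systemSignature R) → Set
  H M = Holds (system M) (L M) (frac M)

  ∈-definable : ∀ s a → Definable (λ M ρ → get ρ s ∈ blk a ρ)
  ∈-definable s a = definable-resp (λ M ρ → mk⇔
      (λ (i , eq) → subst (_∈ blk a ρ) (sym eq) (∈-lookup i (blk a ρ)))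
      (λ u∈ → VecAny.index u∈ , lookup-index u∈))
    (∃-definable λ i → ≡-definable s (tup a i))

  ∈? : ∀ s a M ρ → Dec (get ρ s ∈ blk a ρ)
  ∈? s a M ρ = get ρ s ∈v? blk a ρ
    where open import Data.Vec.Membership.DecPropositional (Finₚ._≟_ {size (structure M)}) renaming (_∈?_ to _∈v?_)

  holds-isVar : ∀ M el → H M isVar (el ∷ []) ⇔ (∃[ v ] el ≡ varE v)
  holds-isVar M (varE v)  = mk⇔ (λ _ → v , refl) (λ _ → tt)
  holds-isVar M (polyE _) = mk⇔ (λ ()) λ ()
  holds-isVar M (monE _)  = mk⇔ (λ ()) λ ()
  holds-isVar M (coefE _) = mk⇔ (λ ()) λ ()
  holds-isVar M (posE _)  = mk⇔ (λ ()) λ ()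

  isVar-varU : ∀ M v → H M isVar (decode M (varU M v) ∷ [])
  isVar-varU M v = from (holds-isVar M _) (v , decode-varU M v)

  isVar⇒varU : ∀ M u → H M isVar (decode M u ∷ []) → ∃[ v ] u ≡ varU M v
  isVar⇒varU M u h = let v , eq = to (holds-isVar M _) h in v , decode-injective M (trans eq (sym (decode-varU M v)))

  -- A set of variables that is given by a definable property of the element y.
  record VariableSet : Set₁ where
    field
      set      : (M : Model) → Env (Uni M) → Mon M
      member   : Property
      member?  : ∀ M ρ → Dec (member M ρ)
      definable : Definable member
      ∈-set    : ∀ M ρ v → v ∈ₛ set M ρ ⇔ member M (upd ρ y (varU M v))

  open VariableSet

  equals-definable : ∀ (V : VariableSet) a → Definable (λ M ρ → set V M ρ ≡ named M (blk a ρ))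
  equals-definable V a = definable-resp (λ M ρ → mk⇔ (sound M ρ) (complete′ M ρ))
    (all-definable y (→-definable (holds? isVar (y ∷ [])) (atom-definable isVar (y ∷ []))
      (×-definable (→-definable (member? V) (definable V) (∈-definable y a))
                   (→-definable (∈? y a) (∈-definable y a) (definable V)))))
    where
    Agrees : Property
    Agrees M ρ = ∀ u → H M isVar (decode M u ∷ []) →
      (member V M (upd ρ y u) → u ∈ blk a ρ) × (u ∈ blk a ρ → member V M (upd ρ y u))
    sound : ∀ M ρ → Agrees M ρ → set V M ρ ≡ named M (blk a ρ)
    sound M ρ agrees = ⊆-antisym
      (λ {v} v∈ → ∈-named⁺ M (blk a ρ) (proj₁ (agrees (varU M v) (isVar-varU M v)) (to (∈-set V M ρ v) v∈)))
      (λ {v} v∈ → from (∈-set V M ρ v) (proj₂ (agrees (varU M v) (isVar-varU M v)) (∈-named⁻ M (blk a ρ) v∈)))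
    complete′ : ∀ M ρ → set V M ρ ≡ named M (blk a ρ) → Agrees M ρ
    complete′ M ρ eq u isvar with v , refl ← isVar⇒varU M u isvar =
      (λ mem → ∈-named⁻ M (blk a ρ) (subst (v ∈ₛ_) eq (from (∈-set V M ρ v) mem))) ,
      (λ u∈ → to (∈-set V M ρ v) (subst (v ∈ₛ_) (sym eq) (∈-named⁺ M (blk a ρ) u∈)))

  card-definable : ∀ (V : VariableSet) i → Definable (λ M ρ → i ≤ ∣ set V M ρ ∣)
  card-definable V i = definable-resp (λ M ρ → mk⇔ (sound M ρ) (complete′ M ρ))
    (ex≥-definable y (×-definable (atom-definable isVar (y ∷ [])) (definable V)) i)
    where
    Many : Property
    Many M ρ = Σ[ us ∈ (Fin i → Uni M) ] Injective _≡_ _≡_ us ×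
      (∀ j → H M isVar (decode M (us j) ∷ []) × member V M (upd ρ y (us j)))
    sound : ∀ M ρ → Many M ρ → i ≤ ∣ set V M ρ ∣
    sound M ρ (us , inj , mem) = injection⇒≤∣∣ (set V M ρ) vs
      (λ {j} {j′} eq → inj (trans (us≡ j) (trans (cong (varU M) eq) (sym (us≡ j′)))))
      λ j → from (∈-set V M ρ (vs j)) (subst (λ u → member V M (upd ρ y u)) (us≡ j) (proj₂ (mem j)))
      where
      vs : Fin i → Fin (#vars (system M))
      vs j = proj₁ (isVar⇒varU M (us j) (proj₁ (mem j)))
      us≡ : ∀ j → us j ≡ varU M (vs j)
      us≡ j = proj₂ (isVar⇒varU M (us j) (proj₁ (mem j)))
    complete′ : ∀ M ρ → i ≤ ∣ set V M ρ ∣ → Many M ρ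
    complete′ M ρ i≤ = let vs , inj , vs∈ = ≤∣∣⇒injection (set V M ρ) i≤ in
      varU M ∘ vs , inj ∘ varU-injective M , λ j → isVar-varU M (vs j) , to (∈-set V M ρ (vs j)) (vs∈ j)

  tupleSet : Fin 3 → VariableSet
  tupleSet a .set M ρ = named M (blk a ρ)
  tupleSet a .member M ρ = get ρ y ∈ blk a ρ
  tupleSet a .member? = ∈? y a
  tupleSet a .definable = ∈-definable y a
  tupleSet a .∈-set M ρ v = mk⇔ (∈-named⁻ M (blk a ρ)) (∈-named⁺ M (blk a ρ))

  emptySet : VariableSet
  emptySet .set M ρ = ∅
  emptySet .member M ρ = ⊥
  emptySet .member? M ρ = no id
  emptySet .definable = definable-resp (λ M ρ → mk⇔ (λ f → f tt) λ ()) (¬-definable ⊤-definable)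
  emptySet .∈-set M ρ v = mk⇔ ∉⊥ ⊥-elim

  -- Total in the element, since a `VariableSet` must be given in every environment; the formulas
  -- built on it also demand `isVar`.
  adjoin : ∀ {M} → El M → Mon M → Mon M
  adjoin (varE v) s = s ∪ ⁅ v ⁆
  adjoin _        s = s

  ∈-adjoin : ∀ M u v s → v ∈ₛ adjoin {M} (decode M u) s ⇔ (v ∈ₛ s ⊎ varU M v ≡ u)
  ∈-adjoin M u v s = by-element (decode M u) refl
    where
    other : ∀ {el} → decode M u ≡ el → el ≢ varE v → v ∈ₛ s ⇔ (v ∈ₛ s ⊎ varU M v ≡ u)
    other eq ≢v = mk⇔ inj₁ λ { (inj₁ v∈) → v∈ ; (inj₂ refl) → contradiction (trans (sym eq) (decode-varU M v)) ≢v }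
    by-element : ∀ el → decode M u ≡ el → v ∈ₛ adjoin {M} el s ⇔ (v ∈ₛ s ⊎ varU M v ≡ u)
    by-element (varE w) eq = mk⇔ forth back
      where
      forth : v ∈ₛ s ∪ ⁅ w ⁆ → v ∈ₛ s ⊎ varU M v ≡ u
      forth v∈ with x∈p∪q⁻ s ⁅ w ⁆ v∈
      ... | inj₁ v∈s = inj₁ v∈s
      ... | inj₂ v∈w with refl ← x∈⁅y⁆⇒x≡y w v∈w = inj₂ (decode-injective M (trans (decode-varU M v) (sym eq)))
      back : v ∈ₛ s ⊎ varU M v ≡ u → v ∈ₛ s ∪ ⁅ w ⁆
      back (inj₁ v∈s) = x∈p∪q⁺ (inj₁ v∈s)
      back (inj₂ refl) with refl ← trans (sym eq) (decode-varU M v) = x∈p∪q⁺ {p = s} (inj₂ (x∈⁅x⁆ v))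
    by-element (polyE _) eq = other eq λ ()
    by-element (monE _)  eq = other eq λ ()
    by-element (coefE _) eq = other eq λ ()
    by-element (posE _)  eq = other eq λ ()

  adjoinSet : Fin 3 → VariableSet
  adjoinSet a .set M ρ = adjoin {M} (decode M (get ρ x)) (named M (blk a ρ))
  adjoinSet a .member M ρ = get ρ y ∈ blk a ρ ⊎ get ρ y ≡ get ρ x
  adjoinSet a .member? M ρ = ∈? y a M ρ ⊎-dec (get ρ y Finₚ.≟ get ρ x)
  adjoinSet a .definable = ⊎-definable (∈-definable y a) (≡-definable y x)
  adjoinSet a .∈-set M ρ v = mk⇔
    (λ v∈ → case₁ (to (∈-adjoin M (get ρ x) v (named M (blk a ρ))) v∈))
    (λ mem → from (∈-adjoin M (get ρ x) v (named M (blk a ρ))) (case₂ mem))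
    where
    case₁ : v ∈ₛ named M (blk a ρ) ⊎ varU M v ≡ get ρ x → varU M v ∈ blk a ρ ⊎ varU M v ≡ get ρ x
    case₁ (inj₁ v∈) = inj₁ (∈-named⁻ M (blk a ρ) v∈)
    case₁ (inj₂ eq) = inj₂ eq
    case₂ : varU M v ∈ blk a ρ ⊎ varU M v ≡ get ρ x → v ∈ₛ named M (blk a ρ) ⊎ varU M v ≡ get ρ x
    case₂ (inj₁ v∈) = inj₁ (∈-named⁺ M (blk a ρ) v∈)
    case₂ (inj₂ eq) = inj₂ eq

  support : ∀ {M} → El M → Mon M
  support (monE s) = s
  support _        = ∅

  monomialSet : VariableSet
  monomialSet .set M ρ = support {M} (decode M (get ρ m))
  monomialSet .member = HoldsAt occursIn (y ∷ m ∷ [])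
  monomialSet .member? = holds? occursIn (y ∷ m ∷ [])
  monomialSet .definable = atom-definable occursIn (y ∷ m ∷ [])
  monomialSet .∈-set M ρ v = by-element (decode M (varU M v)) (decode M (get ρ m)) (decode-varU M v)
    where
    by-element : ∀ el el′ → el ≡ varE v → v ∈ₛ support {M} el′ ⇔ H M occursIn (el ∷ el′ ∷ [])
    by-element _ (monE s)  refl = mk⇔ id id
    by-element _ (polyE _) refl = mk⇔ ∉⊥ λ ()
    by-element _ (varE _)  refl = mk⇔ ∉⊥ λ ()
    by-element _ (coefE _) refl = mk⇔ ∉⊥ λ ()
    by-element _ (posE _)  refl = mk⇔ ∉⊥ λ ()

  -- Coefficients

  holds-isPos : ∀ M el → H M isPos (el ∷ []) ⇔ (∃[ p ] el ≡ posE p)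
  holds-isPos M (posE p)  = mk⇔ (λ _ → p , refl) (λ _ → tt)
  holds-isPos M (polyE _) = mk⇔ (λ ()) λ ()
  holds-isPos M (monE _)  = mk⇔ (λ ()) λ ()
  holds-isPos M (coefE _) = mk⇔ (λ ()) λ ()
  holds-isPos M (varE _)  = mk⇔ (λ ()) λ ()

  holds-isCoef : ∀ M el → H M isCoef (el ∷ []) ⇔ (∃[ q ] el ≡ coefE q)
  holds-isCoef M (coefE q) = mk⇔ (λ _ → q , refl) (λ _ → tt)
  holds-isCoef M (polyE _) = mk⇔ (λ ()) λ ()
  holds-isCoef M (monE _)  = mk⇔ (λ ()) λ ()
  holds-isCoef M (posE _)  = mk⇔ (λ ()) λ ()
  holds-isCoef M (varE _)  = mk⇔ (λ ()) λ ()

  IsPosition : ℕ → Property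
  IsPosition i M ρ = ∃[ p ] decode M (get ρ b) ≡ posE p × toℕ p ≡ i

  -- Position `i` is the one with exactly `i + 1` positions below or equal to it: at least `suc i`,
  -- but not `suc (suc i)`.
  position-definable : ∀ i → Definable (IsPosition i)
  position-definable i = definable-resp (λ M ρ → mk⇔ (sound M ρ) (complete′ M ρ))
    (×-definable (atom-definable isPos (b ∷ []))
      (×-definable (below (suc i)) (¬-definable (below (suc (suc i))))))
    where
    Below : ℕ → Property
    Below n M ρ = Σ[ us ∈ (Fin n → Uni M) ] Injective _≡_ _≡_ us × (∀ j → H M leq (decode M (us j) ∷ decode M (get ρ b) ∷ []))
    below : ∀ n → Definable (Below n)
    below = ex≥-definable b′ (atom-definable leq (b′ ∷ b ∷ []))
    leq⁻ : ∀ M el {p} → H M leq (el ∷ posE p ∷ []) → ∃[ p′ ] el ≡ posE p′ × toℕ p′ ≤ toℕ p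
    leq⁻ M (posE p′) le = p′ , refl , le
    below⁻ : ∀ n M ρ {p} → decode M (get ρ b) ≡ posE p → Below n M ρ → n ≤ suc (toℕ p)
    below⁻ n M ρ {p} b≡p (us , inj , leqs) = Finₚ.injective⇒≤ {f = λ j → fromℕ< (s≤s (proj₂ (proj₂ (pos j))))}
      λ {j} {j′} eq → inj (decode-injective M (trans (proj₁ (proj₂ (pos j))) (trans
        (cong posE (Finₚ.toℕ-injective (trans (sym (Finₚ.toℕ-fromℕ< _)) (trans (cong toℕ eq) (Finₚ.toℕ-fromℕ< _)))))
        (sym (proj₁ (proj₂ (pos j′)))))))
      where
      pos : ∀ j → ∃[ p′ ] decode M (us j) ≡ posE p′ × toℕ p′ ≤ toℕ p
      pos j = leq⁻ M (decode M (us j)) (subst (λ el → H M leq (decode M (us j) ∷ el ∷ [])) b≡p (leqs j))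
    below⁺ : ∀ n M ρ {p} → decode M (get ρ b) ≡ posE p → n ≤ suc (toℕ p) → Below n M ρ
    below⁺ n M ρ {p} b≡p n≤ = (λ j → proj₁ (covers j)) ,
      (λ {j} {j′} eq → Finₚ.toℕ-injective (trans (sym (Finₚ.toℕ-fromℕ< (<L j))) (trans
        (posE-injective (trans (sym (proj₂ (covers j))) (trans (cong (decode M) eq) (proj₂ (covers j′)))))
        (Finₚ.toℕ-fromℕ< (<L j′))))) ,
      λ j → subst (λ el → H M leq (decode M (proj₁ (covers j)) ∷ el ∷ [])) (sym b≡p)
        (subst (λ el → H M leq (el ∷ posE p ∷ [])) (sym (proj₂ (covers j)))
          (subst (_≤ toℕ p) (sym (Finₚ.toℕ-fromℕ< (<L j))) (ℕₚ.≤-pred (ℕₚ.<-≤-trans (Finₚ.toℕ<n j) n≤))))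
      where
      <L : ∀ (j : Fin n) → toℕ j < L M
      <L j = ℕₚ.<-≤-trans (Finₚ.toℕ<n j) (ℕₚ.≤-trans n≤ (Finₚ.toℕ<n p))
      covers : ∀ j → ∃[ u ] decode M u ≡ posE (fromℕ< (<L j))
      covers j = decode-covers M (posE (fromℕ< (<L j))) tt
      posE-injective : ∀ {p p′} → _≡_ {A = El M} (posE p) (posE p′) → toℕ p ≡ toℕ p′
      posE-injective refl = refl
    sound : ∀ M ρ → H M isPos (decode M (get ρ b) ∷ []) × Below (suc i) M ρ × ¬ Below (suc (suc i)) M ρ → IsPosition i M ρ
    sound M ρ (ispos , enough , few) = p , b≡p , ℕₚ.≤-antisym
      (ℕₚ.≮⇒≥ λ i<p → few (below⁺ (suc (suc i)) M ρ b≡p (s≤s i<p)))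
      (ℕₚ.≤-pred (below⁻ (suc i) M ρ b≡p enough))
      where
      p = proj₁ (to (holds-isPos M (decode M (get ρ b))) ispos)
      b≡p = proj₂ (to (holds-isPos M (decode M (get ρ b))) ispos)
    complete′ : ∀ M ρ → IsPosition i M ρ → H M isPos (decode M (get ρ b) ∷ []) × Below (suc i) M ρ × ¬ Below (suc (suc i)) M ρ
    complete′ M ρ (p , b≡p , refl) = from (holds-isPos M (decode M (get ρ b))) (p , b≡p) ,
      below⁺ (suc i) M ρ b≡p ℕₚ.≤-refl ,
      λ many → ℕₚ.<-irrefl refl (below⁻ (suc (suc i)) M ρ b≡p many)

  -- `B` is a fact outside the structure, such as a bit of a fixed number. It enters as the index
  -- set of a conjunction, which is empty if `B` fails.
  agrees-definable : ∀ {B : Set} → Dec B → Definable Pr → Definable (λ M ρ → Pr M ρ ⇔ B)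
  agrees-definable {Pr} {B} B? d = definable-resp (λ M ρ → mk⇔ (forth M ρ B?) λ e → from e , λ ¬B → ¬B ∘ to e)
    (×-definable (∀-definable {I = B} λ _ → d) (∀-definable {I = ¬ B} λ _ → ¬-definable d))
    where
    forth : ∀ M ρ → Dec B → (B → Pr M ρ) × (¬ B → ¬ Pr M ρ) → Pr M ρ ⇔ B
    forth M ρ (yes B) (f , _) = mk⇔ (λ _ → B) f
    forth M ρ (no ¬B) (_ , g) = mk⇔ (λ p → contradiction p (g ¬B)) (λ B → contradiction B ¬B)

  HasValue : ℚ → Property
  HasValue q M ρ = decode M (get ρ c) ≡ coefE q

  -- An encoding may store any fraction equal to `q`, so the disjunction ranges over all of them.
  -- Sign and bits then identify the stored fraction. Bits beyond the available positions agree as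
  -- well, because numerator and denominator are less than `2 ^ L`.
  value-definable : ∀ q → Definable (HasValue q)
  value-definable q = definable-resp (λ M ρ → mk⇔ (sound M ρ) (complete′ M ρ))
    (×-definable (atom-definable isCoef (c ∷ [])) (∃-definable {I = ∃[ r ] r ℚᵘ.≃ toℚᵘ q} λ (r , _) →
      ×-definable (agrees-definable (↥ r ℤₚ.<? 0ℤ) (atom-definable negative (c ∷ [])))
      (×-definable
        (∀-definable λ i → agrees-definable (_ ℕₚ.≟ 1)
          (ex-definable b (×-definable (position-definable i) (atom-definable numBit (c ∷ b ∷ [])))))
        (∀-definable λ i → agrees-definable (_ ℕₚ.≟ 1)
          (ex-definable b (×-definable (position-definable i) (atom-definable denBit (c ∷ b ∷ []))))))))
    where
    NumBit DenBit : ℕ → Property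
    NumBit i M ρ = ∃[ u ] IsPosition i M (upd ρ b u) × H M numBit (decode M (get ρ c) ∷ decode M u ∷ [])
    DenBit i M ρ = ∃[ u ] IsPosition i M (upd ρ b u) × H M denBit (decode M (get ρ c) ∷ decode M u ∷ [])
    Matches : Property
    Matches M ρ = H M isCoef (decode M (get ρ c) ∷ []) × Σ[ (r , _) ∈ (∃[ r ] r ℚᵘ.≃ toℚᵘ q) ]
      (H M negative (decode M (get ρ c) ∷ []) ⇔ (↥ r ℤ.< 0ℤ)) ×
      (∀ i → NumBit i M ρ ⇔ Bit i ℤ.∣ ↥ r ∣) × (∀ i → DenBit i M ρ ⇔ Bit i (↧ₙ r))
    module _ (M : Model) (ρ : Env (Uni M)) {q′ : ℚ} (c≡q′ : decode M (get ρ c) ≡ coefE q′) where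
      occurs : Occurs (system M) (L M) (coefE q′)
      occurs = subst (Occurs (system M) (L M)) c≡q′ (decode-occurs M (get ρ c))
      position : ∀ {i} → i < L M → ∃[ u ] IsPosition i M (upd ρ b u)
      position i<L = let u , eq = decode-covers M (posE (fromℕ< i<L)) tt in u , fromℕ< i<L , eq , Finₚ.toℕ-fromℕ< i<L
      sign⇔ : H M negative (decode M (get ρ c) ∷ []) ⇔ (↥ frac M q′ ℤ.< 0ℤ)
      sign⇔ = subst (λ el → H M negative (el ∷ []) ⇔ (↥ frac M q′ ℤ.< 0ℤ)) (sym c≡q′) (mk⇔ id id)
      num⇔ : ∀ i → NumBit i M ρ ⇔ Bit i ℤ.∣ ↥ frac M q′ ∣
      num⇔ i = mk⇔ forth back
        where
        forth : NumBit i M ρ → Bit i ℤ.∣ ↥ frac M q′ ∣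
        forth (u , (p , u≡p , refl) , h) = subst (λ el → H M numBit (el ∷ posE p ∷ [])) c≡q′
          (subst (λ el → H M numBit (decode M (get ρ c) ∷ el ∷ [])) u≡p h)
        back : Bit i ℤ.∣ ↥ frac M q′ ∣ → NumBit i M ρ
        back bit with position {i} (bit⇒< {i} (num-fits M q′ occurs) bit)
        ... | u , p , u≡p , refl = u , (p , u≡p , refl) ,
          subst (λ el → H M numBit (decode M (get ρ c) ∷ el ∷ [])) (sym u≡p)
            (subst (λ el → H M numBit (el ∷ posE p ∷ [])) (sym c≡q′) bit)
      den⇔ : ∀ i → DenBit i M ρ ⇔ Bit i (↧ₙ frac M q′)
      den⇔ i = mk⇔ forth back
        where
        forth : DenBit i M ρ → Bit i (↧ₙ frac M q′)
        forth (u , (p , u≡p , refl) , h) = subst (λ el → H M denBit (el ∷ posE p ∷ [])) c≡q′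
          (subst (λ el → H M denBit (decode M (get ρ c) ∷ el ∷ [])) u≡p h)
        back : Bit i (↧ₙ frac M q′) → DenBit i M ρ
        back bit with position {i} (bit⇒< {i} (den-fits M q′ occurs) bit)
        ... | u , p , u≡p , refl = u , (p , u≡p , refl) ,
          subst (λ el → H M denBit (decode M (get ρ c) ∷ el ∷ [])) (sym u≡p)
            (subst (λ el → H M denBit (el ∷ posE p ∷ [])) (sym c≡q′) bit)
    ⇔-via : ∀ {A B C : Set} → A ⇔ B → A ⇔ C → B ⇔ C
    ⇔-via ab ac = mk⇔ (to ac ∘ from ab) (to ab ∘ from ac)
    same-fraction : ∀ (r s : ℚᵘ) → (↥ r ℤ.< 0ℤ ⇔ ↥ s ℤ.< 0ℤ) → (∀ i → Bit i ℤ.∣ ↥ r ∣ ⇔ Bit i ℤ.∣ ↥ s ∣) →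
      (∀ i → Bit i (↧ₙ r) ⇔ Bit i (↧ₙ s)) → r ≡ s
    same-fraction (mkℚᵘ n d) (mkℚᵘ n′ d′) sgn num den = cong₂ mkℚᵘ
      (sign-magnitude n n′ sgn (bits-injective ℤ.∣ n ∣ ℤ.∣ n′ ∣ num))
      (ℕₚ.suc-injective (bits-injective (suc d) (suc d′) den))
    sound : ∀ M ρ → Matches M ρ → HasValue q M ρ
    sound M ρ (iscoef , (r , r≃q) , sgn , num , den) with q′ , c≡q′ ← to (holds-isCoef M (decode M (get ρ c))) iscoef =
      trans c≡q′ (cong coefE (ℚₚ.toℚᵘ-injective (ℚᵘₚ.≃-trans (ℚᵘₚ.≃-sym (frac-value M q′ (occurs M ρ c≡q′)))
        (subst (ℚᵘ._≃ toℚᵘ q) (sym (same-fraction (frac M q′) r (⇔-via (sign⇔ M ρ c≡q′) sgn)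
          (λ i → ⇔-via (num⇔ M ρ c≡q′ i) (num i)) (λ i → ⇔-via (den⇔ M ρ c≡q′ i) (den i)))) r≃q))))
    complete′ : ∀ M ρ → HasValue q M ρ → Matches M ρ
    complete′ M ρ c≡q = from (holds-isCoef M (decode M (get ρ c))) (q , c≡q) ,
      (frac M q , frac-value M q (occurs M ρ c≡q)) , sign⇔ M ρ c≡q , num⇔ M ρ c≡q , den⇔ M ρ c≡q

  hasCoef-element : ∀ M u {i u′ u″} → decode M u ≡ polyE i → H M hasCoef (decode M u ∷ decode M u′ ∷ decode M u″ ∷ []) →
    ∃[ s ] ∃[ q ] decode M u′ ≡ monE s × decode M u″ ≡ coefE q × poly (system M) i s ≡ q
  hasCoef-element M u {i} {u′} {u″} u≡i h = by-elements (decode M u′) (decode M u″)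
    (subst (λ el → H M hasCoef (el ∷ decode M u′ ∷ decode M u″ ∷ [])) u≡i h)
    where
    by-elements : ∀ el′ el″ → H M hasCoef (polyE i ∷ el′ ∷ el″ ∷ []) →
      ∃[ s ] ∃[ q ] el′ ≡ monE s × el″ ≡ coefE q × poly (system M) i s ≡ q
    by-elements (monE s)  (coefE q) eq = s , q , refl , refl , eq
    by-elements (monE _)  (polyE _) ()
    by-elements (monE _)  (monE _)  ()
    by-elements (monE _)  (varE _)  ()
    by-elements (monE _)  (posE _)  ()
    by-elements (polyE _) _         ()
    by-elements (varE _)  _         ()
    by-elements (coefE _) _         ()
    by-elements (posE _)  _         ()

  holds-isPoly : ∀ M el → H M isPoly (el ∷ []) ⇔ (∃[ i ] el ≡ polyE i)
  holds-isPoly M (polyE i) = mk⇔ (λ _ → i , refl) (λ _ → tt)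
  holds-isPoly M (varE _)  = mk⇔ (λ ()) λ ()
  holds-isPoly M (monE _)  = mk⇔ (λ ()) λ ()
  holds-isPoly M (coefE _) = mk⇔ (λ ()) λ ()
  holds-isPoly M (posE _)  = mk⇔ (λ ()) λ ()

  -- A `hasCoef` triple in the structure always carries a nonzero coefficient. A violated degree
  -- bound thus appears as a triple whose monomial has `suc k` variables, while zero entries fall to
  -- `from-nonzero`.
  axiomEntry-definable : ∀ a → DefinableF (λ M ρ → axiomEntry M (decode M (get ρ x)) (named M (blk a ρ)))
  axiomEntry-definable a = from-nonzero λ q q≢0 → definable-resp (λ M ρ → mk⇔ (sound q M ρ) (complete′ q q≢0 M ρ))
    (×-definable (atom-definable isPoly (x ∷ [])) (×-definable
      (¬-definable (ex-definable m (ex-definable c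
        (×-definable (atom-definable hasCoef (x ∷ m ∷ c ∷ [])) (card-definable monomialSet (suc k))))))
      (ex-definable m (ex-definable c
        (×-definable (atom-definable hasCoef (x ∷ m ∷ c ∷ [])) (×-definable (equals-definable monomialSet a) (value-definable q)))))))
    where
    High Entry : (M : Model) → Env (Uni M) → ℚ → Set
    High M ρ _ = ∃[ u ] ∃[ w ] H M hasCoef (decode M (get ρ x) ∷ decode M u ∷ decode M w ∷ []) × suc k ≤ ∣ support {M} (decode M u) ∣
    Entry M ρ q = ∃[ u ] ∃[ w ] H M hasCoef (decode M (get ρ x) ∷ decode M u ∷ decode M w ∷ []) ×
      support {M} (decode M u) ≡ named M (blk a ρ) × decode M w ≡ coefE q
    module _ (M : Model) (ρ : Env (Uni M)) {i : Fin (#polys (system M))} (x≡i : decode M (get ρ x) ≡ polyE i) where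
      p : Poly (#vars (system M))
      p = poly (system M) i
      entry : ∀ s → p s ≢ 0ℚ → ∃[ u ] ∃[ w ] decode M u ≡ monE s × decode M w ≡ coefE (p s) ×
        H M hasCoef (decode M (get ρ x) ∷ decode M u ∷ decode M w ∷ [])
      entry s ps≢0 = proj₁ mon , proj₁ coef , proj₂ mon , proj₂ coef ,
        subst (λ el → H M hasCoef (el ∷ decode M (proj₁ mon) ∷ decode M (proj₁ coef) ∷ [])) (sym x≡i)
          (subst (λ el → H M hasCoef (polyE i ∷ el ∷ decode M (proj₁ coef) ∷ [])) (sym (proj₂ mon))
            (subst (λ el → H M hasCoef (polyE i ∷ monE s ∷ el ∷ [])) (sym (proj₂ coef)) refl))
        where
        mon = decode-covers M (monE s) (i , ps≢0)
        coef = decode-covers M (coefE (p s)) (ps≢0 , i , s , refl)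
      high⁺ : ∀ s → k < ∣ s ∣ → p s ≢ 0ℚ → High M ρ 0ℚ
      high⁺ s k< ps≢0 = let u , w , u≡s , _ , h = entry s ps≢0 in
        u , w , h , subst (λ el → suc k ≤ ∣ support {M} el ∣) (sym u≡s) k<
      high⁻ : Degree≤ k p → ¬ High M ρ 0ℚ
      high⁻ deg (u , w , h , k<) = let s , q , u≡s , w≡q , ps≡q = hasCoef-element M (get ρ x) x≡i h in
        proj₁ (subst (Occurs (system M) (L M)) w≡q (decode-occurs M w))
          (trans (sym ps≡q) (deg s (subst (λ el → suc k ≤ ∣ support {M} el ∣) u≡s k<)))
      degree : ¬ High M ρ 0ℚ → Degree≤ k p
      degree low s k< with p s ℚₚ.≟ 0ℚ
      ... | yes eq = eq
      ... | no neq = contradiction (high⁺ s k< neq) low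
      entry⁻ : ∀ q → Entry M ρ q → p (named M (blk a ρ)) ≡ q
      entry⁻ q (u , w , h , s≡ , w≡q) with hasCoef-element M (get ρ x) x≡i h
      ... | s , q′ , u≡s , w≡q′ , ps≡q′ with refl ← trans (sym w≡q) w≡q′ =
        trans (cong p (trans (sym s≡) (cong (support {M}) u≡s))) ps≡q′
      entry⁺ : ∀ q → q ≢ 0ℚ → p (named M (blk a ρ)) ≡ q → Entry M ρ q
      entry⁺ q q≢0 ps≡q = let u , w , u≡s , w≡ , h = entry (named M (blk a ρ)) (λ eq → q≢0 (trans (sym ps≡q) eq)) in
        u , w , h , cong (support {M}) u≡s , trans w≡ (cong coefE ps≡q)
    sound : ∀ q M ρ → H M isPoly (decode M (get ρ x) ∷ []) × ¬ High M ρ q × Entry M ρ q →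
      axiomEntry M (decode M (get ρ x)) (named M (blk a ρ)) ≡ q
    sound q M ρ (ispoly , low , e) = trans (cong (λ el → axiomEntry M el s) x≡i)
      (trans (cong (if_then p M ρ x≡i s else 0ℚ) (dec-true (degree≤? k (p M ρ x≡i)) (degree M ρ x≡i low))) (entry⁻ M ρ x≡i q e))
      where
      s = named M (blk a ρ)
      x≡i = proj₂ (to (holds-isPoly M (decode M (get ρ x))) ispoly)
    complete′ : ∀ q → q ≢ 0ℚ → ∀ M ρ → axiomEntry M (decode M (get ρ x)) (named M (blk a ρ)) ≡ q →
      H M isPoly (decode M (get ρ x) ∷ []) × ¬ High M ρ q × Entry M ρ q
    complete′ q q≢0 M ρ = by-element (decode M (get ρ x)) refl
      where
      s = named M (blk a ρ)
      by-element : ∀ el → decode M (get ρ x) ≡ el → axiomEntry M el s ≡ q →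
        H M isPoly (decode M (get ρ x) ∷ []) × ¬ High M ρ q × Entry M ρ q
      by-element (monE _)  _ eq = contradiction (sym eq) q≢0
      by-element (varE _)  _ eq = contradiction (sym eq) q≢0
      by-element (coefE _) _ eq = contradiction (sym eq) q≢0
      by-element (posE _)  _ eq = contradiction (sym eq) q≢0
      by-element (polyE i) x≡i eq = by-degree (degree≤? k (p M ρ x≡i)) eq
        where
        by-degree : (d? : Dec (Degree≤ k (p M ρ x≡i))) → (if does d? then p M ρ x≡i s else 0ℚ) ≡ q →
          H M isPoly (decode M (get ρ x) ∷ []) × ¬ High M ρ q × Entry M ρ q
        by-degree (no _)    eq = contradiction (sym eq) q≢0
        by-degree (yes deg) eq = from (holds-isPoly M (decode M (get ρ x))) (i , x≡i) , high⁻ M ρ x≡i deg , entry⁺ M ρ x≡i q q≢0 eq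

  -- Matrices

  MatrixFamily : Set
  MatrixFamily = (M : Model) → Uni M → Matrix (Vec (Uni M) k) (Vec (Uni M) k)

  -- The block c is available for bound variables.
  record DefinableM (T : MatrixFamily) : Set₁ where
    constructor at-blocks
    field
      at : ∀ {a b c} → a ≢ b → a ≢ c → b ≢ c → DefinableF (λ M ρ → T M (get ρ x) (blk a ρ) (blk b ρ))

  open DefinableM

  private variable
    S T : MatrixFamily

  blk-setBlk : ∀ {U : Set} (ρ : Env U) a v → blk a (setBlk ρ a v) ≡ v
  blk-setBlk ρ a v = Vecₚ.lookup∘updateAt a (tuple ρ)

  blk-setBlk′ : ∀ {U : Set} (ρ : Env U) {a c} v → a ≢ c → blk a (setBlk ρ c v) ≡ blk a ρ
  blk-setBlk′ ρ {a} {c} v a≢c = Vecₚ.lookup∘updateAt′ a c a≢c (tuple ρ)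

  mapM₁-definable : ∀ h → DefinableM T → DefinableM (λ M u a b → h (T M u a b))
  mapM₁-definable h d .at ab ac bc = map₁-definable h (d .at ab ac bc)

  mapM₂-definable : ∀ h → DefinableM S → DefinableM T → DefinableM (λ M u a b → h (S M u a b) (T M u a b))
  mapM₂-definable h d d′ .at ab ac bc = map₂-definable h (d .at ab ac bc) (d′ .at ab ac bc)

  ᵀ-definable : DefinableM T → DefinableM (λ M u → T M u ᵀ)
  ᵀ-definable d .at ab ac bc = d .at (ab ∘ sym) bc ac

  constM-definable : ∀ q → DefinableM (λ _ _ _ _ → q)
  constM-definable q .at _ _ _ = const-definable q

  -- The summation uses block `c`. In the left factor block `b` becomes the spare one, in the right
  -- factor block `a`. Since families are definable at every arrangement of the three blocks, nested
  -- products need no further variables.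
  ∙-definable : DefinableM S → DefinableM T → DefinableM (λ M u → S M u ∙[ tuples M ] T M u)
  ∙-definable {S} {T} d d′ .at {a} {b} {c} ab ac bc = definableF-resp (λ M ρ → ∑-cong (elements (tuples M)) λ v →
      cong₂ ℚ._*_ (cong₂ (S M (get ρ x)) (blk-setBlk′ ρ v ac) (blk-setBlk ρ c v))
                  (cong₂ (T M (get ρ x)) (blk-setBlk ρ c v) (blk-setBlk′ ρ v bc)))
    (block-sum-definable c (map₂-definable ℚ._*_ (d .at ac ab (bc ∘ sym)) (d′ .at (bc ∘ sym) (ac ∘ sym) (ab ∘ sym))))

  row-sum-definable : DefinableM T → DefinableM (λ M u a _ → sum (tuples M) λ v → T M u a v)
  row-sum-definable {T} d .at {a} {b} {c} ab ac bc = definableF-resp (λ M ρ → ∑-cong (elements (tuples M)) λ v →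
      cong₂ (T M (get ρ x)) (blk-setBlk′ ρ v ac) (blk-setBlk ρ c v))
    (block-sum-definable c (d .at ac ab (bc ∘ sym)))

  -- Here `x` is bound along with block `c`. The result does not depend on it, so `x` can be reused
  -- by the next `step`.
  gram-definable : DefinableM T →
    DefinableM (λ M _ → gram (cartesian (universe M) (tuples M)) λ (u , d) b → T M u d b)
  gram-definable {T} d .at {a} {b} {c} ab ac bc = definableF-resp (λ M ρ → trans
      (∑-cong (elements (universe M)) λ u → ∑-cong (elements (tuples M)) λ v → cong₂ ℚ._*_
        (cong₂ (T M u) (blk-setBlk (upd ρ x u) c v) (blk-setBlk′ (upd ρ x u) v ac))
        (cong₂ (T M u) (blk-setBlk (upd ρ x u) c v) (blk-setBlk′ (upd ρ x u) v bc)))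
      (sym (∑-cartesianProductWith _,_ (elements (universe M)) (elements (tuples M))
        (λ (u , d) → T M u d (blk a ρ) ℚ.* T M u d (blk b ρ)))))
    (sum-definable x (block-sum-definable c (map₂-definable ℚ._*_
      (d .at (ac ∘ sym) (bc ∘ sym) ab) (d .at (bc ∘ sym) (ac ∘ sym) (ab ∘ sym)))))

  poly₀-definable : ∀ r → DefinableM T → DefinableM (λ M u → poly₀ (tuples M) r (T M u))
  poly₀-definable []      d = constM-definable 0ℚ
  poly₀-definable (q ∷ r) d = mapM₂-definable (λ s t → q ℚ.* s ℚ.+ t) d (∙-definable d (poly₀-definable r d))

  same-definable : DefinableM (λ M _ a b → indicator (≡-dec Boolₚ._≟_ (named M a) (named M b)))
  same-definable .at {a} {b} _ _ _ = indicator-definable (λ M ρ → ≡-dec Boolₚ._≟_ (named M (blk a ρ)) (named M (blk b ρ)))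
    (equals-definable (tupleSet a) b)

  multiplicity-definable : DefinableM (λ M _ a _ → multiplicity M a)
  multiplicity-definable = row-sum-definable (ᵀ-definable same-definable)

  adjoin-varE : ∀ M ρ {B : Mon M → Set} s →
    (H M isVar (decode M (get ρ x) ∷ []) × B (adjoin {M} (decode M (get ρ x)) s)) ⇔
    (∃[ v ] decode M (get ρ x) ≡ varE v × B (s ∪ ⁅ v ⁆))
  adjoin-varE M ρ {B} s = mk⇔
    (λ (isvar , h) → let v , eq = to (holds-isVar M (decode M (get ρ x))) isvar in v , eq , subst (λ el → B (adjoin {M} el s)) eq h)
    (λ (v , eq , h) → from (holds-isVar M (decode M (get ρ x))) (v , eq) , subst (λ el → B (adjoin {M} el s)) (sym eq) h)

  times-definable : DefinableM (λ M u → times M u)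
  times-definable = mapM₂-definable {S = λ M u a b → indicator (adjoins? M u a b)} ℚ._*_
    (at-blocks λ {a} {b} _ _ _ → indicator-definable (λ M ρ → adjoins? M (get ρ x) (blk a ρ) (blk b ρ))
      (definable-resp (λ M ρ → adjoin-varE M ρ {λ s → s ≡ named M (blk b ρ)} (named M (blk a ρ)))
        (×-definable (atom-definable isVar (x ∷ [])) (equals-definable (adjoinSet a) b))))
    (mapM₁-definable inverse multiplicity-definable)

  mask-definable : DefinableM T → DefinableM (λ M u → mask M u (T M u))
  mask-definable d = mapM₂-definable {T = λ M u _ b → indicator (exceeds? M u b)} ℚ._*_ d
    (at-blocks λ {a} {b} _ _ _ → indicator-definable (λ M ρ → exceeds? M (get ρ x) (blk b ρ))
      (definable-resp (λ M ρ → adjoin-varE M ρ {λ s → k < ∣ s ∣} (named M (blk b ρ)))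
        (×-definable (atom-definable isVar (x ∷ [])) (card-definable (adjoinSet b) (suc k)))))

  ⊖-definable : DefinableM S → DefinableM T → DefinableM (λ M u → S M u ⊖ T M u)
  ⊖-definable = mapM₂-definable (λ s t → s ℚ.+ ℚ.- t)

  restrict-definable : ∀ r → DefinableM T → DefinableM (λ M u → restrict M u r (T M u))
  restrict-definable r d = ⊖-definable d (∙-definable
    (poly₀-definable r (∙-definable (mask-definable d) (ᵀ-definable (mask-definable d)))) d)

  gate-definable : DefinableM T → DefinableM (λ M u a _ → gate M u (T M u) a)
  gate-definable d = mapM₁-definable isZero
    (row-sum-definable (mapM₂-definable ℚ._*_ (mask-definable d) (mask-definable d)))

  shift-definable : ∀ r → DefinableM T → DefinableM (λ M u d b → shift M r (T M u) (u , d) b)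
  shift-definable r d = mapM₂-definable ℚ._*_ (gate-definable (restrict-definable r d))
    (∙-definable (restrict-definable r d) times-definable)

  code-definable : ∀ C → DefinableM (λ M _ → ⟦_⟧ M C)
  code-definable base = gram-definable {T = λ M u d b → axioms M (u , d) b} (at-blocks λ {a} {b} _ _ _ → axiomEntry-definable b)
  code-definable (join C D) = mapM₂-definable ℚ._+_
    (∙-definable (ᵀ-definable (code-definable C)) (code-definable C))
    (∙-definable (ᵀ-definable (code-definable D)) (code-definable D))
  code-definable (step C r) = gram-definable {T = λ M u d b → shift M r (⟦_⟧ M C) (u , d) b}
    (shift-definable {T = λ M _ → ⟦_⟧ M C} r (code-definable C))

  unit-definable : DefinableM (λ M _ _ b → unit M b)
  unit-definable .at {b = b} _ _ _ = indicator-definable (λ M ρ → ≡-dec Boolₚ._≟_ ∅ (named M (blk b ρ))) (equals-definable emptySet b)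

  residue-definable : ∀ C r → DefinableM (λ M _ _ b → residue M C r b)
  residue-definable C r = ⊖-definable (∙-definable unit-definable (poly₀-definable r (code-definable C))) unit-definable

  test-definable : ∀ C r → DefinableF (λ M ρ → test M C r)
  test-definable C r = row-sum-definable (mapM₂-definable ℚ._*_ (residue-definable C r) (residue-definable C r)) .at
    {0F} {1F} {2F} (λ ()) (λ ()) (λ ())

  -- The first conjunct secures the polynomial on which the correctness of the codes relies.
  Accepted : Property
  Accepted M ρ = (∃[ u ] H M isPoly (decode M u ∷ [])) × (Σ[ (C , r) ∈ Code × List ℚ ] test M C r ≡ 0ℚ)

  accepted-definable : Definable Accepted
  accepted-definable = ×-definable (ex-definable x (atom-definable isPoly (x ∷ [])))
    (∃-definable {I = Code × List ℚ} λ (C , r) → test-definable C r 0ℚ)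

-- The sentence and the number of its variables

module Sentence (k : ℕ) where

  open Definability k
  open Atoms k

  sentence : Formula systemSignature width
  sentence = closure (allFin width) (formula accepted-definable)

  satisfied⇒refutable : ∀ P A → Encodes A P → A ⊨ sentence → Refutable k P
  satisfied⇒refutable P A E sat =
    let M = record { system = P ; structure = A ; encoding = E }
        -- Satisfaction quantifies over assignments, so one has to be exhibited; the constant
        -- assignment exists as the universe is nonempty.
        β , sat-β = closure-elim A (formula accepted-definable) (allFin width) _ (sat λ _ → element (size A) {{nonEmpty A}})
        (u , ispoly) , (C , r) , test≡0 = to (correct accepted-definable M β) sat-β
        i , _ = to (holds-isPoly M (Encodes.decode E u)) ispoly
    in Matrices.Correctness.test⇒refutable k E i C r test≡0
    where
    element : ∀ n → {{ℕ.NonZero n}} → Fin n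
    element (suc n) = zero

  refutable⇒satisfied : ∀ P A → Encodes A P → Refutable k P → A ⊨ sentence
  refutable⇒satisfied P A E d = closure-intro A (formula accepted-definable) (allFin width) λ α →
    let M = record { system = P ; structure = A ; encoding = E }
        i = refutable⇒poly d
        u , u≡i = Encodes.decode-covers E (polyE i) tt
        C , r , test≡0 = Matrices.Correctness.refutable⇒test k E i d
    in from (correct accepted-definable M α)
      ((u , from (holds-isPoly M (Encodes.decode E u)) (i , u≡i)) , (C , r) , test≡0)

  sentence-closed : IsSentence sentence
  sentence-closed = closure-sentence (formula accepted-definable)

  -- The six single variables are absorbed by `6 = 3 · 2 ≤ 3 · k`, whence the constant 6.
  width≤ : 2 ≤ k → width ≤ 6 ℕ.* k
  width≤ 2≤k = begin
    3 ℕ.* k ℕ.+ 3 ℕ.* 2  ≤⟨ ℕₚ.+-monoʳ-≤ (3 ℕ.* k) (ℕₚ.*-monoʳ-≤ 3 2≤k) ⟩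
    3 ℕ.* k ℕ.+ 3 ℕ.* k  ≡⟨ ℕₚ.*-distribʳ-+ k 3 3 ⟨
    6 ℕ.* k              ∎
    where open ℕₚ.≤-Reasoning

open import Data.Nat.Base using (_*_)

theorem4p10 : ∃[ c ] (∀ (k : ℕ) → 2 ≤ k →
    ∃[ w ] (w ≤ c * k × (Σ[ φ ∈ Formula systemSignature w ] (IsSentence φ ×
    (∀ (P : System) (A : Structure systemSignature) → Encodes A P →
    (A ⊨ φ) ⇔ Refutable k P)))))
theorem4p10 = 6 , λ k 2≤k → let open Sentence k in
  Definability.width k , width≤ 2≤k , sentence , sentence-closed ,
  λ P A E → mk⇔ (satisfied⇒refutable P A E) (refutable⇒satisfied P A E)
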